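{- Let $s \geq 4$, let $m \in \mathbb{N}$, and let $A \subseteq S_{3,m}$. Then for every $\epsilon>0$, \[ r_{s}(A) \ll_{s,\epsilon} m^{\epsilon} |A|^{s-3 + 1/2 + \lambda_{s} }, \] where $\lambda_{s} = 2^{ -1} 3^{ -s/2 + 2}$ when $s$ is even, and $\lambda_{s} = 10^{ -1} \cdot 3^{ -(s-1)/2+3}$ when $s$ is odd.
   Context: $S_{3,m} = \{\mathbf{x} \in \mathbb{Z}^3 : x_1^2+x_2^2+x_3^2 = m\}$. For $\mathbf{n} \in \mathbb{R}^3$, $r_s(A,\mathbf{n})$ is the number of tuples $(\mathbf{x}_1,\dots,\mathbf{x}_s) \in A^s$ with $\mathbf{x}_1+\dots+\mathbf{x}_s = \mathbf{n}$, and $r_s(A) = \sup_{\mathbf{n}} r_s(A,\mathbf{n})$. The notation $X \ll_{z} Y$ means $|X| \leq C_z Y$ for a positive constant $C_z$ depending only on $z$. -}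

module Defs where

open import Data.Nat as ℕ using (ℕ; zero; suc; NonZero; _^_; _%_)
open import Data.Integer as ℤ using (ℤ; +_)
open import Data.Rational as ℚ using (ℚ)
open import Data.Nat.Properties as ℕₚ using ()
open import Data.Product using (_×_; _,_)
open import Data.Product.Properties using (≡-dec)
open import Data.List using (List; []; _∷_; map; concatMap; filter; length)
open import Relation.Binary.PropositionalEquality using (_≡_)
open import Relation.Binary using (DecidableEquality)

Point : Set
Point = ℤ × ℤ × ℤ

_≟P_ : DecidableEquality Point
_≟P_ = ≡-dec ℤ._≟_ (≡-dec ℤ._≟_ ℤ._≟_)

origin : Point
origin = (+ 0 , + 0 , + 0)

_⊕_ : Point → Point → Point
(a , b , c) ⊕ (x , y , z) = (a ℤ.+ x , b ℤ.+ y , c ℤ.+ z)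

normSq : Point → ℤ
normSq (a , b , c) = a ℤ.* a ℤ.+ b ℤ.* b ℤ.+ c ℤ.* c

InS3 : ℕ → Point → Set
InS3 m x = normSq x ≡ + m

tuples : ℕ → List Point → List (List Point)
tuples zero A = [] ∷ []
tuples (suc s) A = concatMap (λ x → map (x ∷_) (tuples s A)) A

sumP : List Point → Point
sumP [] = origin
sumP (x ∷ xs) = x ⊕ sumP xs

rep : ℕ → List Point → Point → ℕ
rep s A n = length (filter (λ t → sumP t ≟P n) (tuples s A))

-- λ_s = 2⁻¹ 3^{-s/2+2} = 9 / (2·3^{s/2}) for s even,
-- λ_s = 10⁻¹ 3^{-(s-1)/2+3} = 27 / (10·3^{(s-1)/2}) for s odd
-- (ℕ._/_ is floor division, so s / 2 = (s-1)/2 for odd s)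
lam : ℕ → ℚ
lam s with s % 2
... | zero = (+ 9) ℚ./ (2 ℕ.* 3 ^ (s ℕ./ 2))
  where instance _ : NonZero (2 ℕ.* 3 ^ (s ℕ./ 2))
                 _ = ℕₚ.m*n≢0 2 (3 ^ (s ℕ./ 2)) {{_}} {{ℕₚ.m^n≢0 3 (s ℕ./ 2)}}
... | suc _ = (+ 27) ℚ./ (10 ℕ.* 3 ^ (s ℕ./ 2))
  where instance _ : NonZero (10 ℕ.* 3 ^ (s ℕ./ 2))
                 _ = ℕₚ.m*n≢0 10 (3 ^ (s ℕ./ 2)) {{_}} {{ℕₚ.m^n≢0 3 (s ℕ./ 2)}}

expo : ℕ → ℚ
expo s = (((+ s) ℚ./ 1) ℚ.- ((+ 3) ℚ./ 1)) ℚ.+ ((+ 1) ℚ./ 2) ℚ.+ lam s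

-- "x ≤ C · m^ε · a^e" for nonnegative rational exponents ε, e, stated without
-- reals: for every common-denominator representation ε = p/d, e = q/d,
-- x^d ≤ C^d · m^p · a^q.
BoundPow : (x C m a : ℕ) (ε e : ℚ) → Set
BoundPow x C m a ε e =
  (d p q : ℕ) .{{_ : NonZero d}} → ε ≡ (+ p) ℚ./ d → e ≡ (+ q) ℚ./ d →
  x ^ d ℕ.≤ C ^ d ℕ.* m ^ p ℕ.* a ^ q

{-# OPTIONS --safe #-}
-- Let r_t(n) be the number of t-tuples of A with sum n and E_t = Σ r_t(n)². Then r_{t+1}(n) counts incidences between t-fold sums u
-- and the sphere of radius √m about n. Two such spheres share only m^o(1) lattice points, because a lattice circle becomes a conic
-- x² + D y² = N, whose points are controlled by divisors of N. Space is not cut geometrically but into residue classes modulo q: a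
-- sphere meets q^(2+o(1)) of the q³ classes, while a pair (n , u) off the sphere has |n − u|² ≡ m mod q for only m^o(1) moduli, so
-- that for some q in (D , 2D] a class meets about 1/D of the spheres. Kővári–Sós–Turán within each class and the choice of D give
-- E_{t+1}³ ≪ m^ε |A|^(4t+1) E_t and r_{2t+1}(n)⁵ ≪ m^ε |A|^(4t) E_t³ (up to smaller terms), starting from E_2 ≪ m^ε |A|².
module Submission where

open import Defs
open import Data.Nat
open import Data.Nat.Properties
open import Data.Nat.Divisibility using (_∣_; _∣?_; divides; ∣-trans; ∣-refl; ∣⇒≤; ∣m∣n⇒∣m+n; ∣m+n∣m⇒∣n; *-cancelʳ-∣; ∣m⇒∣m*n; ∣n⇒∣m*n; *-cancelˡ-∣; *-monoʳ-∣; *-monoˡ-∣; *-pres-∣; m∣m*n; n∣m*n; 1∣_; ∣1⇒≡1; 0∣⇒≡0)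
open import Data.Nat.DivMod using (_/_; _%_; m≡m%n+[m/n]*n; m%n<n; m<n*o⇒m/o<n; [m+kn]%n≡m%n)
open import Data.Nat.GCD using (gcd; gcd[m,n]∣m; gcd[m,n]∣n; gcd-greatest; c*gcd[m,n]≡gcd[cm,cn])
open import Data.Nat.Coprimality using (Coprime; coprime-divisor; coprime-factors)
open import Data.Nat.Primality using (Prime; prime⇒irreducible; prime⇒nonZero; prime⇒nonTrivial; _Rough_; rough∧∣⇒prime; rough⇒≤; rough∧∣⇒rough; ∤⇒rough-suc; 2-rough)
open import Data.Nat.Primality.Factorisation using (factorise; module PrimeFactorisation)
open import Data.Nat.Induction using (<-rec)
open import Data.Nat.Tactic.RingSolver using () renaming (solve-∀ to ℕ-ring)
open import Data.Integer.Tactic.RingSolver using () renaming (solve-∀ to ℤ-ring)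
import Data.Integer as ℤ
import Data.Integer.Properties as ℤₚ
import Data.Integer.DivMod as ℤDM
import Data.Integer.Divisibility.Signed as ℤD
open import Data.Integer using (ℤ; +_; -[1+_]; ∣_∣; sign) renaming (_+_ to _+ᶻ_; _*_ to _*ᶻ_; _-_ to _-ᶻ_; -_ to -ᶻ_)
open import Data.Sign using (Sign)
import Data.Sign.Properties as Signₚ
import Data.Rational as ℚ
import Data.Rational.Properties as ℚₚ
open import Data.Rational using (ℚ; 0ℚ)
import Data.Rational.Unnormalised as ℚᵘ
open ℚᵘ using (ℚᵘ; mkℚᵘ; *≡*)
import Data.Rational.Unnormalised.Properties as ℚᵘₚ
open import Data.Product using (Σ; ∃; _×_; _,_; proj₁; proj₂)
open import Data.Product.Properties using (≡-dec)
open import Data.Sum using (_⊎_; inj₁; inj₂)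
open import Data.List using (List; []; _∷_; _++_; map; concatMap; filter; length; upTo; cartesianProduct)
open import Data.List.Properties using (length-map; length-upTo)
open import Data.List.Relation.Unary.All using (All; []; _∷_)
import Data.List.Relation.Unary.All as All
import Data.List.Relation.Unary.All.Properties as Allₚ
open import Data.List.Relation.Unary.Any using (here; there)
open import Data.List.Relation.Unary.AllPairs using ([]; _∷_)
open import Data.List.Relation.Unary.Unique.Propositional using (Unique)
import Data.List.Relation.Unary.Unique.Propositional.Properties as Uniqueₚ
open import Data.List.Membership.Propositional using (_∈_)
open import Data.List.Membership.Propositional.Properties using (∈-filter⁺; ∈-filter⁻; ∈-map⁺; ∈-map⁻; ∈-upTo⁺; ∈-upTo⁻; ∈-cartesianProduct⁺; ∈-cartesianProduct⁻)
open import Relation.Nullary using (¬_; Dec; yes; no; contradiction)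
open import Relation.Nullary.Decidable using (_×-dec_; ¬?)
open import Relation.Unary using () renaming (Decidable to Decidable₁)
open import Relation.Binary using (DecidableEquality)
open import Relation.Binary.PropositionalEquality
open import Function using (_∘_; id)

-- Finite sums and counting

-- The Kővári-Sós-Turán count loses on the diagonal u = u′, in proportion to the largest weight H.
-- Therefore r_t is cut into dyadic levels, on each of which H times the total weight is at most 2
-- E_t; this is how E_t enters the recursion. The origin is set apart because r_2(0) can be as large
-- as |A|, while r_2(u) ≪ m^ε for u ≠ 0. A pair (n , u) on the sphere is seen by every modulus, so
-- the average over q in (D , 2D] gains 1/D only as long as D ≤ |A|; this cap produces one of the
-- smaller terms.
--
-- The exponents: if E_t has exponent e = 2t - 5/2 + δ, then (4t + 1 + e)/3 = 2(t+1) - 5/2 + δ/3, so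
-- each step divides the defect δ by 3. From δ = 1/2 at t = 2 it becomes 9/(2·3^t) = λ_{2t}, and
-- r_{2t} ≤ E_t settles even s. For odd s, (4t + 3e)/5 = 2t - 3/2 + 3δ/5, and 3δ/5 = 27/(10·3^t) =
-- λ_{2t+1}.

private variable
  X Y L : Set

∑ : List X → (X → ℕ) → ℕ
∑ []       f = 0
∑ (x ∷ xs) f = f x + ∑ xs f

infix 5 ∑
syntax ∑ xs (λ x → e) = ∑[ x ∈ xs ] e

⟦_⟧ : {P : Set} → Dec P → ℕ
⟦ yes _ ⟧ = 1
⟦ no _ ⟧  = 0

⟦⟧-yes : {P : Set} (d : Dec P) → P → ⟦ d ⟧ ≡ 1
⟦⟧-yes (yes _) _ = refl
⟦⟧-yes (no ¬p) p = contradiction p ¬p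

⟦⟧-no : {P : Set} (d : Dec P) → ¬ P → ⟦ d ⟧ ≡ 0
⟦⟧-no (yes p) ¬p = contradiction p ¬p
⟦⟧-no (no _)  _  = refl

⟦⟧≤1 : {P : Set} (d : Dec P) → ⟦ d ⟧ ≤ 1
⟦⟧≤1 (yes _) = ≤-refl
⟦⟧≤1 (no _)  = z≤n

⟦⟧-mono : {P Q : Set} (d : Dec P) (e : Dec Q) → (P → Q) → ⟦ d ⟧ ≤ ⟦ e ⟧
⟦⟧-mono (yes p) (yes _) _ = ≤-refl
⟦⟧-mono (yes p) (no ¬q) f = contradiction (f p) ¬q
⟦⟧-mono (no _)  _       _ = z≤n

⟦⟧-cong : {P Q : Set} (d : Dec P) (e : Dec Q) → (P → Q) → (Q → P) → ⟦ d ⟧ ≡ ⟦ e ⟧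
⟦⟧-cong d e f g = ≤-antisym (⟦⟧-mono d e f) (⟦⟧-mono e d g)

⟦⟧*-≤ : {P : Set} (d : Dec P) (x : ℕ) → ⟦ d ⟧ * x ≤ x
⟦⟧*-≤ (yes _) x = ≤-reflexive (*-identityˡ x)
⟦⟧*-≤ (no _)  x = z≤n

⟦⟧-pos : {P : Set} (d : Dec P) → 1 ≤ ⟦ d ⟧ → P
⟦⟧-pos (yes p) _ = p

∑-mono∈ : (xs : List X) {f g : X → ℕ} → (∀ x → x ∈ xs → f x ≤ g x) → ∑ xs f ≤ ∑ xs g
∑-mono∈ []       h = z≤n
∑-mono∈ (x ∷ xs) h = +-mono-≤ (h x (here refl)) (∑-mono∈ xs λ y y∈ → h y (there y∈))

∑-mono : (xs : List X) {f g : X → ℕ} → (∀ x → f x ≤ g x) → ∑ xs f ≤ ∑ xs g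
∑-mono xs h = ∑-mono∈ xs λ x _ → h x

∑-cong∈ : (xs : List X) {f g : X → ℕ} → (∀ x → x ∈ xs → f x ≡ g x) → ∑ xs f ≡ ∑ xs g
∑-cong∈ []       h = refl
∑-cong∈ (x ∷ xs) h = cong₂ _+_ (h x (here refl)) (∑-cong∈ xs λ y y∈ → h y (there y∈))

∑-cong : (xs : List X) {f g : X → ℕ} → (∀ x → f x ≡ g x) → ∑ xs f ≡ ∑ xs g
∑-cong xs h = ∑-cong∈ xs λ x _ → h x

∑-+ : (xs : List X) (f g : X → ℕ) → ∑ xs (λ x → f x + g x) ≡ ∑ xs f + ∑ xs g
∑-+ []       f g = refl
∑-+ (x ∷ xs) f g rewrite ∑-+ xs f g = lemma (f x) (g x) (∑ xs f) (∑ xs g)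
  where
  lemma : ∀ a b c d → a + b + (c + d) ≡ a + c + (b + d)
  lemma = ℕ-ring

∑-*ˡ : (xs : List X) (c : ℕ) (f : X → ℕ) → ∑ xs (λ x → c * f x) ≡ c * ∑ xs f
∑-*ˡ []       c f = sym (*-zeroʳ c)
∑-*ˡ (x ∷ xs) c f rewrite ∑-*ˡ xs c f = sym (*-distribˡ-+ c (f x) (∑ xs f))

∑-*ʳ : (xs : List X) (c : ℕ) (f : X → ℕ) → ∑ xs (λ x → f x * c) ≡ ∑ xs f * c
∑-*ʳ xs c f = trans (∑-cong xs λ x → *-comm (f x) c) (trans (∑-*ˡ xs c f) (*-comm c (∑ xs f)))

∑-const : (xs : List X) (c : ℕ) → ∑ xs (λ _ → c) ≡ length xs * c
∑-const []       c = refl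
∑-const (x ∷ xs) c = cong (_+_ c) (∑-const xs c)

∑-bound : (xs : List X) {f : X → ℕ} {c : ℕ} → (∀ x → x ∈ xs → f x ≤ c) → ∑ xs f ≤ length xs * c
∑-bound xs {c = c} h = ≤-trans (∑-mono∈ xs h) (≤-reflexive (∑-const xs c))

∑-zero : (xs : List X) → ∑ xs (λ _ → 0) ≡ 0
∑-zero xs = trans (∑-const xs 0) (*-zeroʳ (length xs))

∑-swap : (xs : List X) (ys : List Y) (f : X → Y → ℕ) →
  ∑ xs (λ x → ∑ ys (f x)) ≡ ∑ ys (λ y → ∑ xs (λ x → f x y))
∑-swap []       ys f = sym (∑-zero ys)
∑-swap (x ∷ xs) ys f rewrite ∑-swap xs ys f = sym (∑-+ ys (f x) (λ y → ∑ xs (λ x → f x y)))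

∑-++ : (xs ys : List X) (f : X → ℕ) → ∑ (xs ++ ys) f ≡ ∑ xs f + ∑ ys f
∑-++ []       ys f = refl
∑-++ (x ∷ xs) ys f rewrite ∑-++ xs ys f = sym (+-assoc (f x) (∑ xs f) (∑ ys f))

∑-map : (h : X → Y) (xs : List X) (f : Y → ℕ) → ∑ (map h xs) f ≡ ∑ xs (f ∘ h)
∑-map h []       f = refl
∑-map h (x ∷ xs) f = cong (_+_ (f (h x))) (∑-map h xs f)

∑-concatMap : (h : X → List Y) (xs : List X) (f : Y → ℕ) →
  ∑ (concatMap h xs) f ≡ ∑ xs (λ x → ∑ (h x) f)
∑-concatMap h []       f = refl
∑-concatMap h (x ∷ xs) f =
  trans (∑-++ (h x) (concatMap h xs) f) (cong (_+_ (∑ (h x) f)) (∑-concatMap h xs f))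

∑-cartesianProduct : (xs : List X) (ys : List Y) (f : X × Y → ℕ) →
  ∑ (cartesianProduct xs ys) f ≡ ∑ xs (λ x → ∑ ys (λ y → f (x , y)))
∑-cartesianProduct []       ys f = refl
∑-cartesianProduct (x ∷ xs) ys f = trans (∑-++ (map (x ,_) ys) _ f)
  (cong₂ _+_ (∑-map (x ,_) ys f) (∑-cartesianProduct xs ys f))

∑-filter : {P : X → Set} (P? : Decidable₁ P) (xs : List X) (f : X → ℕ) →
  ∑ (filter P? xs) f ≡ ∑ xs (λ x → ⟦ P? x ⟧ * f x)
∑-filter P? []       f = refl
∑-filter P? (x ∷ xs) f with P? x
... | yes _ = cong₂ _+_ (sym (*-identityˡ (f x))) (∑-filter P? xs f)
... | no _  = ∑-filter P? xs f

length≡∑ : (xs : List X) → length xs ≡ ∑ xs (λ _ → 1)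
length≡∑ []       = refl
length≡∑ (x ∷ xs) = cong suc (length≡∑ xs)

length-filter≡∑ : {P : X → Set} (P? : Decidable₁ P) (xs : List X) →
  length (filter P? xs) ≡ ∑ xs (λ x → ⟦ P? x ⟧)
length-filter≡∑ P? xs = trans (length≡∑ (filter P? xs))
  (trans (∑-filter P? xs (λ _ → 1)) (∑-cong xs λ x → *-identityʳ ⟦ P? x ⟧))

∑*∑ : (xs : List X) (ys : List Y) (f : X → ℕ) (g : Y → ℕ) →
  ∑ xs f * ∑ ys g ≡ ∑ xs (λ x → ∑ ys (λ y → f x * g y))
∑*∑ xs ys f g = trans (sym (∑-*ʳ xs (∑ ys g) f)) (∑-cong xs λ x → sym (∑-*ˡ ys (f x) g))

length-cartesianProduct : (xs : List X) (ys : List Y) → length (cartesianProduct xs ys) ≡ length xs * length ys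
length-cartesianProduct xs ys = trans (length≡∑ (cartesianProduct xs ys)) (trans (∑-cartesianProduct xs ys _)
  (trans (∑-cong xs λ _ → trans (∑-const ys 1) (*-identityʳ _)) (∑-const xs (length ys))))

∑-member : (xs : List X) (f : X → ℕ) {x : X} → x ∈ xs → f x ≤ ∑ xs f
∑-member (x ∷ xs) f (here refl) = m≤m+n (f x) _
∑-member (y ∷ xs) f (there x∈) = ≤-trans (∑-member xs f x∈) (m≤n+m _ (f y))

∑-≡0 : (xs : List X) {f : X → ℕ} → (∀ x → x ∈ xs → f x ≡ 0) → ∑ xs f ≡ 0
∑-≡0 xs h = trans (∑-cong∈ xs h) (∑-zero xs)

module _ (_≟_ : DecidableEquality X) where

  ∑-δ : {xs : List X} → Unique xs → (f : X → ℕ) {x : X} → x ∈ xs →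
    ∑ xs (λ y → ⟦ x ≟ y ⟧ * f y) ≡ f x
  ∑-δ {y ∷ xs} (y∉ ∷ u) f {x} (here refl) with x ≟ x
  ... | no x≢x = contradiction refl x≢x
  ... | yes _  = trans (cong₂ _+_ (*-identityˡ (f x))
      (∑-≡0 xs λ z z∈ → cong (_* f z) (⟦⟧-no (x ≟ z) (All.lookup y∉ z∈)))) (+-identityʳ (f x))
  ∑-δ {y ∷ xs} (y∉ ∷ u) f {x} (there x∈) with x ≟ y
  ... | yes refl = contradiction refl (All.lookup y∉ x∈)
  ... | no _     = ∑-δ u f x∈

  ∑-δ-≤ : {xs : List X} → Unique xs → (f : X → ℕ) (x : X) →
    ∑ xs (λ y → ⟦ x ≟ y ⟧ * f y) ≤ f x
  ∑-δ-≤ {[]}     u f x = z≤n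
  ∑-δ-≤ {y ∷ xs} (y∉ ∷ u) f x with x ≟ y
  ... | yes refl = ≤-reflexive (trans (cong₂ _+_ (*-identityˡ (f x))
      (∑-≡0 xs λ z z∈ → cong (_* f z) (⟦⟧-no (x ≟ z) (All.lookup y∉ z∈)))) (+-identityʳ (f x)))
  ... | no _     = ∑-δ-≤ u f x

-- Cauchy-Schwarz and counting by labels

2t≤p+q : ∀ t p q → t * t ≤ p * q → 2 * t ≤ p + q
2t≤p+q t p q h = ≮⇒≥ λ lt → <⇒≱ (*-mono-< lt lt) (begin
  2 * t * (2 * t) ≡⟨ four t ⟩
  4 * (t * t) ≤⟨ *-monoʳ-≤ 4 h ⟩
  4 * (p * q) ≤⟨ amgm p q ⟩
  (p + q) * (p + q) ∎)
  where
  open ≤-Reasoning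
  four : ∀ t → 2 * t * (2 * t) ≡ 4 * (t * t)
  four = ℕ-ring
  expand : ∀ a b → (a + (a + b)) * (a + (a + b)) ≡ 4 * (a * (a + b)) + b * b
  expand = ℕ-ring
  amgm′ : ∀ a b → a ≤ b → 4 * (a * b) ≤ (a + b) * (a + b)
  amgm′ a b a≤b with b ∸ a | m+[n∸m]≡n a≤b
  ... | c | refl = ≤-trans (m≤m+n _ (c * c)) (≤-reflexive (sym (expand a c)))
  amgm : ∀ a b → 4 * (a * b) ≤ (a + b) * (a + b)
  amgm a b with ≤-total a b
  ... | inj₁ a≤b = amgm′ a b a≤b
  ... | inj₂ b≤a = subst₂ _≤_ (cong (_*_ 4) (*-comm b a)) (cong₂ _*_ (+-comm b a) (+-comm b a)) (amgm′ b a b≤a)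

-- The pointwise hypothesis f² ≤ g h replaces square roots. In the induction the cross term 2 f F is
-- at most g H + G h by AM-GM, because (f F)² ≤ (g H)(G h).
cauchy-schwarz : (xs : List X) {f g h : X → ℕ} → (∀ x → x ∈ xs → f x * f x ≤ g x * h x) →
  ∑ xs f * ∑ xs f ≤ ∑ xs g * ∑ xs h
cauchy-schwarz []       _ = z≤n
cauchy-schwarz (x ∷ xs) {f} {g} {h} b = begin
  (f x + F) * (f x + F) ≡⟨ sq (f x) F ⟩
  f x * f x + 2 * (f x * F) + F * F ≤⟨ +-mono-≤ (+-mono-≤ bx (2t≤p+q (f x * F) (g x * H) (G * h x) mixed)) ih ⟩
  g x * h x + (g x * H + G * h x) + G * H ≡⟨ foil (g x) (h x) G H ⟨
  (g x + G) * (h x + H) ∎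
  where
  open ≤-Reasoning
  F = ∑ xs f
  G = ∑ xs g
  H = ∑ xs h
  bx : f x * f x ≤ g x * h x
  bx = b x (here refl)
  ih : F * F ≤ G * H
  ih = cauchy-schwarz xs λ y y∈ → b y (there y∈)
  sq : ∀ a c → (a + c) * (a + c) ≡ a * a + 2 * (a * c) + c * c
  sq = ℕ-ring
  foil : ∀ a b c d → (a + c) * (b + d) ≡ a * b + (a * d + c * b) + c * d
  foil = ℕ-ring
  mixed : f x * F * (f x * F) ≤ g x * H * (G * h x)
  mixed = subst₂ _≤_ (interchange (f x) F) (interchange′ (g x) (h x) G H) (*-mono-≤ bx ih)
    where
    interchange : ∀ a c → a * a * (c * c) ≡ a * c * (a * c)
    interchange = ℕ-ring
    interchange′ : ∀ a b c d → a * b * (c * d) ≡ a * d * (c * b)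
    interchange′ = ℕ-ring

module _ (_≟_ : DecidableEquality L) where

  ∑-fibres : {xs : List X} {ls : List L} → Unique ls → (ℓ : X → L) → (∀ x → x ∈ xs → ℓ x ∈ ls) →
    (f : X → ℕ) → ∑ xs f ≡ ∑ ls (λ l → ∑ xs (λ x → ⟦ ℓ x ≟ l ⟧ * f x))
  ∑-fibres {xs = xs} {ls} u ℓ ℓ∈ f = trans
    (∑-cong∈ xs λ x x∈ → sym (∑-δ _≟_ u (λ _ → f x) (ℓ∈ x x∈)))
    (∑-swap xs ls λ x l → ⟦ ℓ x ≟ l ⟧ * f x)

  length≤fibres : (xs : List X) (ls : List L) {k : ℕ} (ℓ : X → L) → (∀ x → x ∈ xs → ℓ x ∈ ls) →
    (∀ l → l ∈ ls → length (filter (λ x → ℓ x ≟ l) xs) ≤ k) → length xs ≤ length ls * k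
  length≤fibres xs ls {k} ℓ ℓ∈ small = begin
    length xs ≡⟨ length≡∑ xs ⟩
    ∑ xs (λ _ → 1) ≤⟨ ∑-mono∈ xs (λ x x∈ → hit x (ℓ∈ x x∈)) ⟩
    ∑ xs (λ x → ∑ ls (λ l → ⟦ ℓ x ≟ l ⟧)) ≡⟨ ∑-swap xs ls _ ⟩
    ∑ ls (λ l → ∑ xs (λ x → ⟦ ℓ x ≟ l ⟧)) ≤⟨ ∑-bound ls (λ l l∈ → subst (_≤ k) (length-filter≡∑ (λ x → ℓ x ≟ l) xs) (small l l∈)) ⟩
    length ls * k ∎
    where
    open ≤-Reasoning
    hit : ∀ x → ℓ x ∈ ls → 1 ≤ ∑ ls (λ l → ⟦ ℓ x ≟ l ⟧)
    hit x ∈ls = subst (_≤ ∑ ls (λ l → ⟦ ℓ x ≟ l ⟧)) (⟦⟧-yes (ℓ x ≟ ℓ x) refl)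
      (∑-member ls (λ l → ⟦ ℓ x ≟ l ⟧) ∈ls)

  length≤-injective : (xs : List X) (ls : List L) → Unique xs → (ℓ : X → L) → (∀ x → x ∈ xs → ℓ x ∈ ls) →
    (∀ x y → x ∈ xs → y ∈ xs → ℓ x ≡ ℓ y → x ≡ y) → length xs ≤ length ls
  length≤-injective xs ls u ℓ ℓ∈ inj = subst (length xs ≤_) (*-identityʳ (length ls))
    (length≤fibres xs ls ℓ ℓ∈ λ l _ → collapse (Uniqueₚ.filter⁺ (λ x → ℓ x ≟ l) u)
      (λ x y x∈ y∈ → let (x∈xs , ex) = ∈-filter⁻ (λ x → ℓ x ≟ l) {xs = xs} x∈
                         (y∈xs , ey) = ∈-filter⁻ (λ x → ℓ x ≟ l) {xs = xs} y∈
                     in inj x y x∈xs y∈xs (trans ex (sym ey))))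
    where
    collapse : {zs : List X} → Unique zs → (∀ x y → x ∈ zs → y ∈ zs → x ≡ y) → length zs ≤ 1
    collapse {zs = []}         _ _ = z≤n
    collapse {zs = x ∷ []}     _ _ = ≤-refl
    collapse {zs = x ∷ y ∷ zs} ((x≢y ∷ _) ∷ _) eq = contradiction (eq x y (here refl) (there (here refl))) x≢y

  -- Each count is a sum over labels l of a product of two fibre sizes, so this is Cauchy-Schwarz in
  -- l. It serves twice: for the points of a slice of a sphere modulo q, and for r_{2t}(n) ≤ E_t.
  coincidences : {ls : List L} → Unique ls → (xs : List X) (ys : List Y) (α : X → L) (β : Y → L) →
    (∀ x → x ∈ xs → α x ∈ ls) → (∀ y → y ∈ ys → β y ∈ ls) →
    ∑ xs (λ x → ∑ ys λ y → ⟦ α x ≟ β y ⟧) * ∑ xs (λ x → ∑ ys λ y → ⟦ α x ≟ β y ⟧) ≤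
    ∑ xs (λ x → ∑ xs λ x′ → ⟦ α x ≟ α x′ ⟧) * ∑ ys (λ y → ∑ ys λ y′ → ⟦ β y ≟ β y′ ⟧)
  coincidences {ls = ls} u xs ys α β α∈ β∈ = subst₂ _≤_
    (cong₂ _*_ (sym (split xs ys α β α∈)) (sym (split xs ys α β α∈)))
    (cong₂ _*_ (sym (split xs xs α α α∈)) (sym (split ys ys β β β∈)))
    (cauchy-schwarz ls λ l _ → ≤-reflexive (interchange (N xs α l) (N ys β l)))
    where
    N : {Z : Set} → List Z → (Z → L) → L → ℕ
    N zs γ l = ∑ zs (λ z → ⟦ γ z ≟ l ⟧)
    interchange : ∀ a b → a * b * (a * b) ≡ a * a * (b * b)
    interchange = ℕ-ring
    flip≟ : ∀ a b → ⟦ a ≟ b ⟧ ≡ ⟦ b ≟ a ⟧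
    flip≟ a b = ⟦⟧-cong (a ≟ b) (b ≟ a) sym sym
    split : {Z W : Set} (zs : List Z) (ws : List W) (γ : Z → L) (δ : W → L) → (∀ z → z ∈ zs → γ z ∈ ls) →
      ∑ zs (λ z → ∑ ws λ w → ⟦ γ z ≟ δ w ⟧) ≡ ∑ ls (λ l → N zs γ l * N ws δ l)
    split zs ws γ δ γ∈ = trans (∑-fibres u γ γ∈ λ z → ∑ ws λ w → ⟦ γ z ≟ δ w ⟧)
      (∑-cong ls λ l → trans (∑-cong zs λ z → match l z) (∑-*ʳ zs (N ws δ l) λ z → ⟦ γ z ≟ l ⟧))
      where
      match : ∀ l z → ⟦ γ z ≟ l ⟧ * ∑ ws (λ w → ⟦ γ z ≟ δ w ⟧) ≡ ⟦ γ z ≟ l ⟧ * N ws δ l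
      match l z with γ z ≟ l
      ... | no _     = refl
      ... | yes refl = cong (_*_ 1) (∑-cong ws λ w → flip≟ (γ z) (δ w))

-- Powers of natural numbers

*-^ : ∀ m n k → (m * n) ^ k ≡ m ^ k * n ^ k
*-^ m n zero    = refl
*-^ m n (suc k) rewrite *-^ m n k = lemma m n (m ^ k) (n ^ k)
  where
  lemma : ∀ a b c d → a * b * (c * d) ≡ a * c * (b * d)
  lemma = ℕ-ring

^-cancelˡ-≤ : ∀ k {m n} .{{_ : NonZero k}} → m ^ k ≤ n ^ k → m ≤ n
^-cancelˡ-≤ k h = ≮⇒≥ λ lt → <⇒≱ (^-monoˡ-< k lt) h

1≤^ : ∀ {m} n → 1 ≤ m → 1 ≤ m ^ n
1≤^ {suc m} n _ = m^n>0 (suc m) n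

m≤m*n′ : ∀ m {n} → 1 ≤ n → m ≤ m * n
m≤m*n′ m {suc n} _ = m≤m*n m (suc n)

n<2^n : ∀ n → n < 2 ^ n
n<2^n zero    = s≤s z≤n
n<2^n (suc n) = ≤-trans (+-mono-≤ (1≤^ n (s≤s z≤n)) (n<2^n n)) (≤-reflexive (cong (_+_ (2 ^ n)) (sym (+-identityʳ (2 ^ n)))))

-- Writing a = qK + r gives a + 1 ≤ K(q + 1) ≤ K 2^q.
suc^≤2^ : ∀ K a → suc a ^ K ≤ K ^ K * 2 ^ a
suc^≤2^ zero    a = ≤-trans (1≤^ a (s≤s z≤n)) (≤-reflexive (sym (+-identityʳ (2 ^ a))))
suc^≤2^ K@(suc _) a = begin
  suc a ^ K ≤⟨ ^-monoˡ-≤ K bound ⟩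
  (K * 2 ^ (a / K)) ^ K ≡⟨ *-^ K (2 ^ (a / K)) K ⟩
  K ^ K * (2 ^ (a / K)) ^ K ≡⟨ cong (_*_ (K ^ K)) (^-*-assoc 2 (a / K) K) ⟩
  K ^ K * 2 ^ (a / K * K) ≤⟨ *-monoʳ-≤ (K ^ K) (^-monoʳ-≤ 2 (≤-trans (m≤n+m _ (a % K)) (≤-reflexive (sym (m≡m%n+[m/n]*n a K))))) ⟩
  K ^ K * 2 ^ a ∎
  where
  open ≤-Reasoning
  bound : suc a ≤ K * 2 ^ (a / K)
  bound = begin
    suc a ≡⟨ cong suc (m≡m%n+[m/n]*n a K) ⟩
    suc (a % K) + a / K * K ≤⟨ +-monoˡ-≤ _ (m%n<n a K) ⟩
    suc (a / K) * K ≤⟨ *-monoˡ-≤ K (n<2^n (a / K)) ⟩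
    2 ^ (a / K) * K ≡⟨ *-comm (2 ^ (a / K)) K ⟩
    K * 2 ^ (a / K) ∎

-- The divisor bound

divisors : ℕ → List ℕ
divisors n = filter (_∣? n) (map suc (upTo n))

#divisors : ℕ → ℕ
#divisors n = length (divisors n)

divisors-unique : ∀ n → Unique (divisors n)
divisors-unique n = Uniqueₚ.filter⁺ (_∣? n) (Uniqueₚ.map⁺ suc-injective (Uniqueₚ.upTo⁺ n))

∈-divisors⁺ : ∀ {i n} → 1 ≤ n → i ∣ n → i ∈ divisors n
∈-divisors⁺ {zero}  1≤n i∣n = contradiction (sym (0∣⇒≡0 i∣n)) (<⇒≢ 1≤n)
∈-divisors⁺ {suc i} {suc n} 1≤n i∣n = ∈-filter⁺ (_∣? suc n) (∈-map⁺ suc (∈-upTo⁺ (∣⇒≤ i∣n))) i∣n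

∈-divisors⁻ : ∀ {i n} → i ∈ divisors n → i ∣ n
∈-divisors⁻ {n = n} i∈ = proj₂ (∈-filter⁻ (_∣? n) {xs = map suc (upTo n)} i∈)

∣-pos : ∀ {i n} → 1 ≤ n → i ∣ n → 1 ≤ i
∣-pos {zero}  1≤n i∣n = contradiction (sym (0∣⇒≡0 i∣n)) (<⇒≢ 1≤n)
∣-pos {suc i} _   _   = s≤s z≤n

∤-prime⇒coprime : ∀ {p e} → Prime p → ¬ p ∣ e → Coprime e p
∤-prime⇒coprime pr p∤e (i∣e , i∣p) with prime⇒irreducible pr i∣p
... | inj₁ i≡1  = i≡1
... | inj₂ refl = contradiction i∣e p∤e

length-filter-split : {X : Set} {P : X → Set} (P? : Decidable₁ P) (xs : List X) →
  length xs ≡ length (filter P? xs) + length (filter (¬? ∘ P?) xs)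
length-filter-split P? [] = refl
length-filter-split P? (x ∷ xs) with P? x
... | yes _ = cong suc (length-filter-split P? xs)
... | no _  = trans (cong suc (length-filter-split P? xs)) (sym (+-suc _ _))

-- Divisors of p M that are multiples of p correspond to divisors of M; the others are collected in
-- the divisors of N. The free `N` allows two uses: N = M costs a factor 2, and for p^(a+1) M taking
-- N = M adds a single copy of `#divisors M`.
#divisors-prime-* : ∀ {p M} → Prime p → 1 ≤ M → (N : ℕ) → 1 ≤ N →
  (∀ {e} → ¬ p ∣ e → e ∣ p * M → e ∣ N) → #divisors (p * M) ≤ #divisors M + #divisors N
#divisors-prime-* {p} {M} pr 1≤M N 1≤N coprime-part = subst (_≤ #divisors M + #divisors N)
  (sym (length-filter-split (p ∣?_) (divisors (p * M)))) (+-mono-≤ multiples others)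
  where
  instance _ = prime⇒nonZero pr
  multiples : length (filter (p ∣?_) (divisors (p * M))) ≤ #divisors M
  multiples = subst (length (filter (p ∣?_) (divisors (p * M))) ≤_) (length-map (p *_) (divisors M))
    (length≤-injective _≟_ _ (map (p *_) (divisors M)) (Uniqueₚ.filter⁺ (p ∣?_) (divisors-unique (p * M))) id image (λ _ _ _ _ → id))
    where
    image : ∀ e → e ∈ filter (p ∣?_) (divisors (p * M)) → e ∈ map (p *_) (divisors M)
    image e e∈ with ∈-filter⁻ (p ∣?_) {xs = divisors (p * M)} e∈
    ... | e∈D , divides q refl = subst (_∈ map (p *_) (divisors M)) (*-comm p q) (∈-map⁺ (p *_)
          (∈-divisors⁺ 1≤M (*-cancelˡ-∣ p (subst (_∣ p * M) (*-comm q p) (∈-divisors⁻ e∈D)))))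
  others : length (filter (¬? ∘ (p ∣?_)) (divisors (p * M))) ≤ #divisors N
  others = length≤-injective _≟_ _ (divisors N) (Uniqueₚ.filter⁺ (¬? ∘ (p ∣?_)) (divisors-unique (p * M))) id
    (λ e e∈ → let (e∈D , p∤e) = ∈-filter⁻ (¬? ∘ (p ∣?_)) {xs = divisors (p * M)} e∈
              in ∈-divisors⁺ 1≤N (coprime-part p∤e (∈-divisors⁻ e∈D))) (λ _ _ _ _ → id)

#divisors-double : ∀ {p M} → Prime p → 1 ≤ M → #divisors (p * M) ≤ 2 * #divisors M
#divisors-double {p} {M} pr 1≤M = subst (#divisors (p * M) ≤_) (cong (_+_ (#divisors M)) (sym (+-identityʳ (#divisors M))))
  (#divisors-prime-* pr 1≤M M 1≤M λ p∤e → coprime-divisor (∤-prime⇒coprime pr p∤e))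

#divisors-prime-power-* : ∀ {p M} → Prime p → 1 ≤ M → ∀ a → #divisors (p ^ a * M) ≤ suc a * #divisors M
#divisors-prime-power-* {p} {M} pr 1≤M zero = ≤-reflexive
  (trans (cong #divisors (+-identityʳ M)) (sym (+-identityʳ (#divisors M))))
#divisors-prime-power-* {p} {M} pr 1≤M (suc a) = begin
  #divisors (p * p ^ a * M) ≡⟨ cong #divisors (*-assoc p (p ^ a) M) ⟩
  #divisors (p * (p ^ a * M)) ≤⟨ #divisors-prime-* pr 1≤pM M 1≤M (λ {e} p∤e → strip p∤e (suc a) ∘ subst (e ∣_) (sym (*-assoc p (p ^ a) M))) ⟩
  #divisors (p ^ a * M) + #divisors M ≤⟨ +-monoˡ-≤ (#divisors M) (#divisors-prime-power-* pr 1≤M a) ⟩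
  suc a * #divisors M + #divisors M ≡⟨ +-comm (suc a * #divisors M) (#divisors M) ⟩
  suc (suc a) * #divisors M ∎
  where
  open ≤-Reasoning
  instance _ = prime⇒nonZero pr
  1≤pM : 1 ≤ p ^ a * M
  1≤pM = *-mono-≤ (m^n>0 p a) 1≤M
  strip : ∀ {e} → ¬ p ∣ e → ∀ b → e ∣ p ^ b * M → e ∣ M
  strip {e} p∤e zero    h = subst (e ∣_) (+-identityʳ M) h
  strip {e} p∤e (suc b) h = strip p∤e b
    (coprime-divisor (∤-prime⇒coprime pr p∤e) (subst (e ∣_) (*-assoc p (p ^ b) M) h))

∃prime∣ : ∀ n → 2 ≤ n → ∃ λ p → Prime p × p ∣ n
∃prime∣ n 2≤n with factorise n {{>-nonZero (≤-trans (s≤s z≤n) 2≤n)}}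
... | record { factors = [] ; isFactorisation = refl } = contradiction 2≤n (<⇒≱ (s≤s (s≤s z≤n)))
... | record { factors = p ∷ ps ; isFactorisation = refl ; factorsPrime = pr ∷ _ } = p , pr , m∣m*n _

-- Splitting off a prime p at most halves the divisor count. In the K-th power this costs 2^K ≤ p,
-- which the factor p of n pays for, so large primes contribute no constant.
rough-#divisors : ∀ K {b} → 2 ^ K ≤ b → ∀ n → 1 ≤ n → b Rough n → #divisors n ^ K ≤ n
rough-#divisors K {b} 2^K≤b = <-rec _ step
  where
  open ≤-Reasoning
  step : ∀ n → (∀ {k} → k < n → 1 ≤ k → b Rough k → #divisors k ^ K ≤ k) → 1 ≤ n → b Rough n → #divisors n ^ K ≤ n
  step 1             _   _ _ = ≤-reflexive (^-zeroˡ K)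
  step n@(suc (suc _)) rec _ r with ∃prime∣ n (s≤s (s≤s z≤n))
  ... | p , pr , divides M n≡Mp = begin
    #divisors n ^ K ≡⟨ cong (λ z → #divisors z ^ K) n≡pM ⟩
    #divisors (p * M) ^ K ≤⟨ ^-monoˡ-≤ K (#divisors-double pr 1≤M) ⟩
    (2 * #divisors M) ^ K ≡⟨ *-^ 2 (#divisors M) K ⟩
    2 ^ K * #divisors M ^ K ≤⟨ *-mono-≤ (≤-trans 2^K≤b b≤p) (rec M<n 1≤M (rough∧∣⇒rough r (divides p n≡pM))) ⟩
    p * M ≡⟨ n≡pM ⟨
    n ∎
    where
    n≡pM : n ≡ p * M
    n≡pM = trans n≡Mp (*-comm M p)
    instance _ = prime⇒nonTrivial pr
    b≤p : b ≤ p
    b≤p = rough⇒≤ (rough∧∣⇒rough r (divides M n≡Mp))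
    1≤M : 1 ≤ M
    1≤M = ∣-pos {M} {n} (s≤s z≤n) (divides p n≡pM)
    M<n : M < n
    M<n = subst (M <_) (sym n≡Mp) (m<m*n M p {{>-nonZero 1≤M}} (nonTrivial⇒n>1 p))

extract-power : ∀ b → 2 ≤ b → ∀ n → 1 ≤ n → Σ ℕ λ a → Σ ℕ λ M → n ≡ b ^ a * M × ¬ b ∣ M × 1 ≤ M
extract-power b 2≤b = <-rec _ step
  where
  step : ∀ n → (∀ {k} → k < n → 1 ≤ k → Σ ℕ λ a → Σ ℕ λ M → k ≡ b ^ a * M × ¬ b ∣ M × 1 ≤ M) →
    1 ≤ n → Σ ℕ λ a → Σ ℕ λ M → n ≡ b ^ a * M × ¬ b ∣ M × 1 ≤ M
  step n rec 1≤n with b ∣? n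
  ... | no b∤n = 0 , n , sym (+-identityʳ n) , b∤n , 1≤n
  ... | yes (divides q refl) with rec (m<m*n q b {{>-nonZero 1≤q}} 2≤b) 1≤q
    where
    1≤q : 1 ≤ q
    1≤q = ∣-pos 1≤n (m∣m*n b)
  ...   | a , M , refl , b∤M , 1≤M = suc a , M , trans (*-comm _ b) (sym (*-assoc b (b ^ a) M)) , b∤M , 1≤M

-- Only the primes below 2^K cost a constant. `descend` raises the roughness b up to 2^K, and the
-- power b^a is paid for by (a+1)^K ≤ K^K 2^a ≤ K^K b^a; each value of b contributes a factor K^K.
#divisors-subpoly : ∀ K → Σ ℕ λ C → ∀ n → 1 ≤ n → #divisors n ^ K ≤ C * n
#divisors-subpoly zero = 1 , λ n 1≤n → ≤-trans 1≤n (≤-reflexive (sym (+-identityʳ n)))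
#divisors-subpoly K@(suc K′) = let (C , h) = descend (2 ^ K) 2 (s≤s (s≤s z≤n)) (m≤n+m (2 ^ K) 2)
                               in C , λ n 1≤n → h n 1≤n 2-rough
  where
  open ≤-Reasoning
  descend : ∀ j b → 2 ≤ b → 2 ^ K ≤ b + j → Σ ℕ λ C → ∀ n → 1 ≤ n → b Rough n → #divisors n ^ K ≤ C * n
  descend zero b 2≤b h = 1 , λ n 1≤n r → ≤-trans (rough-#divisors K (subst (2 ^ K ≤_) (+-identityʳ b) h) n 1≤n r)
    (≤-reflexive (sym (+-identityʳ n)))
  descend (suc j) b 2≤b h with descend j (suc b) (m≤n⇒m≤1+n 2≤b) (subst (2 ^ K ≤_) (+-suc b j) h)
  ... | C , bound = K ^ K * C , λ n 1≤n r → go n 1≤n r (b ∣? n)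
    where
    1≤K^K : 1 ≤ K ^ K
    1≤K^K = m^n>0 K K
    go : ∀ n → 1 ≤ n → b Rough n → Dec (b ∣ n) → #divisors n ^ K ≤ K ^ K * C * n
    go n 1≤n r (no b∤n) = ≤-trans (bound n 1≤n (∤⇒rough-suc b∤n r))
      (*-monoˡ-≤ n (≤-trans (m≤m*n′ C 1≤K^K) (≤-reflexive (*-comm C (K ^ K)))))
    go n 1≤n r (yes b∣n) with extract-power b 2≤b n 1≤n
    ... | a , M , refl , b∤M , 1≤M = begin
      #divisors (b ^ a * M) ^ K ≤⟨ ^-monoˡ-≤ K (#divisors-prime-power-* pr 1≤M a) ⟩
      (suc a * #divisors M) ^ K ≡⟨ *-^ (suc a) (#divisors M) K ⟩
      suc a ^ K * #divisors M ^ K ≤⟨ *-mono-≤ (≤-trans (suc^≤2^ K a) (*-monoʳ-≤ (K ^ K) (^-monoˡ-≤ a 2≤b)))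
                                                  (bound M 1≤M (∤⇒rough-suc b∤M (rough∧∣⇒rough r (n∣m*n (b ^ a))))) ⟩
      K ^ K * b ^ a * (C * M) ≡⟨ rearrange (K ^ K) (b ^ a) C M ⟩
      K ^ K * C * (b ^ a * M) ∎
      where
      -- A divisor b of a b-rough number is prime, so the recursion can run through all b without
      -- testing primality.
      pr : Prime b
      pr = rough∧∣⇒prime {{n>1⇒nonTrivial 2≤b}} r b∣n
      rearrange : ∀ w x y z → w * x * (y * z) ≡ w * y * (x * z)
      rearrange = ℕ-ring

-- Binary logarithms and subpolynomial growth

log : ∀ n → Σ ℕ λ l → 2 ^ l ≤ suc n × suc n < 2 ^ suc l
log zero = 0 , s≤s z≤n , s≤s (s≤s z≤n)
log (suc n) with log n
... | l , lo , hi with suc (suc n) <? 2 ^ suc l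
...   | yes lt = l , m≤n⇒m≤1+n lo , lt
...   | no ¬lt = suc l , ≮⇒≥ ¬lt , ≤-<-trans hi (m<n*m (2 ^ suc l))
  where
  m<n*m : ∀ m .{{_ : NonZero m}} → m < 2 * m
  m<n*m m = subst (m <_) (cong (_+_ m) (sym (+-identityʳ m))) (m<m+n m (>-nonZero⁻¹ m))
  instance _ = m^n≢0 2 (suc l)

-- The default `lg 0 = 0` keeps `<2^suc-lg` valid for all n.
lg : ℕ → ℕ
lg n = proj₁ (log (pred n))

2^lg≤ : ∀ {n} → 1 ≤ n → 2 ^ lg n ≤ n
2^lg≤ {suc n} _ = proj₁ (proj₂ (log n))

<2^suc-lg : ∀ n → n < 2 ^ suc (lg n)
<2^suc-lg zero    = s≤s z≤n
<2^suc-lg (suc n) = proj₂ (proj₂ (log n))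

lg-mono : ∀ {m n} → 1 ≤ m → m ≤ n → lg m ≤ lg n
lg-mono {m} {n} 1≤m m≤n = ≮⇒≥ λ lt → <⇒≱ (≤-<-trans (≤-trans (^-monoʳ-≤ 2 lt) (2^lg≤ 1≤m)) (s≤s m≤n)) (<2^suc-lg n)

-- T = m^{o(1)}, quantified without real exponents.
SubPoly : (ℕ → ℕ) → Set
SubPoly T = ∀ K → Σ ℕ λ C → ∀ m → 1 ≤ m → T m ^ K ≤ C * m

subPoly-const : ∀ c → SubPoly (λ _ → c)
subPoly-const c K = c ^ K , λ m 1≤m → m≤m*n′ (c ^ K) 1≤m

subPoly-≤ : ∀ {S T} → (∀ m → 1 ≤ m → S m ≤ T m) → SubPoly T → SubPoly S
subPoly-≤ h T K = let (C , b) = T K in C , λ m 1≤m → ≤-trans (^-monoˡ-≤ K (h m 1≤m)) (b m 1≤m)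

square-cancel-≤ : ∀ {x y} → x * x ≤ y * y → x ≤ y
square-cancel-≤ h = ≮⇒≥ λ lt → <⇒≱ (*-mono-< lt lt) h

m≤m*m : ∀ m → m ≤ m * m
m≤m*m zero    = z≤n
m≤m*m (suc m) = m≤m*n (suc m) (suc m)

-- The bounds for the exponent 2K give (S T)^(2K) ≤ C D m², and the square root is again linear in
-- m.
subPoly-* : ∀ {S T} → SubPoly S → SubPoly T → SubPoly (λ m → S m * T m)
subPoly-* {S} {T} s t K = let (C , b) = s (K + K); (D , c) = t (K + K) in
  C * D , λ m 1≤m → square-cancel-≤ (begin
    (S m * T m) ^ K * (S m * T m) ^ K ≡⟨ ^-distribˡ-+-* (S m * T m) K K ⟨
    (S m * T m) ^ (K + K) ≡⟨ *-^ (S m) (T m) (K + K) ⟩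
    S m ^ (K + K) * T m ^ (K + K) ≤⟨ *-mono-≤ (b m 1≤m) (c m 1≤m) ⟩
    C * m * (D * m) ≡⟨ lemma C D m ⟩
    C * D * (m * m) ≤⟨ *-monoˡ-≤ (m * m) (m≤m*m (C * D)) ⟩
    C * D * (C * D) * (m * m) ≡⟨ lemma′ (C * D) m ⟩
    C * D * m * (C * D * m) ∎)
  where
  open ≤-Reasoning
  lemma : ∀ x y z → x * z * (y * z) ≡ x * y * (z * z)
  lemma = ℕ-ring
  lemma′ : ∀ x z → x * x * (z * z) ≡ x * z * (x * z)
  lemma′ = ℕ-ring

subPoly-^ : ∀ {T} → SubPoly T → ∀ j → SubPoly (λ m → T m ^ j)
subPoly-^ t zero    = subPoly-const 1
subPoly-^ t (suc j) = subPoly-* t (subPoly-^ t j)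

-- Reduces to products through a + b ≤ 2 (1 + a)(1 + b).
subPoly-+ : ∀ {S T} → SubPoly S → SubPoly T → SubPoly (λ m → S m + T m)
subPoly-+ {S} {T} s t = subPoly-≤ (λ m _ → sum≤ (S m) (T m))
  (subPoly-* (subPoly-const 2) (subPoly-* {λ m → 1 + S m} {λ m → 1 + T m} (plus1 s) (plus1 t)))
  where
  sum≤ : ∀ a b → a + b ≤ 2 * ((1 + a) * (1 + b))
  sum≤ a b = ≤-trans (m≤m+n (a + b) (2 + a + b + 2 * (a * b))) (≤-reflexive (lemma a b))
    where
    lemma : ∀ a b → a + b + (2 + a + b + 2 * (a * b)) ≡ 2 * ((1 + a) * (1 + b))
    lemma = ℕ-ring
  plus1 : ∀ {T} → SubPoly T → SubPoly (λ m → 1 + T m)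
  plus1 {T} t K = let (C , b) = t K in 2 ^ K * (1 + C) , λ m 1≤m → bound C m 1≤m (T m) (b m 1≤m)
    where
    open ≤-Reasoning
    bound : ∀ C m → 1 ≤ m → ∀ x → x ^ K ≤ C * m → (1 + x) ^ K ≤ 2 ^ K * (1 + C) * m
    bound C m 1≤m zero    _ = ≤-trans (≤-reflexive (^-zeroˡ K)) (*-mono-≤ (*-mono-≤ (1≤^ K (s≤s z≤n)) (s≤s z≤n)) 1≤m)
    bound C m 1≤m (suc x) h = begin
      (1 + suc x) ^ K ≤⟨ ^-monoˡ-≤ K (≤-trans (+-monoˡ-≤ (suc x) (s≤s (z≤n {x}))) (≤-reflexive (cong (_+_ (suc x)) (sym (+-identityʳ (suc x)))))) ⟩
      (2 * suc x) ^ K ≡⟨ *-^ 2 (suc x) K ⟩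
      2 ^ K * suc x ^ K ≤⟨ *-monoʳ-≤ (2 ^ K) h ⟩
      2 ^ K * (C * m) ≤⟨ *-monoʳ-≤ (2 ^ K) (*-monoˡ-≤ m (n≤1+n C)) ⟩
      2 ^ K * ((1 + C) * m) ≡⟨ *-assoc (2 ^ K) (1 + C) m ⟨
      2 ^ K * (1 + C) * m ∎

-- The bound for the exponent K (j+1), evaluated at c m^(j+1), is linear in m after a (j+1)-th root.
-- Thus only the polynomial size in m of an argument matters.
subPoly-∘ : ∀ {T} → SubPoly T → ∀ c j → 1 ≤ c → SubPoly (λ m → T (c * m ^ suc j))
subPoly-∘ {T} t c j 1≤c K = let (C , b) = t (K * suc j) in C * c , λ m 1≤m → ^-cancelˡ-≤ (suc j) (begin
    (T (c * m ^ suc j) ^ K) ^ suc j ≡⟨ ^-*-assoc (T (c * m ^ suc j)) K (suc j) ⟩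
    T (c * m ^ suc j) ^ (K * suc j) ≤⟨ b (c * m ^ suc j) (*-mono-≤ 1≤c (1≤^ (suc j) 1≤m)) ⟩
    C * (c * m ^ suc j) ≡⟨ *-assoc C c (m ^ suc j) ⟨
    C * c * m ^ suc j ≤⟨ *-monoˡ-≤ (m ^ suc j) (self≤^ (C * c)) ⟩
    (C * c) ^ suc j * m ^ suc j ≡⟨ *-^ (C * c) m (suc j) ⟨
    (C * c * m) ^ suc j ∎)
  where
  open ≤-Reasoning
  self≤^ : ∀ x → x ≤ x ^ suc j
  self≤^ zero    = z≤n
  self≤^ (suc x) = m≤m*n′ (suc x) (m^n>0 (suc x) j)

-- The running maximum of the divisor function, not the divisor function itself: monotonicity lets
-- one value of `τ` serve all numbers below a polynomial bound.
τ : ℕ → ℕ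
τ zero    = 1
τ (suc n) = τ n ⊔ #divisors (suc n)

1≤τ : ∀ n → 1 ≤ τ n
1≤τ zero    = ≤-refl
1≤τ (suc n) = ≤-trans (1≤τ n) (m≤m⊔n (τ n) _)

τ-mono : ∀ {m n} → m ≤ n → τ m ≤ τ n
τ-mono {m} m≤n = go (≤⇒≤′ m≤n)
  where
  go : ∀ {n} → m ≤′ n → τ m ≤ τ n
  go ≤′-refl     = ≤-refl
  go (≤′-step h) = ≤-trans (go h) (m≤m⊔n _ _)

#divisors≤τ : ∀ {i n} → i ≤ n → #divisors i ≤ τ n
#divisors≤τ {zero}  _ = z≤n
#divisors≤τ {suc i} h = ≤-trans (m≤n⊔m (τ i) _) (τ-mono h)

subPoly-τ : SubPoly τ
subPoly-τ K = let (C , b) = #divisors-subpoly K in suc C + suc C , λ m 1≤m → begin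
    τ m ^ K ≤⟨ bound C b m ⟩
    suc C * suc m ≤⟨ *-monoʳ-≤ (suc C) (+-monoˡ-≤ m 1≤m) ⟩
    suc C * (m + m) ≡⟨ lemma (suc C) m ⟩
    (suc C + suc C) * m ∎
  where
  open ≤-Reasoning
  lemma : ∀ c m → c * (m + m) ≡ (c + c) * m
  lemma = ℕ-ring
  bound : ∀ C → (∀ n → 1 ≤ n → #divisors n ^ K ≤ C * n) → ∀ m → τ m ^ K ≤ suc C * suc m
  bound C b zero    = ≤-trans (≤-reflexive (^-zeroˡ K)) (s≤s z≤n)
  bound C b (suc m) with ⊔-sel (τ m) (#divisors (suc m))
  ... | inj₁ eq rewrite eq = ≤-trans (bound C b m) (*-monoʳ-≤ (suc C) (n≤1+n (suc m)))
  ... | inj₂ eq rewrite eq = ≤-trans (b (suc m) (s≤s z≤n)) (*-mono-≤ (n≤1+n C) (n≤1+n (suc m)))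

subPoly-lg : SubPoly (λ m → suc (lg m))
subPoly-lg K = K ^ K , λ m 1≤m → ≤-trans (suc^≤2^ K (lg m)) (*-monoʳ-≤ (K ^ K) (2^lg≤ 1≤m))

-- Representations by x² + D y²

∣z∣²≡z² : ∀ z → + (∣ z ∣ * ∣ z ∣) ≡ z *ᶻ z
∣z∣²≡z² (+ n)     = ℤₚ.pos-* n n
∣z∣²≡z² (-[1+ n ]) = refl

∣x∣²+D∣y∣² : ∀ D x y → + (∣ x ∣ * ∣ x ∣ + D * (∣ y ∣ * ∣ y ∣)) ≡ x *ᶻ x +ᶻ + D *ᶻ (y *ᶻ y)
∣x∣²+D∣y∣² D x y = trans (ℤₚ.pos-+ (∣ x ∣ * ∣ x ∣) (D * (∣ y ∣ * ∣ y ∣)))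
  (cong₂ _+ᶻ_ (∣z∣²≡z² x) (trans (ℤₚ.pos-* D _) (cong (_*ᶻ_ (+ D)) (∣z∣²≡z² y))))

IsRep : ℕ → ℕ → ℤ × ℤ → Set
IsRep D N (x , y) = x *ᶻ x +ᶻ + D *ᶻ (y *ᶻ y) ≡ + N

IsRep-∣∣ : ∀ D N x y → IsRep D N (x , y) → ∣ x ∣ * ∣ x ∣ + D * (∣ y ∣ * ∣ y ∣) ≡ N
IsRep-∣∣ D N x y h = ℤₚ.+-injective (trans (∣x∣²+D∣y∣² D x y) h)

SquareFree : ℕ → Set
SquareFree D = ∀ k → k * k ∣ D → k ≡ 1

coprime-* : ∀ {a b c} → Coprime a c → Coprime b c → Coprime (a * b) c
coprime-* {a} {b} {c} ac bc {i} (i∣ab , i∣c) =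
  bc (coprime-divisor {n = a} (λ (j∣i , j∣a) → ac (j∣a , ∣-trans j∣i i∣c)) i∣ab , i∣c)

coprime-sym : ∀ {a b} → Coprime a b → Coprime b a
coprime-sym c (i∣b , i∣a) = c (i∣a , i∣b)

coprime-square : ∀ {a c} → Coprime a c → Coprime (a * a) (c * c)
coprime-square h = let h′ = coprime-sym (coprime-* h h) in coprime-sym (coprime-* h′ h′)

coprime-∣ : ∀ {a b c} → a ∣ b → Coprime b c → Coprime a c
coprime-∣ a∣b h (i∣a , i∣c) = h (∣-trans i∣a a∣b , i∣c)

e²∣4⇒e∣2 : ∀ e → e * e ∣ 4 → e ∣ 2
e²∣4⇒e∣2 0 h = contradiction (0∣⇒≡0 h) λ ()
e²∣4⇒e∣2 1 h = 1∣ 2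
e²∣4⇒e∣2 2 h = ∣-refl
e²∣4⇒e∣2 (suc (suc (suc e))) h =
  contradiction (∣⇒≤ h) (<⇒≱ (≤-trans (s≤s (s≤s (s≤s (s≤s (s≤s z≤n))))) (*-mono-≤ (s≤s (s≤s (s≤s (z≤n {e})))) (s≤s (s≤s (s≤s (z≤n {e})))))))

-- If g divides e and x, then g² divides N and x², hence D y²; as g is prime to y, g² divides the
-- squarefree D.
squareFree⇒coprime : ∀ {D N} x y → SquareFree D → Coprime x y → x * x + D * (y * y) ≡ N → ∀ e → e * e ∣ N → Coprime e x
squareFree⇒coprime {D} {N} x y sf cop eq e e²∣N {g} (g∣e , g∣x) = sf g (coprime-divisor {n = y * y} (coprime-square (coprime-∣ g∣x cop))
  (subst (g * g ∣_) (*-comm D (y * y)) (∣m+n∣m⇒∣n (subst (g * g ∣_) (sym eq) (∣-trans (*-pres-∣ g∣e g∣e) e²∣N)) (*-pres-∣ g∣x g∣x))))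

-- From e² ∣ D (2y)² and e² ∣ 4N follows e² ∣ 4x², and e is prime to x, which leaves e² ∣ 4.
e∣2 : ∀ {D N} x y → SquareFree D → Coprime x y → x * x + D * (y * y) ≡ N → ∀ e → e * e ∣ N → e ∣ y * 2 → e ∣ 2
e∣2 {D} {N} x y sf cop eq e e²∣N e∣2y = e²∣4⇒e∣2 e
  (coprime-divisor {n = x * x} (coprime-square (squareFree⇒coprime x y sf cop eq e e²∣N)) e²∣4x²)
  where
  regroup : D * (y * 2 * (y * 2)) + x * x * 4 ≡ N * 4
  regroup = trans (lemma D x y) (cong (_* 4) eq)
    where
    lemma : ∀ D x y → D * (y * 2 * (y * 2)) + x * x * 4 ≡ (x * x + D * (y * y)) * 4
    lemma = ℕ-ring
  e²∣4x² : e * e ∣ x * x * 4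
  e²∣4x² = ∣m+n∣m⇒∣n (subst (e * e ∣_) (sym regroup) (∣m⇒∣m*n 4 e²∣N)) (∣n⇒∣m*n D (*-pres-∣ e∣2y e∣2y))

-- A congruence modulo n′ d divided by its gcd d: after cancellation t and n′ are coprime.
∣m*[n/d] : ∀ d n′ t {s} → 1 ≤ d → gcd (t * d) (n′ * d) ≡ d → n′ * d ∣ t * d * s → n′ ∣ s
∣m*[n/d] d n′ t {s} 1≤d g≡d h = coprime-divisor cop (*-cancelʳ-∣ d (subst (n′ * d ∣_) (lemma t d s) h))
  where
  instance _ = >-nonZero 1≤d
  lemma : ∀ t d s → t * d * s ≡ t * s * d
  lemma = ℕ-ring
  cop : Coprime n′ t
  cop {i} (i∣n′ , i∣t) = ∣1⇒≡1 (*-cancelʳ-∣ d (subst (i * d ∣_) (trans g≡d (sym (+-identityʳ d)))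
    (gcd-greatest (*-monoˡ-∣ d i∣t) (*-monoˡ-∣ d i∣n′))))

∣⇒∣ᶻ : ∀ {k} z → k ∣ ∣ z ∣ → + k ℤD.∣ z
∣⇒∣ᶻ z = ℤD.∣ᵤ⇒∣

∣ᶻ⇒∣ : ∀ {k} {z} → + k ℤD.∣ z → k ∣ ∣ z ∣
∣ᶻ⇒∣ = ℤD.∣⇒∣ᵤ

∣double∣ : ∀ z → ∣ z +ᶻ z ∣ ≡ ∣ z ∣ * 2
∣double∣ (+ n)      = trans (cong (_+_ n) (sym (+-identityʳ n))) (*-comm 2 n)
∣double∣ (-[1+ n ]) = cong suc (cong suc (trans (cong (_+_ n) (sym (+-identityʳ n))) (*-comm 2 n)))

-- For primitive representations (x₁,y₁), (x₂,y₂) with the same d = gcd (x y₀ − x₀ y, N), both d and N/d divide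
-- x₁y₂ − x₂y₁: modulo d the ratio x : y is x₀ : y₀, modulo N/d it is − x₀ : y₀.
N∣2W : ∀ {D N} x₀ y₀ x₁ y₁ x₂ y₂ → 1 ≤ N → SquareFree D →
  IsRep D N (x₀ , y₀) → IsRep D N (x₁ , y₁) → IsRep D N (x₂ , y₂) →
  Coprime ∣ x₀ ∣ ∣ y₀ ∣ → Coprime ∣ x₁ ∣ ∣ y₁ ∣ →
  gcd (∣ x₁ *ᶻ y₀ -ᶻ x₀ *ᶻ y₁ ∣) N ≡ gcd (∣ x₂ *ᶻ y₀ -ᶻ x₀ *ᶻ y₂ ∣) N →
  N ∣ ∣ x₁ *ᶻ y₂ -ᶻ x₂ *ᶻ y₁ ∣ * 2
N∣2W {D} {N} x₀ y₀ x₁ y₁ x₂ y₂ 1≤N sf r₀ r₁ r₂ c₀ c₁ same with gcd[m,n]∣n ∣ x₁ *ᶻ y₀ -ᶻ x₀ *ᶻ y₁ ∣ N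
... | divides n′ N≡n′d = ∣-trans (subst₂ _∣_ (sym N≡n′d) refl dn′∣we) (*-monoʳ-∣ w e∣two)
  where
  T : ℤ → ℤ → ℤ
  T x y = x *ᶻ y₀ -ᶻ x₀ *ᶻ y
  T′ : ℤ → ℤ → ℤ
  T′ x y = x *ᶻ y₀ +ᶻ x₀ *ᶻ y
  d w : ℕ
  d = gcd ∣ T x₁ y₁ ∣ N
  w = ∣ x₁ *ᶻ y₂ -ᶻ x₂ *ᶻ y₁ ∣
  1≤d : 1 ≤ d
  1≤d = ∣-pos 1≤N (gcd[m,n]∣n ∣ T x₁ y₁ ∣ N)
  d∣T₁ : d ∣ ∣ T x₁ y₁ ∣
  d∣T₁ = gcd[m,n]∣m ∣ T x₁ y₁ ∣ N
  d∣T₂ : d ∣ ∣ T x₂ y₂ ∣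
  d∣T₂ = subst (_∣ ∣ T x₂ y₂ ∣) (sym same) (gcd[m,n]∣m ∣ T x₂ y₂ ∣ N)
  -- T T′ = x² y₀² - x₀² y², where x² ≡ -D y² and x₀² ≡ -D y₀² modulo N.
  N∣TT′ : ∀ x y → IsRep D N (x , y) → N ∣ ∣ T x y ∣ * ∣ T′ x y ∣
  N∣TT′ x y r = subst (N ∣_) (ℤₚ.abs-* (T x y) (T′ x y)) (∣ᶻ⇒∣ (ℤD.divides (y₀ *ᶻ y₀ -ᶻ y *ᶻ y) (begin
    T x y *ᶻ T′ x y ≡⟨ lemma x y x₀ y₀ (+ D) ⟩
    (x *ᶻ x +ᶻ + D *ᶻ (y *ᶻ y)) *ᶻ (y₀ *ᶻ y₀) -ᶻ (x₀ *ᶻ x₀ +ᶻ + D *ᶻ (y₀ *ᶻ y₀)) *ᶻ (y *ᶻ y)  ≡⟨ cong₂ (λ a b → a *ᶻ (y₀ *ᶻ y₀) -ᶻ b *ᶻ (y *ᶻ y)) r r₀ ⟩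
    + N *ᶻ (y₀ *ᶻ y₀) -ᶻ + N *ᶻ (y *ᶻ y) ≡⟨ lemma′ (+ N) y₀ y ⟩
    (y₀ *ᶻ y₀ -ᶻ y *ᶻ y) *ᶻ + N ∎)))
    where
    open ≡-Reasoning
    lemma : ∀ x y x₀ y₀ D → (x *ᶻ y₀ -ᶻ x₀ *ᶻ y) *ᶻ (x *ᶻ y₀ +ᶻ x₀ *ᶻ y) ≡
      (x *ᶻ x +ᶻ D *ᶻ (y *ᶻ y)) *ᶻ (y₀ *ᶻ y₀) -ᶻ (x₀ *ᶻ x₀ +ᶻ D *ᶻ (y₀ *ᶻ y₀)) *ᶻ (y *ᶻ y)
    lemma = ℤ-ring
    lemma′ : ∀ N a b → N *ᶻ (a *ᶻ a) -ᶻ N *ᶻ (b *ᶻ b) ≡ (a *ᶻ a -ᶻ b *ᶻ b) *ᶻ N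
    lemma′ = ℤ-ring
  n′∣T′ : ∀ x y → IsRep D N (x , y) → gcd ∣ T x y ∣ N ≡ d → d ∣ ∣ T x y ∣ → n′ ∣ ∣ T′ x y ∣
  n′∣T′ x y r g≡d (divides t T≡td) = ∣m*[n/d] d n′ t 1≤d
    (trans (cong₂ gcd (sym T≡td) (sym N≡n′d)) g≡d)
    (subst₂ _∣_ N≡n′d (cong (_* ∣ T′ x y ∣) T≡td) (N∣TT′ x y r))
  n′∣T′₁ : n′ ∣ ∣ T′ x₁ y₁ ∣
  n′∣T′₁ = n′∣T′ x₁ y₁ r₁ refl d∣T₁
  n′∣T′₂ : n′ ∣ ∣ T′ x₂ y₂ ∣
  n′∣T′₂ = n′∣T′ x₂ y₂ r₂ (sym same) d∣T₂
  -- Both x₀ w and y₀ w are combinations of the two values of T, and x₀, y₀ are coprime. The same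
  -- argument with T′ handles N/d.
  d∣w : d ∣ w
  d∣w = coprime-factors c₀
    ( subst (d ∣_) (ℤₚ.abs-* x₀ (x₁ *ᶻ y₂ -ᶻ x₂ *ᶻ y₁)) (∣ᶻ⇒∣ (subst (+ d ℤD.∣_) (px x₀ y₀ x₁ y₁ x₂ y₂)
        (ℤD.∣m∣n⇒∣m-n (ℤD.∣n⇒∣m*n x₂ (∣⇒∣ᶻ (T x₁ y₁) d∣T₁)) (ℤD.∣n⇒∣m*n x₁ (∣⇒∣ᶻ (T x₂ y₂) d∣T₂)))))
    , subst (d ∣_) (ℤₚ.abs-* y₀ (x₁ *ᶻ y₂ -ᶻ x₂ *ᶻ y₁)) (∣ᶻ⇒∣ (subst (+ d ℤD.∣_) (py x₀ y₀ x₁ y₁ x₂ y₂)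
        (ℤD.∣m∣n⇒∣m-n (ℤD.∣n⇒∣m*n y₂ (∣⇒∣ᶻ (T x₁ y₁) d∣T₁)) (ℤD.∣n⇒∣m*n y₁ (∣⇒∣ᶻ (T x₂ y₂) d∣T₂))))) )
    where
    px : ∀ x₀ y₀ x₁ y₁ x₂ y₂ → x₂ *ᶻ (x₁ *ᶻ y₀ -ᶻ x₀ *ᶻ y₁) -ᶻ x₁ *ᶻ (x₂ *ᶻ y₀ -ᶻ x₀ *ᶻ y₂) ≡ x₀ *ᶻ (x₁ *ᶻ y₂ -ᶻ x₂ *ᶻ y₁)
    px = ℤ-ring
    py : ∀ x₀ y₀ x₁ y₁ x₂ y₂ → y₂ *ᶻ (x₁ *ᶻ y₀ -ᶻ x₀ *ᶻ y₁) -ᶻ y₁ *ᶻ (x₂ *ᶻ y₀ -ᶻ x₀ *ᶻ y₂) ≡ y₀ *ᶻ (x₁ *ᶻ y₂ -ᶻ x₂ *ᶻ y₁)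
    py = ℤ-ring
  n′∣w : n′ ∣ w
  n′∣w = coprime-factors c₀
    ( subst (n′ ∣_) (ℤₚ.abs-* x₀ (x₁ *ᶻ y₂ -ᶻ x₂ *ᶻ y₁)) (∣ᶻ⇒∣ (subst (+ n′ ℤD.∣_) (px x₀ y₀ x₁ y₁ x₂ y₂)
        (ℤD.∣m∣n⇒∣m-n (ℤD.∣n⇒∣m*n x₁ (∣⇒∣ᶻ (T′ x₂ y₂) n′∣T′₂)) (ℤD.∣n⇒∣m*n x₂ (∣⇒∣ᶻ (T′ x₁ y₁) n′∣T′₁)))))
    , subst (n′ ∣_) (ℤₚ.abs-* y₀ (x₁ *ᶻ y₂ -ᶻ x₂ *ᶻ y₁)) (∣ᶻ⇒∣ (subst (+ n′ ℤD.∣_) (py x₀ y₀ x₁ y₁ x₂ y₂)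
        (ℤD.∣m∣n⇒∣m-n (ℤD.∣n⇒∣m*n y₂ (∣⇒∣ᶻ (T′ x₁ y₁) n′∣T′₁)) (ℤD.∣n⇒∣m*n y₁ (∣⇒∣ᶻ (T′ x₂ y₂) n′∣T′₂))))) )
    where
    px : ∀ x₀ y₀ x₁ y₁ x₂ y₂ → x₁ *ᶻ (x₂ *ᶻ y₀ +ᶻ x₀ *ᶻ y₂) -ᶻ x₂ *ᶻ (x₁ *ᶻ y₀ +ᶻ x₀ *ᶻ y₁) ≡ x₀ *ᶻ (x₁ *ᶻ y₂ -ᶻ x₂ *ᶻ y₁)
    px = ℤ-ring
    py : ∀ x₀ y₀ x₁ y₁ x₂ y₂ → y₂ *ᶻ (x₁ *ᶻ y₀ +ᶻ x₀ *ᶻ y₁) -ᶻ y₁ *ᶻ (x₂ *ᶻ y₀ +ᶻ x₀ *ᶻ y₂) ≡ y₀ *ᶻ (x₁ *ᶻ y₂ -ᶻ x₂ *ᶻ y₁)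
    py = ℤ-ring
  -- The divisors d and N/d of w need not be coprime, so only N ∣ w e follows, with e their gcd.
  -- Since e² ∣ N, squarefreeness of D forces e ∣ 2; this is the origin of the factor 2 in the
  -- conclusion.
  e : ℕ
  e = gcd d n′
  dn′∣we : n′ * d ∣ w * e
  dn′∣we = subst (n′ * d ∣_) (sym (c*gcd[m,n]≡gcd[cm,cn] w d n′))
    (gcd-greatest (*-monoˡ-∣ d n′∣w) (subst (_∣ w * n′) (*-comm d n′) (*-monoˡ-∣ n′ d∣w)))
  e∣2x₀y₁ : + e ℤD.∣ x₀ *ᶻ (y₁ +ᶻ y₁)
  e∣2x₀y₁ = subst (+ e ℤD.∣_) (lemma x₀ y₀ x₁ y₁) (ℤD.∣m∣n⇒∣m-n
    (∣⇒∣ᶻ (T′ x₁ y₁) (∣-trans (gcd[m,n]∣n d n′) n′∣T′₁)) (∣⇒∣ᶻ (T x₁ y₁) (∣-trans (gcd[m,n]∣m d n′) d∣T₁)))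
    where
    lemma : ∀ x₀ y₀ x₁ y₁ → (x₁ *ᶻ y₀ +ᶻ x₀ *ᶻ y₁) -ᶻ (x₁ *ᶻ y₀ -ᶻ x₀ *ᶻ y₁) ≡ x₀ *ᶻ (y₁ +ᶻ y₁)
    lemma = ℤ-ring
  e²∣N : e * e ∣ N
  e²∣N = subst (e * e ∣_) (sym N≡n′d) (*-pres-∣ (gcd[m,n]∣n d n′) (gcd[m,n]∣m d n′))
  e⊥x₀ : Coprime e ∣ x₀ ∣
  e⊥x₀ = squareFree⇒coprime ∣ x₀ ∣ ∣ y₀ ∣ sf c₀ (IsRep-∣∣ D N x₀ y₀ r₀) e e²∣N
  e∣two : e ∣ 2
  e∣two = e∣2 ∣ x₁ ∣ ∣ y₁ ∣ sf c₁ (IsRep-∣∣ D N x₁ y₁ r₁) e e²∣N (subst (e ∣_) (∣double∣ y₁)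
    (coprime-divisor e⊥x₀ (subst (e ∣_) (ℤₚ.abs-* x₀ (y₁ +ᶻ y₁)) (∣ᶻ⇒∣ e∣2x₀y₁))))

_≟ᶻ²_ : DecidableEquality (ℤ × ℤ)
_≟ᶻ²_ = ≡-dec ℤₚ._≟_ ℤₚ._≟_

-- The multiples of N of absolute value at most 2N, the only candidates for twice a wedge.
evens : ℕ → List ℤ
evens N = + 0 ∷ + N ∷ -ᶻ + N ∷ + (2 * N) ∷ -ᶻ + (2 * N) ∷ []

∈-evens : ∀ N q z → q ≤ 2 → ∣ z ∣ ≡ q * N → z ∈ evens N
∈-evens N q z q≤2 eq with q | q≤2 | z
... | 0 | _ | + _ = here (cong +_ eq)
... | 0 | _ | -[1+ n ] = contradiction eq λ ()
... | 1 | _ | + n = there (here (cong +_ (trans eq (+-identityʳ N))))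
... | 1 | _ | -[1+ n ] = there (there (here (cong (λ k → -ᶻ + k) (trans eq (+-identityʳ N)))))
... | 2 | _ | + n = there (there (there (here (cong +_ eq))))
... | 2 | _ | -[1+ n ] = there (there (there (there (here (cong (λ k → -ᶻ + k) eq)))))
... | suc (suc (suc _)) | s≤s (s≤s ()) | _

halve-≡ : ∀ a b → a +ᶻ a ≡ b +ᶻ b → a ≡ b
halve-≡ a b h = ℤₚ.*-cancelˡ-≡ (+ 2) a b (trans (sym (double a)) (trans h (double b)))
  where
  double : ∀ a → a +ᶻ a ≡ + 2 *ᶻ a
  double a = trans (sym (cong₂ _+ᶻ_ (ℤₚ.*-identityˡ a) (ℤₚ.*-identityˡ a))) (sym (ℤₚ.*-distribʳ-+ a (+ 1) (+ 1)))

+ᶻ-cancelʳ : ∀ c a b → a +ᶻ c ≡ b +ᶻ c → a ≡ b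
+ᶻ-cancelʳ c a b h = trans (lemma a c) (trans (cong (_-ᶻ c) h) (sym (lemma b c)))
  where
  lemma : ∀ a c → a ≡ a +ᶻ c -ᶻ c
  lemma = ℤ-ring

square-≡ : ∀ a b → a *ᶻ a ≡ b *ᶻ b → ∣ a ∣ ≡ ∣ b ∣
square-≡ a b h = ≤-antisym (square-cancel-≤ (≤-reflexive e)) (square-cancel-≤ (≤-reflexive (sym e)))
  where
  e : ∣ a ∣ * ∣ a ∣ ≡ ∣ b ∣ * ∣ b ∣
  e = ℤₚ.+-injective (trans (∣z∣²≡z² a) (trans h (sym (∣z∣²≡z² b))))

opaque

  -- In ℤ[√-D] the product (x₁ - y₁√-D)(x + y√-D) equals `pairing` + `wedge` √-D.
  wedge : ℤ × ℤ → ℤ × ℤ → ℤ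
  wedge (x₁ , y₁) (x , y) = x₁ *ᶻ y -ᶻ x *ᶻ y₁

  pairing : ℕ → ℤ × ℤ → ℤ × ℤ → ℤ
  pairing D (x₁ , y₁) (x , y) = x₁ *ᶻ x +ᶻ + D *ᶻ (y₁ *ᶻ y)

  wedge-def : ∀ x₁ y₁ x y → wedge (x₁ , y₁) (x , y) ≡ x₁ *ᶻ y -ᶻ x *ᶻ y₁
  wedge-def x₁ y₁ x y = refl

  pairing-def : ∀ D x₁ y₁ x y → pairing D (x₁ , y₁) (x , y) ≡ x₁ *ᶻ x +ᶻ + D *ᶻ (y₁ *ᶻ y)
  pairing-def D x₁ y₁ x y = refl

-- Brahmagupta's identity, that is, multiplicativity of the norm of ℤ[√-D].
composition : ∀ {D N} v w → IsRep D N v → IsRep D N w →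
  pairing D v w *ᶻ pairing D v w +ᶻ + D *ᶻ (wedge v w *ᶻ wedge v w) ≡ + N *ᶻ + N
composition {D} (x₁ , y₁) (x , y) r₁ r = trans
  (cong₂ (λ Z W → Z *ᶻ Z +ᶻ + D *ᶻ (W *ᶻ W)) (pairing-def D x₁ y₁ x y) (wedge-def x₁ y₁ x y))
  (trans (lemma x y x₁ y₁ (+ D)) (cong₂ _*ᶻ_ r₁ r))
  where
  lemma : ∀ x y x₁ y₁ D → (x₁ *ᶻ x +ᶻ D *ᶻ (y₁ *ᶻ y)) *ᶻ (x₁ *ᶻ x +ᶻ D *ᶻ (y₁ *ᶻ y)) +ᶻ
    D *ᶻ ((x₁ *ᶻ y -ᶻ x *ᶻ y₁) *ᶻ (x₁ *ᶻ y -ᶻ x *ᶻ y₁)) ≡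
    (x₁ *ᶻ x₁ +ᶻ D *ᶻ (y₁ *ᶻ y₁)) *ᶻ (x *ᶻ x +ᶻ D *ᶻ (y *ᶻ y))
  lemma = ℤ-ring

∣wedge∣≤ : ∀ {D N} → 1 ≤ D → ∀ v w → IsRep D N v → IsRep D N w → ∣ wedge v w ∣ ≤ N
∣wedge∣≤ {D} {N} 1≤D v w r₁ r = square-cancel-≤ (≤-trans (≤-trans (m≤m*n′ _ 1≤D) (≤-reflexive (*-comm _ D)))
  (≤-trans (m≤n+m _ (∣ pairing D v w ∣ * ∣ pairing D v w ∣))
    (≤-reflexive (IsRep-∣∣ D (N * N) (pairing D v w) (wedge v w) (trans (composition v w r₁ r) (sym (ℤₚ.pos-* N N)))))))

-- Multiplying `pairing` + `wedge` √-D by x₁ + y₁√-D returns N (x + y√-D). This is the rational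
-- part; `solve-second` is the coefficient of √-D.
solve-first : ∀ {D N} x₁ y₁ x y → IsRep D N (x₁ , y₁) →
  + N *ᶻ x ≡ x₁ *ᶻ pairing D (x₁ , y₁) (x , y) -ᶻ + D *ᶻ (y₁ *ᶻ wedge (x₁ , y₁) (x , y))
solve-first {D} x₁ y₁ x y r₁ = trans (cong (_*ᶻ x) (sym r₁)) (trans (lemma x y x₁ y₁ (+ D))
  (sym (cong₂ (λ Z W → x₁ *ᶻ Z -ᶻ + D *ᶻ (y₁ *ᶻ W)) (pairing-def D x₁ y₁ x y) (wedge-def x₁ y₁ x y))))
  where
  lemma : ∀ x y x₁ y₁ D → (x₁ *ᶻ x₁ +ᶻ D *ᶻ (y₁ *ᶻ y₁)) *ᶻ x ≡
    x₁ *ᶻ (x₁ *ᶻ x +ᶻ D *ᶻ (y₁ *ᶻ y)) -ᶻ D *ᶻ (y₁ *ᶻ (x₁ *ᶻ y -ᶻ x *ᶻ y₁))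
  lemma = ℤ-ring

solve-second : ∀ {D N} x₁ y₁ x y → IsRep D N (x₁ , y₁) →
  + N *ᶻ y ≡ y₁ *ᶻ pairing D (x₁ , y₁) (x , y) +ᶻ x₁ *ᶻ wedge (x₁ , y₁) (x , y)
solve-second {D} x₁ y₁ x y r₁ = trans (cong (_*ᶻ y) (sym r₁)) (trans (lemma x y x₁ y₁ (+ D))
  (sym (cong₂ (λ Z W → y₁ *ᶻ Z +ᶻ x₁ *ᶻ W) (pairing-def D x₁ y₁ x y) (wedge-def x₁ y₁ x y))))
  where
  lemma : ∀ x y x₁ y₁ D → (x₁ *ᶻ x₁ +ᶻ D *ᶻ (y₁ *ᶻ y₁)) *ᶻ y ≡
    y₁ *ᶻ (x₁ *ᶻ x +ᶻ D *ᶻ (y₁ *ᶻ y)) +ᶻ x₁ *ᶻ (x₁ *ᶻ y -ᶻ x *ᶻ y₁)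
  lemma = ℤ-ring

double∈evens : ∀ {N} z → 1 ≤ N → N ∣ ∣ z ∣ * 2 → ∣ z ∣ ≤ N → z +ᶻ z ∈ evens N
double∈evens {N} z 1≤N (divides q 2z≡qN) z≤N = ∈-evens N q (z +ᶻ z)
  (*-cancelʳ-≤ q 2 N {{>-nonZero 1≤N}} (≤-trans (≤-reflexive (sym 2z≡qN)) (≤-trans (*-monoˡ-≤ 2 z≤N) (≤-reflexive (*-comm N 2)))))
  (trans (∣double∣ z) 2z≡qN)

signs : List Sign
signs = Sign.+ ∷ Sign.- ∷ []

∈signs : ∀ s → s ∈ signs
∈signs Sign.+ = here refl
∈signs Sign.- = there (here refl)

Primitive : ℕ → ℕ → ℤ × ℤ → Set
Primitive D N v = IsRep D N v × Coprime ∣ proj₁ v ∣ ∣ proj₂ v ∣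

module _ (D N : ℕ) (1≤D : 1 ≤ D) (1≤N : 1 ≤ N) where

  -- By `composition` the wedge determines the pairing up to sign, and the two together determine v.
  -- The wedge is doubled because N is known to divide only twice the wedge.
  code : ℤ × ℤ → ℤ × ℤ → ℤ × Sign
  code v₁ v = wedge v₁ v +ᶻ wedge v₁ v , sign (pairing D v₁ v)

  code-injective : ∀ v₁ v w → IsRep D N v₁ → IsRep D N v → IsRep D N w → code v₁ v ≡ code v₁ w → v ≡ w
  code-injective v₁@(x₁ , y₁) v@(x , y) w@(x′ , y′) r₁ r r′ eq = cong₂ _,_ x≡ y≡
    where
    instance _ = ℤ.≢-nonZero {+ N} (λ N≡0 → <⇒≢ 1≤N (sym (ℤₚ.+-injective N≡0)))
    W≡ : wedge v₁ v ≡ wedge v₁ w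
    W≡ = halve-≡ (wedge v₁ v) (wedge v₁ w) (cong proj₁ eq)
    Z²≡ : pairing D v₁ v *ᶻ pairing D v₁ v ≡ pairing D v₁ w *ᶻ pairing D v₁ w
    Z²≡ = +ᶻ-cancelʳ (+ D *ᶻ (wedge v₁ v *ᶻ wedge v₁ v)) _ _ (trans (composition v₁ v r₁ r)
      (trans (sym (composition v₁ w r₁ r′)) (cong (λ W → pairing D v₁ w *ᶻ pairing D v₁ w +ᶻ + D *ᶻ (W *ᶻ W)) (sym W≡))))
    Z≡ : pairing D v₁ v ≡ pairing D v₁ w
    Z≡ = ℤₚ.◃-cong (cong proj₂ eq) (square-≡ (pairing D v₁ v) (pairing D v₁ w) Z²≡)
    x≡ : x ≡ x′
    x≡ = ℤₚ.*-cancelˡ-≡ (+ N) x x′ (trans (solve-first x₁ y₁ x y r₁)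
      (trans (cong₂ (λ Z W → x₁ *ᶻ Z -ᶻ + D *ᶻ (y₁ *ᶻ W)) Z≡ W≡) (sym (solve-first x₁ y₁ x′ y′ r₁))))
    y≡ : y ≡ y′
    y≡ = ℤₚ.*-cancelˡ-≡ (+ N) y y′ (trans (solve-second x₁ y₁ x y r₁)
      (trans (cong₂ (λ Z W → y₁ *ᶻ Z +ᶻ x₁ *ᶻ W) Z≡ W≡) (sym (solve-second x₁ y₁ x′ y′ r₁))))

  content : ℤ × ℤ → ℤ × ℤ → ℕ
  content (x₀ , y₀) (x , y) = gcd (∣ x *ᶻ y₀ -ᶻ x₀ *ᶻ y ∣) N

  content∈ : ∀ v₀ v → content v₀ v ∈ divisors N
  content∈ (x₀ , y₀) (x , y) = ∈-divisors⁺ 1≤N (gcd[m,n]∣n (∣ x *ᶻ y₀ -ᶻ x₀ *ᶻ y ∣) N)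

  N∣2wedge : SquareFree D → ∀ v₀ v₁ v → Primitive D N v₀ → Primitive D N v₁ → Primitive D N v →
    content v₀ v₁ ≡ content v₀ v → N ∣ ∣ wedge v₁ v ∣ * 2
  N∣2wedge sf (x₀ , y₀) (x₁ , y₁) (x , y) (r₀ , c₀) (r₁ , c₁) (r , _) e = subst (λ W → N ∣ ∣ W ∣ * 2) (sym (wedge-def x₁ y₁ x y))
    (N∣2W x₀ y₀ x₁ y₁ x y 1≤N sf r₀ r₁ r c₀ c₁ e)

  -- Representations are sorted by the divisor `content v₀ v` of N. Inside a fibre the doubled wedge
  -- has five possible values and the pairing two signs, whence 10.
  primitive-count : SquareFree D → (L : List (ℤ × ℤ)) → Unique L → All (Primitive D N) L → length L ≤ #divisors N * 10
  primitive-count sf [] _ _ = z≤n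
  primitive-count sf L@(v₀ ∷ _) uL prims@(p₀ ∷ _) = length≤fibres _≟_ L (divisors N) (content v₀)
    (λ v _ → content∈ v₀ v)
    λ d _ → small d (filter (λ v → content v₀ v ≟ d) L) (Uniqueₚ.filter⁺ (λ v → content v₀ v ≟ d) uL)
      (λ v v∈ → let (v∈L , e) = ∈-filter⁻ (λ v → content v₀ v ≟ d) {xs = L} v∈ in All.lookup prims v∈L , e)
    where
    small : ∀ d F → Unique F → (∀ v → v ∈ F → Primitive D N v × content v₀ v ≡ d) → length F ≤ 10
    small d [] _ _ = z≤n
    small d F@(v₁ ∷ _) uF inF = length≤-injective (≡-dec ℤₚ._≟_ Signₚ._≟_) F (cartesianProduct (evens N) signs) uF (code v₁)
      (λ v v∈ → ∈-cartesianProduct⁺ (double∈evens (wedge v₁ v) 1≤N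
          (N∣2wedge sf v₀ v₁ v p₀ (proj₁ in₁) (proj₁ (inF v v∈)) (trans (proj₂ in₁) (sym (proj₂ (inF v v∈)))))
          (∣wedge∣≤ 1≤D v₁ v (proj₁ (proj₁ in₁)) (proj₁ (proj₁ (inF v v∈))))) (∈signs _))
      (λ v w v∈ w∈ → code-injective v₁ v w (proj₁ (proj₁ in₁)) (proj₁ (proj₁ (inF v v∈))) (proj₁ (proj₁ (inF w w∈))))
      where
      in₁ : Primitive D N v₁ × content v₀ v₁ ≡ d
      in₁ = inF v₁ (here refl)

scale : ℕ → ℤ × ℤ → ℤ × ℤ
scale c (x , y) = + c *ᶻ x , + c *ᶻ y

unscale : {P : ℤ × ℤ → Set} (c : ℕ) (L : List (ℤ × ℤ)) → (∀ v → v ∈ L → Σ (ℤ × ℤ) λ u → v ≡ scale c u × P u) →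
  Σ (List (ℤ × ℤ)) λ L′ → L ≡ map (scale c) L′ × All P L′
unscale c []      _ = [] , refl , []
unscale c (v ∷ L) h with h v (here refl) | unscale c L (λ w w∈ → h w (there w∈))
... | u , refl , p | L′ , refl , ps = u ∷ L′ , refl , p ∷ ps

-- Sorting by the gcd c of the coordinates: c² divides N, and dividing by c gives primitive
-- representations of N/c².
rep-count : ∀ D N → 1 ≤ D → 1 ≤ N → SquareFree D → (L : List (ℤ × ℤ)) → Unique L →
  All (IsRep D N) L → length L ≤ #divisors N * (τ N * 10)
rep-count D N 1≤D 1≤N sf L uL reps = length≤fibres _≟_ L (divisors N) content′ content′∈ fibre
  where
  content′ : ℤ × ℤ → ℕ
  content′ (x , y) = gcd ∣ x ∣ ∣ y ∣
  square∣ : ∀ c x y → IsRep D N (x , y) → c ∣ ∣ x ∣ → c ∣ ∣ y ∣ → c * c ∣ N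
  square∣ c x y r c∣x c∣y = subst (c * c ∣_) (IsRep-∣∣ D N x y r)
    (∣m∣n⇒∣m+n (*-pres-∣ c∣x c∣x) (∣n⇒∣m*n D (*-pres-∣ c∣y c∣y)))
  content′∈ : ∀ v → v ∈ L → content′ v ∈ divisors N
  content′∈ (x , y) v∈ = ∈-divisors⁺ 1≤N (∣-trans (m∣m*n _) (square∣ (content′ (x , y)) x y (All.lookup reps v∈)
    (gcd[m,n]∣m ∣ x ∣ ∣ y ∣) (gcd[m,n]∣n ∣ x ∣ ∣ y ∣)))
  fibre : ∀ c → c ∈ divisors N → length (filter (λ v → content′ v ≟ c) L) ≤ τ N * 10
  fibre c c∈ = go (filter (λ v → content′ v ≟ c) L) (Uniqueₚ.filter⁺ (λ v → content′ v ≟ c) uL)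
    λ v v∈ → let (v∈L , e) = ∈-filter⁻ (λ v → content′ v ≟ c) {xs = L} v∈ in All.lookup reps v∈L , e
    where
    1≤c : 1 ≤ c
    1≤c = ∣-pos 1≤N (∈-divisors⁻ {n = N} c∈)
    go : (F : List (ℤ × ℤ)) → Unique F → (∀ v → v ∈ F → IsRep D N v × content′ v ≡ c) → length F ≤ τ N * 10
    go [] _ _ = z≤n
    go F@((x₁ , y₁) ∷ _) uF inF with square∣ c x₁ y₁ (proj₁ (inF _ (here refl)))
          (subst (_∣ ∣ x₁ ∣) (proj₂ (inF _ (here refl))) (gcd[m,n]∣m ∣ x₁ ∣ ∣ y₁ ∣))
          (subst (_∣ ∣ y₁ ∣) (proj₂ (inF _ (here refl))) (gcd[m,n]∣n ∣ x₁ ∣ ∣ y₁ ∣))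
    ... | divides M N≡Mcc with unscale {λ v → IsRep D M v × Coprime ∣ proj₁ v ∣ ∣ proj₂ v ∣} c F divided
      where
      instance _ = >-nonZero 1≤c
      divided : ∀ v → v ∈ F → Σ (ℤ × ℤ) λ u → v ≡ scale c u × IsRep D M u × Coprime ∣ proj₁ u ∣ ∣ proj₂ u ∣
      divided (x , y) v∈ with inF (x , y) v∈
      ... | r , e with ∣⇒∣ᶻ x (subst (_∣ ∣ x ∣) e (gcd[m,n]∣m ∣ x ∣ ∣ y ∣))
                     | ∣⇒∣ᶻ y (subst (_∣ ∣ y ∣) e (gcd[m,n]∣n ∣ x ∣ ∣ y ∣))
      ...   | ℤD.divides a refl | ℤD.divides b refl = (a , b) , cong₂ _,_ (ℤₚ.*-comm a (+ c)) (ℤₚ.*-comm b (+ c)) , quotient-rep , coprime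
        where
        instance _ = ℤ.≢-nonZero {+ (c * c)} (λ z → <⇒≢ (*-mono-≤ 1≤c 1≤c) (sym (ℤₚ.+-injective z)))
        quotient-rep : IsRep D M (a , b)
        quotient-rep = ℤₚ.*-cancelˡ-≡ (+ (c * c)) _ (+ M) (begin
          + (c * c) *ᶻ (a *ᶻ a +ᶻ + D *ᶻ (b *ᶻ b)) ≡⟨ cong (_*ᶻ _) (ℤₚ.pos-* c c) ⟩
          + c *ᶻ + c *ᶻ (a *ᶻ a +ᶻ + D *ᶻ (b *ᶻ b)) ≡⟨ lemma (+ c) a b (+ D) ⟩
          a *ᶻ + c *ᶻ (a *ᶻ + c) +ᶻ + D *ᶻ (b *ᶻ + c *ᶻ (b *ᶻ + c))  ≡⟨ r ⟩
          + N ≡⟨ cong +_ (trans N≡Mcc (*-comm M (c * c))) ⟩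
          + (c * c * M) ≡⟨ ℤₚ.pos-* (c * c) M ⟩
          + (c * c) *ᶻ + M ∎)
          where
          open ≡-Reasoning
          lemma : ∀ c a b D → c *ᶻ c *ᶻ (a *ᶻ a +ᶻ D *ᶻ (b *ᶻ b)) ≡ a *ᶻ c *ᶻ (a *ᶻ c) +ᶻ D *ᶻ (b *ᶻ c *ᶻ (b *ᶻ c))
          lemma = ℤ-ring
        coprime : Coprime ∣ a ∣ ∣ b ∣
        coprime {i} (i∣a , i∣b) = ∣1⇒≡1 (*-cancelʳ-∣ c (subst (i * c ∣_) (trans e (sym (+-identityʳ c)))
          (gcd-greatest (subst (i * c ∣_) (sym (ℤₚ.abs-* a (+ c))) (*-monoˡ-∣ c i∣a))
                        (subst (i * c ∣_) (sym (ℤₚ.abs-* b (+ c))) (*-monoˡ-∣ c i∣b)))))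
    ...   | F′ , F≡ , props = ≤-trans (≤-reflexive (trans (cong length F≡) (length-map (scale c) F′)))
            (≤-trans (primitive-count D M 1≤D 1≤M sf F′ (Uniqueₚ.map⁻ (subst Unique F≡ uF)) props)
              (*-monoˡ-≤ 10 (#divisors≤τ (∣⇒≤ {{>-nonZero 1≤N}} M∣N))))
      where
      M∣N : M ∣ N
      M∣N = subst (M ∣_) (sym N≡Mcc) (m∣m*n (c * c))
      1≤M : 1 ≤ M
      1≤M = ∣-pos 1≤N M∣N

squareFree-part : ∀ D → 1 ≤ D → Σ ℕ λ f → Σ ℕ λ D₀ → D ≡ f * f * D₀ × 1 ≤ f × 1 ≤ D₀ × SquareFree D₀
squareFree-part = <-rec _ step
  where
  step : ∀ D → (∀ {k} → k < D → 1 ≤ k → Σ ℕ λ f → Σ ℕ λ D₀ → k ≡ f * f * D₀ × 1 ≤ f × 1 ≤ D₀ × SquareFree D₀) →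
    1 ≤ D → Σ ℕ λ f → Σ ℕ λ D₀ → D ≡ f * f * D₀ × 1 ≤ f × 1 ≤ D₀ × SquareFree D₀
  step D rec 1≤D with anyUpTo? (λ k → (2 ≤? k) ×-dec (k * k ∣? D)) (suc D)
  ... | no none = 1 , D , sym (+-identityʳ D) , s≤s z≤n , 1≤D , sf
    where
    sf : SquareFree D
    sf 0 h = contradiction (sym (0∣⇒≡0 h)) (<⇒≢ 1≤D)
    sf 1 _ = refl
    sf k@(suc (suc _)) h = contradiction
      (k , s≤s (≤-trans (m≤m*m k) (∣⇒≤ {{>-nonZero 1≤D}} h)) , s≤s (s≤s z≤n) , h) none
  ... | yes (k , _ , 2≤k , divides q refl) with rec (m<m*n q (k * k) {{>-nonZero 1≤q}} (≤-trans 2≤k (m≤m*m k))) 1≤q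
    where
    1≤q : 1 ≤ q
    1≤q = ∣-pos 1≤D (m∣m*n (k * k))
  ...   | f , D₀ , refl , 1≤f , 1≤D₀ , sf = k * f , D₀ , lemma k f D₀ , *-mono-≤ (≤-trans (s≤s z≤n) 2≤k) 1≤f , 1≤D₀ , sf
    where
    lemma : ∀ k f D → f * f * D * (k * k) ≡ k * f * (k * f) * D
    lemma = ℕ-ring

sum-zero : ∀ {a b} → a + b ≡ 0 → a ≡ 0 × b ≡ 0
sum-zero {zero} {b} h = refl , h

square-zero : ∀ z → ∣ z ∣ * ∣ z ∣ ≡ 0 → z ≡ + 0
square-zero z h = ℤₚ.∣i∣≡0⇒i≡0 (n≤0⇒n≡0 (subst (∣ z ∣ ≤_) h (m≤m*m ∣ z ∣)))

-- The square part f² of D is absorbed into y, which leaves a squarefree coefficient. The value N =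
-- 0 is represented only by (0 , 0).
binary-form-count : ∀ D N B → 1 ≤ D → N ≤ B → (L : List (ℤ × ℤ)) → Unique L →
  All (IsRep D N) L → length L ≤ τ B * (τ B * 10)
binary-form-count D zero B 1≤D _ L uL reps = ≤-trans
  (length≤-injective _≟ᶻ²_ L ((+ 0 , + 0) ∷ []) uL id (λ v v∈ → here (zero-rep v (All.lookup reps v∈))) (λ _ _ _ _ → id))
  (*-mono-≤ (1≤τ B) (*-mono-≤ (1≤τ B) (s≤s z≤n)))
  where
  zero-rep : ∀ v → IsRep D 0 v → v ≡ (+ 0 , + 0)
  zero-rep (x , y) r with sum-zero {∣ x ∣ * ∣ x ∣} (IsRep-∣∣ D 0 x y r)
  ... | x²≡0 , Dy²≡0 with m*n≡0⇒m≡0∨n≡0 D Dy²≡0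
  ...   | inj₁ refl = contradiction 1≤D λ ()
  ...   | inj₂ y²≡0 = cong₂ _,_ (square-zero x x²≡0) (square-zero y y²≡0)
binary-form-count D N@(suc _) B 1≤D N≤B L uL reps with squareFree-part D 1≤D
... | f , D₀ , D≡ , 1≤f , 1≤D₀ , sf = begin
  length L ≡⟨ length-map h L ⟨
  length (map h L) ≤⟨ rep-count D₀ N 1≤D₀ (s≤s z≤n) sf (map h L) (Uniqueₚ.map⁺ h-inj uL) (Allₚ.map⁺ (All.map (λ {v} → transfer v) reps)) ⟩
  #divisors N * (τ N * 10) ≤⟨ *-mono-≤ (#divisors≤τ N≤B) (*-monoˡ-≤ 10 (τ-mono N≤B)) ⟩
  τ B * (τ B * 10) ∎
  where
  open ≤-Reasoning
  h : ℤ × ℤ → ℤ × ℤ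
  h (x , y) = x , + f *ᶻ y
  instance _ = ℤ.≢-nonZero {+ f} (λ z → <⇒≢ 1≤f (sym (ℤₚ.+-injective z)))
  h-inj : ∀ {v w} → h v ≡ h w → v ≡ w
  h-inj {x , y} {x′ , y′} e = cong₂ _,_ (cong proj₁ e) (ℤₚ.*-cancelˡ-≡ (+ f) y y′ (cong proj₂ e))
  transfer : ∀ v → IsRep D N v → IsRep D₀ N (h v)
  transfer (x , y) r = trans (trans (lemma (+ f) x y (+ D₀)) (cong (λ d → x *ᶻ x +ᶻ d *ᶻ (y *ᶻ y)) (sym +D≡))) r
    where
    lemma : ∀ f x y d → x *ᶻ x +ᶻ d *ᶻ (f *ᶻ y *ᶻ (f *ᶻ y)) ≡ x *ᶻ x +ᶻ f *ᶻ f *ᶻ d *ᶻ (y *ᶻ y)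
    lemma = ℤ-ring
    +D≡ : + D ≡ + f *ᶻ + f *ᶻ + D₀
    +D≡ = trans (cong +_ D≡) (trans (ℤₚ.pos-* (f * f) D₀) (cong (_*ᶻ + D₀) (ℤₚ.pos-* f f)))

-- Lattice points on circles

infixl 6 _⊖_

_⊖_ : Point → Point → Point
(a , b , c) ⊖ (x , y , z) = (a -ᶻ x , b -ᶻ y , c -ᶻ z)

dot : Point → Point → ℤ
dot (a , b , c) (x , y , z) = a *ᶻ x +ᶻ b *ᶻ y +ᶻ c *ᶻ z

nonneg-sum : ∀ D x y {V} → x *ᶻ x +ᶻ + D *ᶻ (y *ᶻ y) ≡ V → V ≡ + ∣ V ∣
nonneg-sum D x y h = subst (λ v → v ≡ + ∣ v ∣) (trans (∣x∣²+D∣y∣² D x y) h) refl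

‖_‖² : Point → ℕ
‖ a , b , c ‖² = ∣ a ∣ * ∣ a ∣ + ∣ b ∣ * ∣ b ∣ + ∣ c ∣ * ∣ c ∣

normSq≡‖‖² : ∀ p → normSq p ≡ + ‖ p ‖²
normSq≡‖‖² (a , b , c) = sym (trans (ℤₚ.pos-+ (∣ a ∣ * ∣ a ∣ + ∣ b ∣ * ∣ b ∣) (∣ c ∣ * ∣ c ∣))
  (cong₂ _+ᶻ_ (trans (ℤₚ.pos-+ (∣ a ∣ * ∣ a ∣) (∣ b ∣ * ∣ b ∣)) (cong₂ _+ᶻ_ (∣z∣²≡z² a) (∣z∣²≡z² b))) (∣z∣²≡z² c)))

-- The factor (a² + c²) c² that |h × x|² acquires when w₃ is eliminated and the square is completed.
discriminant : ℤ → ℤ → ℕ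
discriminant a c = (∣ a ∣ * ∣ a ∣ + ∣ c ∣ * ∣ c ∣) * (∣ c ∣ * ∣ c ∣)

+discriminant : ∀ a c → + discriminant a c ≡ (a *ᶻ a +ᶻ c *ᶻ c) *ᶻ (c *ᶻ c)
+discriminant a c = trans (ℤₚ.pos-* (∣ a ∣ * ∣ a ∣ + ∣ c ∣ * ∣ c ∣) (∣ c ∣ * ∣ c ∣))
  (cong₂ _*ᶻ_ (trans (ℤₚ.pos-+ (∣ a ∣ * ∣ a ∣) (∣ c ∣ * ∣ c ∣)) (cong₂ _+ᶻ_ (∣z∣²≡z² a) (∣z∣²≡z² c))) (∣z∣²≡z² c))

-- The cross product w = h × x lies in the plane orthogonal to h = (a,b,c) and has |w|² = |h|²|x|² − (h·x)². Eliminating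
-- w₃ and completing the square turns |w|² into the form X² + |h|² Y².
module CircleForm (a b c : ℤ) (c≢0 : c ≢ + 0) where

  toForm : Point → ℤ × ℤ
  toForm (x , y , z) = (a *ᶻ a +ᶻ c *ᶻ c) *ᶻ (b *ᶻ z -ᶻ c *ᶻ y) +ᶻ a *ᶻ b *ᶻ (c *ᶻ x -ᶻ a *ᶻ z) , c *ᶻ (c *ᶻ x -ᶻ a *ᶻ z)

  value : ∀ p → let (X , Y) = toForm p in X *ᶻ X +ᶻ normSq (a , b , c) *ᶻ (Y *ᶻ Y) ≡
    (a *ᶻ a +ᶻ c *ᶻ c) *ᶻ (c *ᶻ c) *ᶻ (normSq (a , b , c) *ᶻ normSq p -ᶻ dot (a , b , c) p *ᶻ dot (a , b , c) p)
  value (x , y , z) = begin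
    _ ≡⟨ complete a b c w₁ w₂ ⟩
    (a *ᶻ a +ᶻ c *ᶻ c) *ᶻ (c *ᶻ c *ᶻ (w₁ *ᶻ w₁) +ᶻ c *ᶻ c *ᶻ (w₂ *ᶻ w₂) +ᶻ (a *ᶻ w₁ +ᶻ b *ᶻ w₂) *ᶻ (a *ᶻ w₁ +ᶻ b *ᶻ w₂))
      ≡⟨ cong (λ s → (a *ᶻ a +ᶻ c *ᶻ c) *ᶻ (c *ᶻ c *ᶻ (w₁ *ᶻ w₁) +ᶻ c *ᶻ c *ᶻ (w₂ *ᶻ w₂) +ᶻ s *ᶻ s)) (orthogonal a b c x y z) ⟩
    (a *ᶻ a +ᶻ c *ᶻ c) *ᶻ (c *ᶻ c *ᶻ (w₁ *ᶻ w₁) +ᶻ c *ᶻ c *ᶻ (w₂ *ᶻ w₂) +ᶻ c *ᶻ w₃ *ᶻ (c *ᶻ w₃))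
      ≡⟨ factor (a *ᶻ a +ᶻ c *ᶻ c) c w₁ w₂ w₃ ⟩
    (a *ᶻ a +ᶻ c *ᶻ c) *ᶻ (c *ᶻ c) *ᶻ (w₁ *ᶻ w₁ +ᶻ w₂ *ᶻ w₂ +ᶻ w₃ *ᶻ w₃)
      ≡⟨ cong (_*ᶻ_ ((a *ᶻ a +ᶻ c *ᶻ c) *ᶻ (c *ᶻ c))) (lagrange a b c x y z) ⟩
    _ ∎
    where
    open ≡-Reasoning
    -- `w₃` is minus the third component of h × x, so that orthogonality to h reads a w₁ + b w₂ = c
    -- w₃.
    w₁ w₂ w₃ : ℤ
    w₁ = b *ᶻ z -ᶻ c *ᶻ y
    w₂ = c *ᶻ x -ᶻ a *ᶻ z
    w₃ = b *ᶻ x -ᶻ a *ᶻ y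
    complete : ∀ a b c u v → ((a *ᶻ a +ᶻ c *ᶻ c) *ᶻ u +ᶻ a *ᶻ b *ᶻ v) *ᶻ ((a *ᶻ a +ᶻ c *ᶻ c) *ᶻ u +ᶻ a *ᶻ b *ᶻ v) +ᶻ
      (a *ᶻ a +ᶻ b *ᶻ b +ᶻ c *ᶻ c) *ᶻ (c *ᶻ v *ᶻ (c *ᶻ v)) ≡
      (a *ᶻ a +ᶻ c *ᶻ c) *ᶻ (c *ᶻ c *ᶻ (u *ᶻ u) +ᶻ c *ᶻ c *ᶻ (v *ᶻ v) +ᶻ (a *ᶻ u +ᶻ b *ᶻ v) *ᶻ (a *ᶻ u +ᶻ b *ᶻ v))
    complete = ℤ-ring
    orthogonal : ∀ a b c x y z → a *ᶻ (b *ᶻ z -ᶻ c *ᶻ y) +ᶻ b *ᶻ (c *ᶻ x -ᶻ a *ᶻ z) ≡ c *ᶻ (b *ᶻ x -ᶻ a *ᶻ y)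
    orthogonal = ℤ-ring
    factor : ∀ α c u v w → α *ᶻ (c *ᶻ c *ᶻ (u *ᶻ u) +ᶻ c *ᶻ c *ᶻ (v *ᶻ v) +ᶻ c *ᶻ w *ᶻ (c *ᶻ w)) ≡
      α *ᶻ (c *ᶻ c) *ᶻ (u *ᶻ u +ᶻ v *ᶻ v +ᶻ w *ᶻ w)
    factor = ℤ-ring
    lagrange : ∀ a b c x y z →
      (b *ᶻ z -ᶻ c *ᶻ y) *ᶻ (b *ᶻ z -ᶻ c *ᶻ y) +ᶻ (c *ᶻ x -ᶻ a *ᶻ z) *ᶻ (c *ᶻ x -ᶻ a *ᶻ z) +ᶻ (b *ᶻ x -ᶻ a *ᶻ y) *ᶻ (b *ᶻ x -ᶻ a *ᶻ y) ≡
      (a *ᶻ a +ᶻ b *ᶻ b +ᶻ c *ᶻ c) *ᶻ (x *ᶻ x +ᶻ y *ᶻ y +ᶻ z *ᶻ z) -ᶻ (a *ᶻ x +ᶻ b *ᶻ y +ᶻ c *ᶻ z) *ᶻ (a *ᶻ x +ᶻ b *ᶻ y +ᶻ c *ᶻ z)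
    lagrange = ℤ-ring

  pos-square : 1 ≤ ∣ c ∣ * ∣ c ∣
  pos-square = ≤-trans (n≢0⇒n>0 λ e → c≢0 (ℤₚ.∣i∣≡0⇒i≡0 e)) (m≤m*m ∣ c ∣)

  sum-squares≢0 : ∀ d → d *ᶻ d +ᶻ c *ᶻ c ≢ + 0
  sum-squares≢0 d e = contradiction pos-square (<⇒≱ (s≤s (≤-trans (m≤n+m _ (∣ d ∣ * ∣ d ∣)) (≤-reflexive (ℤₚ.+-injective
    (trans (ℤₚ.pos-+ (∣ d ∣ * ∣ d ∣) _) (trans (cong₂ _+ᶻ_ (∣z∣²≡z² d) (∣z∣²≡z² c)) e)))))))

  1≤‖h‖² : 1 ≤ ‖ a , b , c ‖²
  1≤‖h‖² = ≤-trans pos-square (m≤n+m _ (∣ a ∣ * ∣ a ∣ + ∣ b ∣ * ∣ b ∣))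

  -- A vector is determined by its dot and cross products with h ≠ 0. As c and a² + c² are nonzero,
  -- the form returns w₁ and w₂, and then |h|² z = c (h·p) - a w₂ + b w₁.
  toForm-injective : ∀ p q → dot (a , b , c) p ≡ dot (a , b , c) q → toForm p ≡ toForm q → p ≡ q
  toForm-injective p@(x , y , z) q@(x′ , y′ , z′) dot≡ form≡ = cong₂ _,_ x≡ (cong₂ _,_ y≡ z≡)
    where
    instance
      _ = ℤ.≢-nonZero c≢0
      _ = ℤ.≢-nonZero (sum-squares≢0 a)
      _ = ℤ.≢-nonZero {normSq (a , b , c)} (λ e → contradiction 1≤‖h‖² (<⇒≱ (s≤s (≤-reflexive (ℤₚ.+-injective (trans (sym (normSq≡‖‖² (a , b , c))) e))))))
    w₂≡ : c *ᶻ x -ᶻ a *ᶻ z ≡ c *ᶻ x′ -ᶻ a *ᶻ z′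
    w₂≡ = ℤₚ.*-cancelˡ-≡ c _ _ (cong proj₂ form≡)
    w₁≡ : b *ᶻ z -ᶻ c *ᶻ y ≡ b *ᶻ z′ -ᶻ c *ᶻ y′
    w₁≡ = ℤₚ.*-cancelˡ-≡ (a *ᶻ a +ᶻ c *ᶻ c) _ _ (+ᶻ-cancelʳ (a *ᶻ b *ᶻ (c *ᶻ x -ᶻ a *ᶻ z)) _ _
      (trans (cong proj₁ form≡) (cong (λ w → (a *ᶻ a +ᶻ c *ᶻ c) *ᶻ (b *ᶻ z′ -ᶻ c *ᶻ y′) +ᶻ a *ᶻ b *ᶻ w) (sym w₂≡))))
    solve-z : ∀ a b c x y z → (a *ᶻ a +ᶻ b *ᶻ b +ᶻ c *ᶻ c) *ᶻ z ≡
      c *ᶻ (a *ᶻ x +ᶻ b *ᶻ y +ᶻ c *ᶻ z) -ᶻ a *ᶻ (c *ᶻ x -ᶻ a *ᶻ z) +ᶻ b *ᶻ (b *ᶻ z -ᶻ c *ᶻ y)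
    solve-z = ℤ-ring
    z≡ : z ≡ z′
    z≡ = ℤₚ.*-cancelˡ-≡ (normSq (a , b , c)) z z′ (trans (solve-z a b c x y z)
      (trans (cong₂ (λ k w → c *ᶻ k -ᶻ a *ᶻ (c *ᶻ x -ᶻ a *ᶻ z) +ᶻ b *ᶻ w) dot≡ w₁≡)
      (trans (cong (λ w → c *ᶻ dot (a , b , c) q -ᶻ a *ᶻ w +ᶻ b *ᶻ (b *ᶻ z′ -ᶻ c *ᶻ y′)) w₂≡) (sym (solve-z a b c x′ y′ z′)))))
    solve-x : ∀ a c x z → c *ᶻ x ≡ (c *ᶻ x -ᶻ a *ᶻ z) +ᶻ a *ᶻ z
    solve-x = ℤ-ring
    x≡ : x ≡ x′
    x≡ = ℤₚ.*-cancelˡ-≡ c x x′ (trans (solve-x a c x z) (trans (cong₂ (λ w v → w +ᶻ a *ᶻ v) w₂≡ z≡) (sym (solve-x a c x′ z′))))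
    solve-y : ∀ b c y z → c *ᶻ y ≡ b *ᶻ z -ᶻ (b *ᶻ z -ᶻ c *ᶻ y)
    solve-y = ℤ-ring
    y≡ : y ≡ y′
    y≡ = ℤₚ.*-cancelˡ-≡ c y y′ (trans (solve-y b c y z) (trans (cong₂ (λ w v → b *ᶻ v -ᶻ w) w₁≡ z≡) (sym (solve-y b c y′ z′))))

  -- On the section the form takes one value V. It is nonnegative, being represented, so dropping
  -- the term -k² bounds it by `discriminant a c` times |h|² m, uniformly in k.
  plane-section-count : ∀ m k B → discriminant a c * (‖ a , b , c ‖² * m) ≤ B → (L : List Point) → Unique L →
    All (λ p → normSq p ≡ + m × dot (a , b , c) p ≡ k) L → length L ≤ τ B * (τ B * 10)
  plane-section-count m k B small [] _ _ = z≤n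
  plane-section-count m k B small L@(p₀ ∷ _) uL props = begin
    length L ≡⟨ length-map toForm L ⟨
    length (map toForm L) ≤⟨ binary-form-count H ∣ V ∣ B 1≤‖h‖² V≤B (map toForm L) uniq
                                    (Allₚ.map⁺ (All.map (λ {p} (n , d) → isRep p n d) props)) ⟩
    τ B * (τ B * 10) ∎
    where
    open ≤-Reasoning
    H : ℕ
    H = ‖ a , b , c ‖²
    V : ℤ
    V = (a *ᶻ a +ᶻ c *ᶻ c) *ᶻ (c *ᶻ c) *ᶻ (normSq (a , b , c) *ᶻ + m -ᶻ k *ᶻ k)
    isV : ∀ p → normSq p ≡ + m → dot (a , b , c) p ≡ k → let (X , Y) = toForm p in X *ᶻ X +ᶻ + H *ᶻ (Y *ᶻ Y) ≡ V
    isV p n d = trans (cong (λ h → let (X , Y) = toForm p in X *ᶻ X +ᶻ h *ᶻ (Y *ᶻ Y)) (sym (normSq≡‖‖² (a , b , c))))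
      (trans (value p) (cong₂ (λ v w → (a *ᶻ a +ᶻ c *ᶻ c) *ᶻ (c *ᶻ c) *ᶻ (normSq (a , b , c) *ᶻ v -ᶻ w *ᶻ w)) n d))
    V≡ : V ≡ + ∣ V ∣
    V≡ = let (n , d) = All.lookup props (here refl) in
      nonneg-sum H (proj₁ (toForm p₀)) (proj₂ (toForm p₀)) (isV p₀ n d)
    isRep : ∀ p → normSq p ≡ + m → dot (a , b , c) p ≡ k → IsRep H ∣ V ∣ (toForm p)
    isRep p n d = trans (isV p n d) V≡
    V≤B : ∣ V ∣ ≤ B
    V≤B = ≤-trans (m≤m+n ∣ V ∣ (discriminant a c * (∣ k ∣ * ∣ k ∣))) (≤-trans (≤-reflexive (ℤₚ.+-injective total)) small)
      where
      lemma : ∀ f g h → f *ᶻ (g -ᶻ h) +ᶻ f *ᶻ h ≡ f *ᶻ g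
      lemma = ℤ-ring
      total : + (∣ V ∣ + discriminant a c * (∣ k ∣ * ∣ k ∣)) ≡ + (discriminant a c * (H * m))
      total = trans (ℤₚ.pos-+ ∣ V ∣ _)
        (trans (cong₂ _+ᶻ_ (sym V≡) (trans (ℤₚ.pos-* (discriminant a c) _) (cong₂ _*ᶻ_ (+discriminant a c) (∣z∣²≡z² k))))
        (trans (lemma ((a *ᶻ a +ᶻ c *ᶻ c) *ᶻ (c *ᶻ c)) (normSq (a , b , c) *ᶻ + m) (k *ᶻ k))
        (trans (cong₂ _*ᶻ_ (sym (+discriminant a c)) (trans (cong (_*ᶻ + m) (normSq≡‖‖² (a , b , c))) (sym (ℤₚ.pos-* H m))))
        (sym (ℤₚ.pos-* (discriminant a c) (H * m))))))
    uniq : Unique (map toForm L)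
    uniq = unique-map L uL (λ p q p∈ q∈ → toForm-injective p q
      (trans (proj₂ (All.lookup props p∈)) (sym (proj₂ (All.lookup props q∈)))))
      where
      unique-map : (L : List Point) → Unique L → (∀ p q → p ∈ L → q ∈ L → toForm p ≡ toForm q → p ≡ q) → Unique (map toForm L)
      unique-map [] _ _ = []
      unique-map (p ∷ L) (p∉ ∷ u) inj = Allₚ.map⁺ (All.tabulate λ {q} q∈ e → All.lookup p∉ q∈ (inj p q (here refl) (there q∈) e))
        ∷ unique-map L u λ p q p∈ q∈ → inj p q (there p∈) (there q∈)

opaque

  -- With the coordinates of h at most 2m and s = (2m)², the value is at most 2s · s · 3s · m = 384
  -- m⁷.
  planeValueBound : ℕ → ℕ
  planeValueBound m = 384 * m ^ 7

  subPoly-planeValueBound : ∀ {T} → SubPoly T → SubPoly (λ m → T (planeValueBound m))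
  subPoly-planeValueBound t = subPoly-∘ t 384 6 (s≤s z≤n)

  plane-section-bound : ∀ a b c m → ∣ a ∣ ≤ m + m → ∣ b ∣ ≤ m + m → ∣ c ∣ ≤ m + m →
    discriminant a c * (‖ a , b , c ‖² * m) ≤ planeValueBound m
  plane-section-bound a b c m a≤ b≤ c≤ = ≤-trans
    (*-mono-≤ (*-mono-≤ (+-mono-≤ (sq a≤) (sq c≤)) (sq c≤)) (*-monoˡ-≤ m (+-mono-≤ (+-mono-≤ (sq a≤) (sq b≤)) (sq c≤))))
    (≤-reflexive (lemma m))
    where
    sq : ∀ {n} → n ≤ m + m → n * n ≤ (m + m) * (m + m)
    sq h = *-mono-≤ h h
    lemma : ∀ m → let s = (m + m) * (m + m) in (s + s) * s * ((s + s + s) * m) ≡ 384 * (m * (m * (m * (m * (m * (m * (m * 1)))))))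
    lemma = ℕ-ring

  circleBound : ℕ → ℕ
  circleBound m = τ (planeValueBound m) * (τ (planeValueBound m) * 10)

  1≤circleBound : ∀ m → 1 ≤ circleBound m
  1≤circleBound m = *-mono-≤ (1≤τ (planeValueBound m)) (*-mono-≤ (1≤τ (planeValueBound m)) (s≤s (z≤n {9})))

  subPoly-circleBound : SubPoly circleBound
  subPoly-circleBound = subPoly-* (subPoly-planeValueBound subPoly-τ)
    (subPoly-* (subPoly-planeValueBound subPoly-τ) (subPoly-const 10))

-- The crude |x| ≤ x² ≤ m avoids roots; it enters only through quantities whose size need merely be
-- polynomial in m.
coordinate≤ : ∀ {p m} → normSq p ≡ + m → let (x , y , z) = p in ∣ x ∣ ≤ m × ∣ y ∣ ≤ m × ∣ z ∣ ≤ m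
coordinate≤ {p@(x , y , z)} {m} h =
    ≤-trans (m≤m*m ∣ x ∣) (≤-trans (m≤m+n _ _) (≤-trans (m≤m+n _ _) sum≤))
  , ≤-trans (m≤m*m ∣ y ∣) (≤-trans (m≤n+m _ (∣ x ∣ * ∣ x ∣)) (≤-trans (m≤m+n _ _) sum≤))
  , ≤-trans (m≤m*m ∣ z ∣) (≤-trans (m≤n+m _ (∣ x ∣ * ∣ x ∣ + ∣ y ∣ * ∣ y ∣)) sum≤)
  where
  sum≤ : ‖ p ‖² ≤ m
  sum≤ = ≤-reflexive (ℤₚ.+-injective (trans (sym (normSq≡‖‖² p)) h))

rotate : Point → Point
rotate (x , y , z) = y , z , x

rotate-injective : ∀ {p q} → rotate p ≡ rotate q → p ≡ q
rotate-injective refl = refl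

rotate-sum : ∀ x y z → y +ᶻ z +ᶻ x ≡ x +ᶻ y +ᶻ z
rotate-sum = ℤ-ring

normSq-rotate : ∀ p → normSq (rotate p) ≡ normSq p
normSq-rotate (x , y , z) = rotate-sum (x *ᶻ x) (y *ᶻ y) (z *ᶻ z)

dot-rotate : ∀ h p → dot (rotate h) (rotate p) ≡ dot h p
dot-rotate (a , b , c) (x , y , z) = rotate-sum (a *ᶻ x) (b *ᶻ y) (c *ᶻ z)

opaque
  unfolding circleBound

  -- A cyclic rotation moves a nonzero coordinate of h into the third place, where `CircleForm`
  -- needs it.
  plane-count : ∀ m k h → h ≢ origin → let (a , b , c) = h in ∣ a ∣ ≤ m + m → ∣ b ∣ ≤ m + m → ∣ c ∣ ≤ m + m →
    (L : List Point) → Unique L → All (λ p → normSq p ≡ + m × dot h p ≡ k) L → length L ≤ circleBound m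
  plane-count m k h@(a , b , c) h≢0 a≤ b≤ c≤ L uL props with c ℤ.≟ + 0 | a ℤ.≟ + 0 | b ℤ.≟ + 0
  ... | no c≢0 | _ | _ = CircleForm.plane-section-count a b c c≢0 m k _ (plane-section-bound a b c m a≤ b≤ c≤) L uL props
  ... | yes refl | yes refl | yes refl = contradiction refl h≢0
  ... | yes _ | no a≢0 | _ = subst (_≤ circleBound m) (length-map rotate L)
    (CircleForm.plane-section-count b c a a≢0 m k _ (plane-section-bound b c a m b≤ c≤ a≤) (map rotate L) (Uniqueₚ.map⁺ rotate-injective uL)
      (Allₚ.map⁺ (All.map (λ {p} (n , d) → trans (normSq-rotate p) n , trans (dot-rotate h p) d) props)))
  ... | yes _ | yes _ | no b≢0 = subst (_≤ circleBound m) (length-map (rotate ∘ rotate) L)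
    (CircleForm.plane-section-count c a b b≢0 m k _ (plane-section-bound c a b m c≤ a≤ b≤) (map (rotate ∘ rotate) L)
      (Uniqueₚ.map⁺ (rotate-injective ∘ rotate-injective) uL)
      (Allₚ.map⁺ (All.map (λ {p} (n , d) → trans (normSq-rotate (rotate p)) (trans (normSq-rotate p) n)
                                         , trans (dot-rotate (rotate h) (rotate p)) (trans (dot-rotate h p) d)) props)))

p⊖q≡0 : ∀ {p q} → p ⊖ q ≡ origin → p ≡ q
p⊖q≡0 e = cong₂ _,_ (ℤₚ.i-j≡0⇒i≡j _ _ (cong proj₁ e)) (cong₂ _,_ (ℤₚ.i-j≡0⇒i≡j _ _ (cong (proj₁ ∘ proj₂) e)) (ℤₚ.i-j≡0⇒i≡j _ _ (cong (proj₂ ∘ proj₂) e)))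

⊖-injectiveˡ : ∀ {u p q} → p ⊖ u ≡ q ⊖ u → p ≡ q
⊖-injectiveˡ e = cong₂ _,_ (inj (cong proj₁ e)) (cong₂ _,_ (inj (cong (proj₁ ∘ proj₂) e)) (inj (cong (proj₂ ∘ proj₂) e)))
  where
  inj : ∀ {x y u} → x -ᶻ u ≡ y -ᶻ u → x ≡ y
  inj {x} {y} {u} e = +ᶻ-cancelʳ (-ᶻ u) x y e

-- The points common to two spheres with centres u ≠ v lie on a plane with normal v − u.
circle-count : ∀ m {u v} → u ≢ v → (L : List Point) → Unique L →
  All (λ p → normSq (p ⊖ u) ≡ + m × normSq (p ⊖ v) ≡ + m) L → length L ≤ circleBound m
circle-count m u≢v [] _ _ = z≤n
circle-count m {u@(u₁ , u₂ , u₃)} {v@(v₁ , v₂ , v₃)} u≢v L@(p₀@(x₀ , y₀ , z₀) ∷ _) uL props@((onU , onV) ∷ _) =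
  subst (_≤ circleBound m) (length-map (_⊖ u) L)
    (plane-count m (dot (v ⊖ u) (p₀ ⊖ u)) (v ⊖ u) (λ e → u≢v (sym (p⊖q≡0 e)))
      (diff x₀ (proj₁ (coordinate≤ {p₀ ⊖ u} onU)) (proj₁ (coordinate≤ {p₀ ⊖ v} onV)))
      (diff y₀ (proj₁ (proj₂ (coordinate≤ {p₀ ⊖ u} onU))) (proj₁ (proj₂ (coordinate≤ {p₀ ⊖ v} onV))))
      (diff z₀ (proj₂ (proj₂ (coordinate≤ {p₀ ⊖ u} onU))) (proj₂ (proj₂ (coordinate≤ {p₀ ⊖ v} onV))))
      (map (_⊖ u) L) (Uniqueₚ.map⁺ ⊖-injectiveˡ uL)
      (Allₚ.map⁺ (All.map (λ {p} (n , n′) → n , halve-≡ (dot (v ⊖ u) (p ⊖ u)) (dot (v ⊖ u) (p₀ ⊖ u)) (trans (twice p n n′) (sym (twice p₀ onU onV)))) props)))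
  where
  diff : ∀ x {s t} → ∣ x -ᶻ s ∣ ≤ m → ∣ x -ᶻ t ∣ ≤ m → ∣ t -ᶻ s ∣ ≤ m + m
  diff x {s} {t} h h′ = subst (λ z → ∣ z ∣ ≤ m + m) (lemma x s t)
    (≤-trans (ℤₚ.∣i-j∣≤∣i∣+∣j∣ (x -ᶻ s) (x -ᶻ t)) (+-mono-≤ h h′))
    where
    lemma : ∀ x s t → (x -ᶻ s) -ᶻ (x -ᶻ t) ≡ t -ᶻ s
    lemma = ℤ-ring
  -- Polarisation: 2 (v - u)·(p - u) = |p - u|² + |v - u|² - |p - v|², the same for all common
  -- points p. It is kept doubled to avoid a division.
  twice : ∀ p → normSq (p ⊖ u) ≡ + m → normSq (p ⊖ v) ≡ + m →
    dot (v ⊖ u) (p ⊖ u) +ᶻ dot (v ⊖ u) (p ⊖ u) ≡ + m +ᶻ normSq (v ⊖ u) -ᶻ + m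
  twice p@(x , y , z) n n′ = trans
    (lemma (x -ᶻ u₁) (y -ᶻ u₂) (z -ᶻ u₃) (v₁ -ᶻ u₁) (v₂ -ᶻ u₂) (v₃ -ᶻ u₃))
    (cong₂ (λ s t → s +ᶻ normSq (v ⊖ u) -ᶻ t) n (trans (cong normSq (cong₂ _,_ (shift x u₁ v₁) (cong₂ _,_ (shift y u₂ v₂) (shift z u₃ v₃)))) n′))
    where
    shift : ∀ x u v → (x -ᶻ u) -ᶻ (v -ᶻ u) ≡ x -ᶻ v
    shift = ℤ-ring
    lemma : ∀ x y z a b c → (a *ᶻ x +ᶻ b *ᶻ y +ᶻ c *ᶻ z) +ᶻ (a *ᶻ x +ᶻ b *ᶻ y +ᶻ c *ᶻ z) ≡
      (x *ᶻ x +ᶻ y *ᶻ y +ᶻ z *ᶻ z) +ᶻ (a *ᶻ a +ᶻ b *ᶻ b +ᶻ c *ᶻ c) -ᶻ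
      ((x -ᶻ a) *ᶻ (x -ᶻ a) +ᶻ (y -ᶻ b) *ᶻ (y -ᶻ b) +ᶻ (z -ᶻ c) *ᶻ (z -ᶻ c))
    lemma = ℤ-ring

-- Residues of spheres

small-∣ : ∀ e z → + e ℤD.∣ z → ∣ z ∣ < e → z ≡ + 0
small-∣ e z e∣z z<e with ∣ z ∣ in eq | ∣ᶻ⇒∣ e∣z
... | zero  | _   = ℤₚ.∣i∣≡0⇒i≡0 eq
... | suc k | e∣k = contradiction (∣⇒≤ e∣k) (<⇒≱ z<e)

∣difference∣< : ∀ {r s e} → r < e → s < e → ∣ + r -ᶻ + s ∣ < e
∣difference∣< {r} {s} r<e s<e = subst (λ z → ∣ z ∣ < _) (sym (ℤₚ.m-n≡m⊖n r s))
  (≤-<-trans (ℤₚ.∣m⊝n∣≤m⊔n r s) (⊔-lub r<e s<e))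

module _ (q : ℕ) .{{_ : NonZero q}} where

  residue-∣ : ∀ z → + q ℤD.∣ z -ᶻ + (z ℤDM.%ℕ q)
  residue-∣ z = ℤD.divides (z ℤDM./ℕ q) (trans (cong (_-ᶻ + (z ℤDM.%ℕ q)) (ℤDM.a≡a%ℕn+[a/ℕn]*n z q))
    (lemma (+ (z ℤDM.%ℕ q)) _))
    where
    lemma : ∀ r s → (r +ᶻ s) -ᶻ r ≡ s
    lemma = ℤ-ring

  residue≡⇒∣ : ∀ y z → y ℤDM.%ℕ q ≡ z ℤDM.%ℕ q → + q ℤD.∣ y -ᶻ z
  residue≡⇒∣ y z e = subst (+ q ℤD.∣_) (trans (cong (λ r → (y -ᶻ + r) -ᶻ (z -ᶻ + (z ℤDM.%ℕ q))) e) (lemma y z _))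
    (ℤD.∣m∣n⇒∣m-n (residue-∣ y) (residue-∣ z))
    where
    lemma : ∀ y z r → (y -ᶻ r) -ᶻ (z -ᶻ r) ≡ y -ᶻ z
    lemma = ℤ-ring

  ∣⇒residue≡ : ∀ y z → + q ℤD.∣ y -ᶻ z → y ℤDM.%ℕ q ≡ z ℤDM.%ℕ q
  ∣⇒residue≡ y z d = ℤₚ.+-injective (ℤₚ.i-j≡0⇒i≡j _ _ (small-∣ q (+ (y ℤDM.%ℕ q) -ᶻ + (z ℤDM.%ℕ q))
    (subst (+ q ℤD.∣_) (lemma y z _ _) (ℤD.∣m∣n⇒∣m+n (ℤD.∣m∣n⇒∣m-n (residue-∣ z) (residue-∣ y)) d))
    (∣difference∣< (ℤDM.n%ℕd<d y q) (ℤDM.n%ℕd<d z q))))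
    where
    lemma : ∀ y z r s → ((z -ᶻ s) -ᶻ (y -ᶻ r)) +ᶻ (y -ᶻ z) ≡ r -ᶻ s
    lemma = ℤ-ring

-- All listed v have the same residue modulo e, so the quotient `v / e`, which is below g,
-- identifies v.
progression-count : ∀ e g c → 1 ≤ e → length (filter (λ v → + e ℤD.∣? (c -ᶻ + v)) (upTo (g * e))) ≤ g
progression-count e g c 1≤e = subst (length xs ≤_) (length-upTo g)
  (length≤-injective _≟_ xs (upTo g) (Uniqueₚ.filter⁺ P? (Uniqueₚ.upTo⁺ (g * e))) (λ v → v / e)
    (λ v v∈ → ∈-upTo⁺ (m<n*o⇒m/o<n {v} {g} {e} (∈-upTo⁻ (proj₁ (∈-filter⁻ P? {xs = upTo (g * e)} v∈)))))
    λ v w v∈ w∈ v/e≡w/e → same v w (proj₂ (∈-filter⁻ P? {xs = upTo (g * e)} v∈)) (proj₂ (∈-filter⁻ P? {xs = upTo (g * e)} w∈)) v/e≡w/e)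
  where
  instance _ = >-nonZero 1≤e
  P? : Decidable₁ (λ v → + e ℤD.∣ (c -ᶻ + v))
  P? v = + e ℤD.∣? (c -ᶻ + v)
  xs : List ℕ
  xs = filter P? (upTo (g * e))
  same : ∀ v w → + e ℤD.∣ (c -ᶻ + v) → + e ℤD.∣ (c -ᶻ + w) → v / e ≡ w / e → v ≡ w
  same v w dv dw q≡ = trans (m≡m%n+[m/n]*n v e) (trans (cong₂ (λ r s → r + s * e) r≡ q≡) (sym (m≡m%n+[m/n]*n w e)))
    where
    lemma : ∀ c r s t → (c -ᶻ (s +ᶻ t)) -ᶻ (c -ᶻ (r +ᶻ t)) ≡ r -ᶻ s
    lemma = ℤ-ring
    expand : ∀ v → + v ≡ + (v % e) +ᶻ + (v / e * e)
    expand v = trans (cong +_ (m≡m%n+[m/n]*n v e)) (ℤₚ.pos-+ (v % e) _)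
    r≡ : v % e ≡ w % e
    r≡ = ℤₚ.+-injective (ℤₚ.i-j≡0⇒i≡j _ _ (small-∣ e _ (subst (+ e ℤD.∣_)
      (trans (cong₂ (λ a b → (c -ᶻ b) -ᶻ (c -ᶻ a)) (trans (expand v) (cong (λ s → + (v % e) +ᶻ + (s * e)) q≡)) (expand w))
        (lemma c (+ (v % e)) (+ (w % e)) (+ (w / e * e))))
      (ℤD.∣m∣n⇒∣m-n dw dv)) (∣difference∣< (m%n<n v e) (m%n<n w e))))

-- A coincidence (n − i)² ≡ (n − i′)² mod q reads q ∣ s t with s = i′ − i and t = 2n − i − i′. With g = gcd (s , q), s lies in
-- a progression modulo g and t in one modulo q / g.
square-coincidences : ∀ q n → 1 ≤ q → (γ : ℕ → ℕ) →
  (∀ i j → γ i ≡ γ j → + q ℤD.∣ (n -ᶻ + i) *ᶻ (n -ᶻ + i) -ᶻ (n -ᶻ + j) *ᶻ (n -ᶻ + j)) →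
  ∑ (upTo q) (λ i → ∑ (upTo q) λ j → ⟦ γ i ≟ γ j ⟧) ≤ #divisors q * (4 * q)
square-coincidences q n 1≤q γ γ⇒∣ = begin
  ∑ (upTo q) (λ i → ∑ (upTo q) λ j → ⟦ γ i ≟ γ j ⟧) ≡⟨ ∑-cartesianProduct (upTo q) (upTo q) _ ⟨
  ∑ square (λ p → ⟦ γ (proj₁ p) ≟ γ (proj₂ p) ⟧) ≡⟨ length-filter≡∑ P? square ⟨
  length pairs ≤⟨ length≤fibres _≟_ pairs (divisors q) g (λ p _ → ∈-divisors⁺ 1≤q (gcd[m,n]∣n (s p) q)) fibre ⟩
  #divisors q * (4 * q) ∎
  where
  open ≤-Reasoning
  square : List (ℕ × ℕ)
  square = cartesianProduct (upTo q) (upTo q)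
  P? : Decidable₁ (λ p → γ (proj₁ p) ≡ γ (proj₂ p))
  P? p = γ (proj₁ p) ≟ γ (proj₂ p)
  pairs : List (ℕ × ℕ)
  pairs = filter P? square
  s : ℕ × ℕ → ℕ
  s (i , j) = ∣ + j -ᶻ + i ∣
  g : ℕ × ℕ → ℕ
  g p = gcd (s p) q
  pairs-unique : Unique pairs
  pairs-unique = Uniqueₚ.filter⁺ P? (Uniqueₚ.cartesianProduct⁺ (Uniqueₚ.upTo⁺ q) (Uniqueₚ.upTo⁺ q))
  fibre : ∀ d → d ∈ divisors q → length (filter (λ p → g p ≟ d) pairs) ≤ 4 * q
  fibre d d∈ with ∈-divisors⁻ {n = q} d∈
  ... | divides e q≡ed = begin
    length (filter (λ p → g p ≟ d) pairs) ≤⟨ length≤-injective (≡-dec _≟_ _≟_) (filter (λ p → g p ≟ d) pairs) (cartesianProduct S T)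
                                                   (Uniqueₚ.filter⁺ (λ p → g p ≟ d) pairs-unique) label (λ p → label∈ p ∘ inF p)
                                                   (λ p p′ p∈ p′∈ → label-inj p p′ (inF p p∈) (inF p′ p′∈)) ⟩
    length (cartesianProduct S T) ≡⟨ length-cartesianProduct S T ⟩
    length S * length T ≤⟨ *-mono-≤ (progression-count d (2 * e) (+ q) (∣-pos 1≤q (divides e q≡ed)))
                                                          (progression-count e (2 * d) (n +ᶻ n) (∣-pos 1≤q (divides d (trans q≡ed (*-comm e d))))) ⟩
    2 * e * (2 * d) ≡⟨ four e d ⟩
    4 * (e * d) ≡⟨ cong (_*_ 4) q≡ed ⟨
    4 * q ∎
    where
    S T : List ℕ
    S = filter (λ v → + d ℤD.∣? (+ q -ᶻ + v)) (upTo (2 * e * d))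
    T = filter (λ v → + e ℤD.∣? (n +ᶻ n -ᶻ + v)) (upTo (2 * d * e))
    four : ∀ e d → 2 * e * (2 * d) ≡ 4 * (e * d)
    four = ℕ-ring
    -- The difference j - i is shifted by q to be a natural number; this preserves its class modulo
    -- d, as d ∣ q. Both labels are below 2q, so there are at most 2e and 2d of them, whence 4q.
    label : ℕ × ℕ → ℕ × ℕ
    label (i , j) = j + (q ∸ i) , i + j
    Fibre : ℕ × ℕ → Set
    Fibre p@(i , j) = i < q × j < q × γ i ≡ γ j × g p ≡ d
    inF : ∀ p → p ∈ filter (λ p → g p ≟ d) pairs → Fibre p
    inF p p∈ = let (p∈pairs , gp) = ∈-filter⁻ (λ p → g p ≟ d) {xs = pairs} p∈
                   (p∈sq , γ≡) = ∈-filter⁻ P? {xs = square} p∈pairs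
                   (i∈ , j∈) = ∈-cartesianProduct⁻ (upTo q) (upTo q) p∈sq
               in ∈-upTo⁻ i∈ , ∈-upTo⁻ j∈ , γ≡ , gp
    2q≡ : 2 * q ≡ 2 * e * d
    2q≡ = trans (cong (_*_ 2) q≡ed) (sym (*-assoc 2 e d))
    <2q : ∀ {a b} → a < q → b ≤ q → a + b < 2 * q
    <2q a< b≤ = ≤-trans (+-mono-≤ a< b≤) (≤-reflexive (cong (_+_ q) (sym (+-identityʳ q))))
    +[q∸i] : ∀ {i} → i ≤ q → + (q ∸ i) ≡ + q -ᶻ + i
    +[q∸i] {i} i≤q = trans (sym (ℤₚ.⊖-≥ i≤q)) (sym (ℤₚ.m-n≡m⊖n q i))
    label∈ : ∀ p → Fibre p → label p ∈ cartesianProduct S T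
    label∈ p@(i , j) (i<q , j<q , γ≡ , gp) = ∈-cartesianProduct⁺
      (∈-filter⁺ (λ v → + d ℤD.∣? (+ q -ᶻ + v)) (∈-upTo⁺ (subst (j + (q ∸ i) <_) 2q≡ (<2q j<q (m∸n≤m q i)))) d∣)
      (∈-filter⁺ (λ v → + e ℤD.∣? (n +ᶻ n -ᶻ + v)) (∈-upTo⁺ (subst (i + j <_) (trans 2q≡ (swap e d)) (<2q i<q (<⇒≤ j<q)))) e∣)
      where
      swap : ∀ e d → 2 * e * d ≡ 2 * d * e
      swap = ℕ-ring
      d∣s : d ∣ s p
      d∣s = subst (_∣ s p) gp (gcd[m,n]∣m (s p) q)
      d∣ : + d ℤD.∣ (+ q -ᶻ + (j + (q ∸ i)))
      d∣ = subst (+ d ℤD.∣_) (sym (trans (cong (_-ᶻ_ (+ q)) (trans (ℤₚ.pos-+ j _) (cong (_+ᶻ_ (+ j)) (+[q∸i] (<⇒≤ i<q)))))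
        (lemma (+ q) (+ i) (+ j)))) (ℤD.∣m⇒∣-m (∣⇒∣ᶻ (+ j -ᶻ + i) d∣s))
        where
        lemma : ∀ q i j → q -ᶻ (j +ᶻ (q -ᶻ i)) ≡ -ᶻ (j -ᶻ i)
        lemma = ℤ-ring
      e∣ : + e ℤD.∣ (n +ᶻ n -ᶻ + (i + j))
      e∣ with d∣s
      ... | divides t s≡td = subst (+ e ℤD.∣_) (cong (_-ᶻ_ (n +ᶻ n)) (sym (ℤₚ.pos-+ i j))) (∣⇒∣ᶻ (n +ᶻ n -ᶻ (+ i +ᶻ + j))
            (∣m*[n/d] d e t (∣-pos 1≤q (divides e q≡ed)) (trans (cong₂ gcd (sym s≡td) (sym q≡ed)) gp)
              (subst₂ _∣_ q≡ed (trans (ℤₚ.abs-* (+ j -ᶻ + i) _) (cong (_* ∣ n +ᶻ n -ᶻ (+ i +ᶻ + j) ∣) s≡td))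
                (∣ᶻ⇒∣ (subst (+ q ℤD.∣_) (lemma n (+ i) (+ j)) (γ⇒∣ i j γ≡))))))
        where
        lemma : ∀ n i j → (n -ᶻ i) *ᶻ (n -ᶻ i) -ᶻ (n -ᶻ j) *ᶻ (n -ᶻ j) ≡ (j -ᶻ i) *ᶻ (n +ᶻ n -ᶻ (i +ᶻ j))
        lemma = ℤ-ring
    label-inj : ∀ p p′ → Fibre p → Fibre p′ → label p ≡ label p′ → p ≡ p′
    label-inj (i , j) (i′ , j′) (i<q , _) (i′<q , _) eq = cong₂ _,_ i≡ j≡
      where
      sum≡ : i + j ≡ i′ + j′
      sum≡ = cong proj₂ eq
      difference≡ : + j -ᶻ + i ≡ + j′ -ᶻ + i′
      difference≡ = trans (sym (conv i j i<q)) (trans (cong (λ c → + c -ᶻ + q) (cong proj₁ eq)) (conv i′ j′ i′<q))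
        where
        lemma : ∀ q i j → j +ᶻ (q -ᶻ i) -ᶻ q ≡ j -ᶻ i
        lemma = ℤ-ring
        conv : ∀ i j → i < q → + (j + (q ∸ i)) -ᶻ + q ≡ + j -ᶻ + i
        conv i j i<q = trans (cong (_-ᶻ + q) (trans (ℤₚ.pos-+ j _) (cong (_+ᶻ_ (+ j)) (+[q∸i] (<⇒≤ i<q))))) (lemma (+ q) (+ i) (+ j))
      j≡ : j ≡ j′
      j≡ = ℤₚ.+-injective (halve-≡ (+ j) (+ j′) (trans (sym (lemma (+ i) (+ j))) (trans (cong₂ _+ᶻ_
        (trans (sym (ℤₚ.pos-+ i j)) (trans (cong +_ sum≡) (ℤₚ.pos-+ i′ j′))) difference≡) (lemma (+ i′) (+ j′)))))
        where
        lemma : ∀ i j → (i +ᶻ j) +ᶻ (j -ᶻ i) ≡ j +ᶻ j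
        lemma = ℤ-ring
      i≡ : i ≡ i′
      i≡ = +-cancelʳ-≡ j i i′ (trans sum≡ (cong (_+_ i′) (sym j≡)))

-- Residue classes met by a sphere

Cell : Set
Cell = ℕ × ℕ × ℕ

_≟ᶜ_ : DecidableEquality Cell
_≟ᶜ_ = ≡-dec _≟_ (≡-dec _≟_ _≟_)

cells : ℕ → List Cell
cells q = cartesianProduct (upTo q) (cartesianProduct (upTo q) (upTo q))

cells-unique : ∀ q → Unique (cells q)
cells-unique q = Uniqueₚ.cartesianProduct⁺ (Uniqueₚ.upTo⁺ q) (Uniqueₚ.cartesianProduct⁺ (Uniqueₚ.upTo⁺ q) (Uniqueₚ.upTo⁺ q))

representative : Cell → Point
representative (i , j , k) = + i , + j , + k

touches? : ∀ q m (n : Point) (κ : Cell) → Dec (+ q ℤD.∣ normSq (n ⊖ representative κ) -ᶻ + m)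
touches? q m n κ = + q ℤD.∣? (normSq (n ⊖ representative κ) -ᶻ + m)

module _ (q : ℕ) .{{_ : NonZero q}} where

  cell : Point → Cell
  cell (x , y , z) = x ℤDM.%ℕ q , y ℤDM.%ℕ q , z ℤDM.%ℕ q

  cell∈ : ∀ p → cell p ∈ cells q
  cell∈ (x , y , z) = ∈-cartesianProduct⁺ (∈-upTo⁺ (ℤDM.n%ℕd<d x q))
    (∈-cartesianProduct⁺ (∈-upTo⁺ (ℤDM.n%ℕd<d y q)) (∈-upTo⁺ (ℤDM.n%ℕd<d z q)))

  normSq-cell : ∀ n u → + q ℤD.∣ normSq (n ⊖ u) -ᶻ normSq (n ⊖ representative (cell u))
  normSq-cell (a , b , c) (x , y , z) = subst (+ q ℤD.∣_) (lemma a b c x y z x′ y′ z′)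
    (ℤD.∣m∣n⇒∣m+n (ℤD.∣m∣n⇒∣m+n (ℤD.∣m⇒∣m*n (x +ᶻ x′ -ᶻ a -ᶻ a) (residue-∣ q x)) (ℤD.∣m⇒∣m*n (y +ᶻ y′ -ᶻ b -ᶻ b) (residue-∣ q y)))
      (ℤD.∣m⇒∣m*n (z +ᶻ z′ -ᶻ c -ᶻ c) (residue-∣ q z)))
    where
    x′ y′ z′ : ℤ
    x′ = + (x ℤDM.%ℕ q)
    y′ = + (y ℤDM.%ℕ q)
    z′ = + (z ℤDM.%ℕ q)
    lemma : ∀ a b c x y z x′ y′ z′ →
      (x -ᶻ x′) *ᶻ (x +ᶻ x′ -ᶻ a -ᶻ a) +ᶻ (y -ᶻ y′) *ᶻ (y +ᶻ y′ -ᶻ b -ᶻ b) +ᶻ (z -ᶻ z′) *ᶻ (z +ᶻ z′ -ᶻ c -ᶻ c) ≡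
      ((a -ᶻ x) *ᶻ (a -ᶻ x) +ᶻ (b -ᶻ y) *ᶻ (b -ᶻ y) +ᶻ (c -ᶻ z) *ᶻ (c -ᶻ z)) -ᶻ
      ((a -ᶻ x′) *ᶻ (a -ᶻ x′) +ᶻ (b -ᶻ y′) *ᶻ (b -ᶻ y′) +ᶻ (c -ᶻ z′) *ᶻ (c -ᶻ z′))
    lemma = ℤ-ring

  on-sphere⇒touches : ∀ m n u → normSq (n ⊖ u) ≡ + m → + q ℤD.∣ normSq (n ⊖ representative (cell u)) -ᶻ + m
  on-sphere⇒touches m n u e = subst (+ q ℤD.∣_) (trans (cong (λ v → -ᶻ (v -ᶻ normSq (n ⊖ representative (cell u)))) e)
    (lemma (+ m) (normSq (n ⊖ representative (cell u)))))
    (ℤD.∣m⇒∣-m (normSq-cell n u))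
    where
    lemma : ∀ m s → -ᶻ (m -ᶻ s) ≡ s -ᶻ m
    lemma = ℤ-ring

  touches⇒∣ : ∀ m n u → + q ℤD.∣ normSq (n ⊖ representative (cell u)) -ᶻ + m → + q ℤD.∣ normSq (n ⊖ u) -ᶻ + m
  touches⇒∣ m n u d = subst (+ q ℤD.∣_) (lemma (normSq (n ⊖ u)) (normSq (n ⊖ representative (cell u))) (+ m)) (ℤD.∣m∣n⇒∣m+n (normSq-cell n u) d)
    where
    lemma : ∀ s t m → (s -ᶻ t) +ᶻ (t -ᶻ m) ≡ s -ᶻ m
    lemma = ℤ-ring

  -- With the first coordinate fixed, the condition is a coincidence of two quadratic polynomials in
  -- one variable each. Cauchy-Schwarz reduces it to the self-coincidences of a square, which number
  -- at most 4q times the divisor count; there are q slices.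
  touched-cells : ∀ m n → ∑ (cells q) (λ κ → ⟦ touches? q m n κ ⟧) ≤ q * (#divisors q * (4 * q))
  touched-cells m n@(a , b , c) = begin
    ∑ (cells q) (λ κ → ⟦ touches? q m n κ ⟧)
      ≡⟨ ∑-cartesianProduct (upTo q) (cartesianProduct (upTo q) (upTo q)) _ ⟩
    ∑ (upTo q) (λ i → ∑ (cartesianProduct (upTo q) (upTo q)) (λ p → ⟦ touches? q m n (i , p) ⟧))
      ≤⟨ ∑-mono (upTo q) (λ i → ≤-trans (≤-reflexive (∑-cartesianProduct (upTo q) (upTo q) _)) (slice i)) ⟩
    ∑ (upTo q) (λ _ → #divisors q * (4 * q))
      ≡⟨ trans (∑-const (upTo q) _) (cong (_* (#divisors q * (4 * q))) (length-upTo q)) ⟩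
    q * (#divisors q * (4 * q)) ∎
    where
    open ≤-Reasoning
    1≤q : 1 ≤ q
    1≤q = >-nonZero⁻¹ q
    slice : ∀ i → ∑ (upTo q) (λ j → ∑ (upTo q) λ k → ⟦ touches? q m n (i , j , k) ⟧) ≤ #divisors q * (4 * q)
    slice i = ≤-trans (∑-mono (upTo q) λ j → ∑-mono (upTo q) λ k → ⟦⟧-mono (touches? q m n (i , j , k)) (α j ≟ β k) (hit j k))
      (square-cancel-≤ (≤-trans (coincidences _≟_ (Uniqueₚ.upTo⁺ q) (upTo q) (upTo q) α β
        (λ j _ → ∈-upTo⁺ (ℤDM.n%ℕd<d (αᶻ j) q)) (λ k _ → ∈-upTo⁺ (ℤDM.n%ℕd<d (βᶻ k) q)))
        (*-mono-≤ (square-coincidences q b 1≤q α λ j j′ → residue≡⇒∣ q (αᶻ j) (αᶻ j′))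
                  (square-coincidences q c 1≤q β λ k k′ e → subst (+ q ℤD.∣_) (flip ((c -ᶻ + k) *ᶻ (c -ᶻ + k)) ((c -ᶻ + k′) *ᶻ (c -ᶻ + k′)) r) (ℤD.∣m⇒∣-m (residue≡⇒∣ q (βᶻ k) (βᶻ k′) e))))))
      where
      r : ℤ
      r = + m -ᶻ (a -ᶻ + i) *ᶻ (a -ᶻ + i)
      αᶻ βᶻ : ℕ → ℤ
      αᶻ j = (b -ᶻ + j) *ᶻ (b -ᶻ + j)
      βᶻ k = r -ᶻ (c -ᶻ + k) *ᶻ (c -ᶻ + k)
      α β : ℕ → ℕ
      α j = αᶻ j ℤDM.%ℕ q
      β k = βᶻ k ℤDM.%ℕ q
      flip : ∀ s t r → -ᶻ ((r -ᶻ s) -ᶻ (r -ᶻ t)) ≡ s -ᶻ t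
      flip = ℤ-ring
      hit : ∀ j k → + q ℤD.∣ normSq (n ⊖ representative (i , j , k)) -ᶻ + m → α j ≡ β k
      hit j k d = ∣⇒residue≡ q (αᶻ j) (βᶻ k) (subst (+ q ℤD.∣_)
        (lemma ((a -ᶻ + i) *ᶻ (a -ᶻ + i)) (αᶻ j) ((c -ᶻ + k) *ᶻ (c -ᶻ + k)) (+ m)) d)
        where
        lemma : ∀ x y z m → (x +ᶻ y +ᶻ z) -ᶻ m ≡ y -ᶻ ((m -ᶻ x) -ᶻ z)
        lemma = ℤ-ring

-- Incidences within boxes

-- A Kővári–Sós–Turán count inside each box: pairs u ≠ u′ in a common box share at most k neighbours, and a box meets n for at
-- most R boxes. Splitting off the boxes in which n sees weight at most 2H leaves only off-diagonal pairs.
module Incidence {V W L : Set} (_≟V_ : DecidableEquality V) (_≟L_ : DecidableEquality L)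
  (Us : List V) (uU : Unique Us) (Ns : List W) (boxes : List L) (uB : Unique boxes)
  (inc : W → V → ℕ) (inc≤1 : ∀ n u → inc n u ≤ 1)
  (box : V → L) (box∈ : ∀ u → box u ∈ boxes)
  (meets : W → L → ℕ) (inc≤meets : ∀ n u → inc n u ≤ meets n (box u))
  (R k : ℕ) (∑meets : ∀ n → ∑ boxes (meets n) ≤ R)
  (codegree : ∀ u u′ → u ≢ u′ → ∑ Ns (λ n → inc n u * inc n u′) ≤ k)
  (f : V → ℕ) (H : ℕ) (f≤H : ∀ u → f u ≤ H) (g : W → ℕ) where

  weight : L → W → V → ℕ
  weight κ n u = ⟦ box u ≟L κ ⟧ * (f u * inc n u)

  d : L → W → ℕ
  d κ n = ∑ Us (weight κ n)

  F : L → ℕ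
  F κ = ∑ Us λ u → ⟦ box u ≟L κ ⟧ * f u

  ne : V → V → ℕ
  ne u u′ = ⟦ ¬? (u ≟V u′) ⟧

  off : L → W → ℕ
  off κ n = ∑ Us λ u → ∑ Us λ u′ → ne u u′ * (weight κ n u * weight κ n u′)

  incidences total₁ total₂ : ℕ
  incidences = ∑ Ns λ n → g n * ∑ Us λ u → f u * inc n u
  total₁ = ∑ Us f
  total₂ = ∑ Us λ u → f u * ∑ Ns λ n → g n * g n * meets n (box u)

  f*inc≤f : ∀ n u → f u * inc n u ≤ f u
  f*inc≤f n u = ≤-trans (*-monoʳ-≤ (f u) (inc≤1 n u)) (≤-reflexive (*-identityʳ (f u)))

  weight≤H : ∀ κ n u → weight κ n u ≤ H
  weight≤H κ n u = ≤-trans (⟦⟧*-≤ (box u ≟L κ) _) (≤-trans (f*inc≤f n u) (f≤H u))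

  ≟+ne : ∀ u u′ → ⟦ u ≟V u′ ⟧ + ne u u′ ≡ 1
  ≟+ne u u′ with u ≟V u′
  ... | yes _ = refl
  ... | no _  = refl

  d*d≤ : ∀ κ n → d κ n * d κ n ≤ H * d κ n + off κ n
  d*d≤ κ n = begin
    d κ n * d κ n
      ≡⟨ ∑*∑ Us Us (weight κ n) (weight κ n) ⟩
    ∑ Us (λ u → ∑ Us λ u′ → weight κ n u * weight κ n u′)
      ≡⟨ ∑-cong Us (λ u → trans (∑-cong Us (λ u′ → split u u′)) (∑-+ Us _ _)) ⟩
    ∑ Us (λ u → ∑ Us (λ u′ → ⟦ u ≟V u′ ⟧ * (weight κ n u * weight κ n u′)) + ∑ Us (λ u′ → ne u u′ * (weight κ n u * weight κ n u′)))
      ≡⟨ ∑-+ Us _ _ ⟩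
    ∑ Us (λ u → ∑ Us (λ u′ → ⟦ u ≟V u′ ⟧ * (weight κ n u * weight κ n u′))) + off κ n
      ≤⟨ +-monoˡ-≤ (off κ n) (∑-mono Us λ u → ≤-trans (∑-δ-≤ _≟V_ uU (λ u′ → weight κ n u * weight κ n u′) u) (*-monoˡ-≤ (weight κ n u) (weight≤H κ n u))) ⟩
    ∑ Us (λ u → H * weight κ n u) + off κ n
      ≡⟨ cong (_+ off κ n) (∑-*ˡ Us H (weight κ n)) ⟩
    H * d κ n + off κ n ∎
    where
    open ≤-Reasoning
    split : ∀ u u′ → weight κ n u * weight κ n u′ ≡ ⟦ u ≟V u′ ⟧ * (weight κ n u * weight κ n u′) + ne u u′ * (weight κ n u * weight κ n u′)
    split u u′ = trans (sym (*-identityˡ _)) (trans (cong (_* (weight κ n u * weight κ n u′)) (sym (≟+ne u u′)))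
      (*-distribʳ-+ (weight κ n u * weight κ n u′) ⟦ u ≟V u′ ⟧ (ne u u′)))

  d≤meets*d : ∀ κ n → d κ n ≤ meets n κ * d κ n
  d≤meets*d κ n = ≤-trans (∑-mono Us term) (≤-reflexive (∑-*ˡ Us (meets n κ) (weight κ n)))
    where
    absorb : ∀ i m x → i ≤ 1 → i ≤ m → x * i ≤ m * (x * i)
    absorb zero m x _ _ = ≤-trans (≤-reflexive (*-zeroʳ x)) z≤n
    absorb (suc zero) (suc m) x _ _ = m≤m+n (x * 1) _
    absorb (suc (suc i)) m x (s≤s ()) _
    absorb (suc zero) zero x _ ()
    term : ∀ u → weight κ n u ≤ meets n κ * weight κ n u
    term u with box u ≟L κ
    ... | no _     = z≤n
    ... | yes refl = subst (λ z → z ≤ meets n κ * z) (sym (*-identityˡ _)) (absorb (inc n u) (meets n κ) (f u) (inc≤1 n u) (inc≤meets n u))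

  large : L → W → ℕ
  large κ n with 2 * H <? d κ n
  ... | yes _ = d κ n
  ... | no _  = 0

  d≤small+large : ∀ κ n → d κ n ≤ meets n κ * (2 * H) + large κ n
  d≤small+large κ n with 2 * H <? d κ n
  ... | yes _ = m≤n+m (d κ n) _
  ... | no ¬lt = ≤-trans (d≤meets*d κ n) (≤-trans (*-monoʳ-≤ (meets n κ) (≮⇒≥ ¬lt)) (≤-reflexive (sym (+-identityʳ _))))

  -- In d² ≤ H d + off the diagonal part H d is at most half of d² once d > 2H. This explains the
  -- threshold in `large`.
  large² : ∀ κ n → large κ n * large κ n ≤ meets n κ * (2 * off κ n)
  large² κ n with 2 * H <? d κ n
  ... | no _   = z≤n
  ... | yes lt = ≤-trans (*-monoˡ-≤ (d κ n) (d≤meets*d κ n)) (≤-trans (≤-reflexive (*-assoc (meets n κ) (d κ n) (d κ n)))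
      (*-monoʳ-≤ (meets n κ) bound))
    where
    open ≤-Reasoning
    bound : d κ n * d κ n ≤ 2 * off κ n
    bound = +-cancelˡ-≤ (d κ n * d κ n) _ _ (begin
      d κ n * d κ n + d κ n * d κ n ≡⟨ double (d κ n * d κ n) ⟩
      2 * (d κ n * d κ n) ≤⟨ *-monoʳ-≤ 2 (d*d≤ κ n) ⟩
      2 * (H * d κ n + off κ n) ≡⟨ distrib H (d κ n) (off κ n) ⟩
      2 * H * d κ n + 2 * off κ n ≤⟨ +-monoˡ-≤ _ (*-monoˡ-≤ (d κ n) (<⇒≤ lt)) ⟩
      d κ n * d κ n + 2 * off κ n ∎)
      where
      double : ∀ x → x + x ≡ 2 * x
      double = ℕ-ring
      distrib : ∀ h x y → 2 * (h * x + y) ≡ 2 * h * x + 2 * y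
      distrib = ℕ-ring

  -- Summing over n first turns every pair u ≠ u′ into a codegree.
  ∑off : ∀ κ → ∑ Ns (off κ) ≤ k * (F κ * F κ)
  ∑off κ = begin
    ∑ Ns (λ n → ∑ Us λ u → ∑ Us λ u′ → ne u u′ * (weight κ n u * weight κ n u′))
      ≡⟨ ∑-swap Ns Us _ ⟩
    ∑ Us (λ u → ∑ Ns λ n → ∑ Us λ u′ → ne u u′ * (weight κ n u * weight κ n u′))
      ≡⟨ ∑-cong Us (λ u → ∑-swap Ns Us _) ⟩
    ∑ Us (λ u → ∑ Us λ u′ → ∑ Ns λ n → ne u u′ * (weight κ n u * weight κ n u′))
      ≤⟨ ∑-mono Us (λ u → ∑-mono Us λ u′ → pair u u′) ⟩
    ∑ Us (λ u → ∑ Us λ u′ → k * (φ u * φ u′))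
      ≡⟨ ∑-cong Us (λ u → ∑-*ˡ Us k _) ⟩
    ∑ Us (λ u → k * ∑ Us λ u′ → φ u * φ u′)
      ≡⟨ ∑-*ˡ Us k _ ⟩
    k * ∑ Us (λ u → ∑ Us λ u′ → φ u * φ u′)
      ≡⟨ cong (_*_ k) (∑*∑ Us Us φ φ) ⟨
    k * (F κ * F κ) ∎
    where
    open ≤-Reasoning
    φ : V → ℕ
    φ u = ⟦ box u ≟L κ ⟧ * f u
    regroup : ∀ n u u′ → weight κ n u * weight κ n u′ ≡ φ u * φ u′ * (inc n u * inc n u′)
    regroup n u u′ = lemma ⟦ box u ≟L κ ⟧ (f u) (inc n u) ⟦ box u′ ≟L κ ⟧ (f u′) (inc n u′)
      where
      lemma : ∀ a b c x y z → a * (b * c) * (x * (y * z)) ≡ a * b * (x * y) * (c * z)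
      lemma = ℕ-ring
    pair : ∀ u u′ → ∑ Ns (λ n → ne u u′ * (weight κ n u * weight κ n u′)) ≤ k * (φ u * φ u′)
    pair u u′ with u ≟V u′
    ... | yes _    = ≤-trans (≤-reflexive (∑-zero Ns)) z≤n
    ... | no u≢u′ = begin
      ∑ Ns (λ n → 1 * (weight κ n u * weight κ n u′)) ≡⟨ ∑-cong Ns (λ n → trans (*-identityˡ _) (regroup n u u′)) ⟩
      ∑ Ns (λ n → φ u * φ u′ * (inc n u * inc n u′)) ≡⟨ ∑-*ˡ Ns (φ u * φ u′) _ ⟩
      φ u * φ u′ * ∑ Ns (λ n → inc n u * inc n u′) ≤⟨ *-monoʳ-≤ (φ u * φ u′) (codegree u u′ u≢u′) ⟩
      φ u * φ u′ * k ≡⟨ *-comm _ k ⟩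
      k * (φ u * φ u′) ∎

  G₂ : L → ℕ
  G₂ κ = ∑ Ns λ n → g n * g n * meets n κ

  heavy : L → ℕ
  heavy κ = ∑ Ns λ n → g n * large κ n

  -- Cauchy-Schwarz in n, with `meets` kept beside g². One factor `F κ` is then moved over, so that
  -- a second Cauchy-Schwarz over the boxes produces `total₂`, a quantity that can be averaged over
  -- moduli.
  heavy² : ∀ κ → heavy κ * heavy κ ≤ F κ * G₂ κ * (2 * k * F κ)
  heavy² κ = begin
    heavy κ * heavy κ ≤⟨ cauchy-schwarz Ns (λ n _ → pointwise n) ⟩
    G₂ κ * ∑ Ns (λ n → 2 * off κ n) ≡⟨ cong (_*_ (G₂ κ)) (∑-*ˡ Ns 2 (off κ)) ⟩
    G₂ κ * (2 * ∑ Ns (off κ)) ≤⟨ *-monoʳ-≤ (G₂ κ) (*-monoʳ-≤ 2 (∑off κ)) ⟩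
    G₂ κ * (2 * (k * (F κ * F κ))) ≡⟨ lemma (G₂ κ) k (F κ) ⟩
    F κ * G₂ κ * (2 * k * F κ) ∎
    where
    open ≤-Reasoning
    lemma : ∀ x k y → x * (2 * (k * (y * y))) ≡ y * x * (2 * k * y)
    lemma = ℕ-ring
    lemma′ : ∀ x y → x * y * (x * y) ≡ x * x * (y * y)
    lemma′ = ℕ-ring
    pointwise : ∀ n → g n * large κ n * (g n * large κ n) ≤ g n * g n * meets n κ * (2 * off κ n)
    pointwise n = ≤-trans (≤-reflexive (lemma′ (g n) (large κ n)))
      (≤-trans (*-monoʳ-≤ (g n * g n) (large² κ n)) (≤-reflexive (sym (*-assoc (g n * g n) (meets n κ) (2 * off κ n)))))

  ∑F*G₂ : ∑ boxes (λ κ → F κ * G₂ κ) ≡ total₂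
  ∑F*G₂ = trans (∑-cong boxes λ κ → trans (sym (∑-*ʳ Us (G₂ κ) _)) (∑-cong Us (at κ)))
    (sym (∑-fibres _≟L_ {xs = Us} uB box (λ u _ → box∈ u) (λ u → f u * G₂ (box u))))
    where
    at : ∀ κ u → ⟦ box u ≟L κ ⟧ * f u * G₂ κ ≡ ⟦ box u ≟L κ ⟧ * (f u * G₂ (box u))
    at κ u with box u ≟L κ
    ... | yes refl = *-assoc 1 (f u) (G₂ κ)
    ... | no _     = refl

  -- Each n meets at most R boxes, and each of them contributes at most 2H unless it is heavy. The
  -- heavy part is returned as Y with a bound on Y², which avoids a square root.
  incidence-bound : Σ ℕ λ Y → incidences ≤ 2 * H * R * ∑ Ns g + Y × Y * Y ≤ total₂ * (2 * k * total₁)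
  incidence-bound = ∑ boxes heavy , first , second
    where
    open ≤-Reasoning
    first : incidences ≤ 2 * H * R * ∑ Ns g + ∑ boxes heavy
    first = begin
      ∑ Ns (λ n → g n * ∑ Us λ u → f u * inc n u)
        ≡⟨ ∑-cong Ns (λ n → cong (_*_ (g n)) (∑-fibres _≟L_ {xs = Us} uB box (λ u _ → box∈ u) (λ u → f u * inc n u))) ⟩
      ∑ Ns (λ n → g n * ∑ boxes λ κ → d κ n)
        ≤⟨ ∑-mono Ns (λ n → *-monoʳ-≤ (g n) (∑-mono boxes λ κ → d≤small+large κ n)) ⟩
      ∑ Ns (λ n → g n * ∑ boxes λ κ → meets n κ * (2 * H) + large κ n)
        ≡⟨ ∑-cong Ns (λ n → trans (cong (_*_ (g n)) (∑-+ boxes _ _)) (*-distribˡ-+ (g n) _ _)) ⟩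
      ∑ Ns (λ n → g n * ∑ boxes (λ κ → meets n κ * (2 * H)) + g n * ∑ boxes (λ κ → large κ n))
        ≡⟨ ∑-+ Ns _ _ ⟩
      ∑ Ns (λ n → g n * ∑ boxes (λ κ → meets n κ * (2 * H))) + ∑ Ns (λ n → g n * ∑ boxes (λ κ → large κ n))
        ≤⟨ +-mono-≤ (∑-mono Ns λ n → *-monoʳ-≤ (g n) (≤-trans (≤-reflexive (∑-*ʳ boxes (2 * H) (meets n))) (*-monoˡ-≤ (2 * H) (∑meets n))))
             (≤-reflexive (trans (∑-cong Ns λ n → sym (∑-*ˡ boxes (g n) _)) (∑-swap Ns boxes _))) ⟩
      ∑ Ns (λ n → g n * (R * (2 * H))) + ∑ boxes heavy
        ≡⟨ cong (_+ ∑ boxes heavy) (trans (∑-*ʳ Ns (R * (2 * H)) g) (rearrange (∑ Ns g) R H)) ⟩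
      2 * H * R * ∑ Ns g + ∑ boxes heavy ∎
      where
      rearrange : ∀ x r h → x * (r * (2 * h)) ≡ 2 * h * r * x
      rearrange = ℕ-ring
    second : ∑ boxes heavy * ∑ boxes heavy ≤ total₂ * (2 * k * total₁)
    second = begin
      ∑ boxes heavy * ∑ boxes heavy ≤⟨ cauchy-schwarz boxes (λ κ _ → heavy² κ) ⟩
      ∑ boxes (λ κ → F κ * G₂ κ) * ∑ boxes (λ κ → 2 * k * F κ) ≡⟨ cong₂ _*_ ∑F*G₂ (trans (∑-*ˡ boxes (2 * k) F)
                                                                          (cong (_*_ (2 * k)) (sym (∑-fibres _≟L_ {xs = Us} uB box (λ u _ → box∈ u) f)))) ⟩
      total₂ * (2 * k * total₁) ∎

-- Tuple sums

⊕-comm : ∀ p q → p ⊕ q ≡ q ⊕ p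
⊕-comm (a , b , c) (x , y , z) = cong₂ _,_ (ℤₚ.+-comm a x) (cong₂ _,_ (ℤₚ.+-comm b y) (ℤₚ.+-comm c z))

⊕-assoc : ∀ p q r → (p ⊕ q) ⊕ r ≡ p ⊕ (q ⊕ r)
⊕-assoc (a , b , c) (x , y , z) (u , v , w) = cong₂ _,_ (ℤₚ.+-assoc a x u) (cong₂ _,_ (ℤₚ.+-assoc b y v) (ℤₚ.+-assoc c z w))

⊕-identityˡ : ∀ p → origin ⊕ p ≡ p
⊕-identityˡ (a , b , c) = cong₂ _,_ (ℤₚ.+-identityˡ a) (cong₂ _,_ (ℤₚ.+-identityˡ b) (ℤₚ.+-identityˡ c))

⊕-⊖ : ∀ p q → (p ⊕ q) ⊖ p ≡ q
⊕-⊖ (a , b , c) (x , y , z) = cong₂ _,_ (l a x) (cong₂ _,_ (l b y) (l c z))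
  where
  l : ∀ a x → (a +ᶻ x) -ᶻ a ≡ x
  l = ℤ-ring

⊖-⊕ : ∀ p q → p ⊕ (q ⊖ p) ≡ q
⊖-⊕ (a , b , c) (x , y , z) = cong₂ _,_ (l a x) (cong₂ _,_ (l b y) (l c z))
  where
  l : ∀ a x → a +ᶻ (x -ᶻ a) ≡ x
  l = ℤ-ring

⊖-origin : ∀ p → p ⊖ origin ≡ p
⊖-origin (a , b , c) = cong₂ _,_ (l a) (cong₂ _,_ (l b) (l c))
  where
  l : ∀ a → a -ᶻ + 0 ≡ a
  l a = ℤₚ.+-identityʳ a

⊖-⊕-⊖ : ∀ n a u → n ⊖ (a ⊕ u) ≡ (n ⊖ a) ⊖ u
⊖-⊕-⊖ (n₁ , n₂ , n₃) (a , b , c) (x , y , z) = cong₂ _,_ (l n₁ a x) (cong₂ _,_ (l n₂ b y) (l n₃ c z))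
  where
  l : ∀ n a x → n -ᶻ (a +ᶻ x) ≡ (n -ᶻ a) -ᶻ x
  l = ℤ-ring

normSq-reflect : ∀ p q r → normSq ((p ⊖ q) ⊖ r) ≡ normSq (q ⊖ (p ⊖ r))
normSq-reflect (a , b , c) (x , y , z) (u , v , w) = cong₂ _+ᶻ_ (cong₂ _+ᶻ_ (l a x u) (l b y v)) (l c z w)
  where
  l : ∀ a x u → ((a -ᶻ x) -ᶻ u) *ᶻ ((a -ᶻ x) -ᶻ u) ≡ (x -ᶻ (a -ᶻ u)) *ᶻ (x -ᶻ (a -ᶻ u))
  l = ℤ-ring

normSq-flip : ∀ p q → normSq (p ⊖ q) ≡ normSq (q ⊖ p)
normSq-flip (a , b , c) (x , y , z) = cong₂ _+ᶻ_ (cong₂ _+ᶻ_ (l a x) (l b y)) (l c z)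
  where
  l : ∀ a x → (a -ᶻ x) *ᶻ (a -ᶻ x) ≡ (x -ᶻ a) *ᶻ (x -ᶻ a)
  l = ℤ-ring

Bounded : ℕ → Point → Set
Bounded B (x , y , z) = ∣ x ∣ ≤ B × ∣ y ∣ ≤ B × ∣ z ∣ ≤ B

bounded-≤ : ∀ {B B′} p → B ≤ B′ → Bounded B p → Bounded B′ p
bounded-≤ p h (a , b , c) = ≤-trans a h , ≤-trans b h , ≤-trans c h

bounded-⊕ : ∀ {B B′} p q → Bounded B p → Bounded B′ q → Bounded (B + B′) (p ⊕ q)
bounded-⊕ (x , y , z) (x′ , y′ , z′) (a , b , c) (a′ , b′ , c′) =
    ≤-trans (ℤₚ.∣i+j∣≤∣i∣+∣j∣ x x′) (+-mono-≤ a a′)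
  , ≤-trans (ℤₚ.∣i+j∣≤∣i∣+∣j∣ y y′) (+-mono-≤ b b′)
  , ≤-trans (ℤₚ.∣i+j∣≤∣i∣+∣j∣ z z′) (+-mono-≤ c c′)

bounded-⊖ : ∀ {B B′} p q → Bounded B p → Bounded B′ q → Bounded (B + B′) (p ⊖ q)
bounded-⊖ (x , y , z) (x′ , y′ , z′) (a , b , c) (a′ , b′ , c′) =
    ≤-trans (ℤₚ.∣i-j∣≤∣i∣+∣j∣ x x′) (+-mono-≤ a a′)
  , ≤-trans (ℤₚ.∣i-j∣≤∣i∣+∣j∣ y y′) (+-mono-≤ b b′)
  , ≤-trans (ℤₚ.∣i-j∣≤∣i∣+∣j∣ z z′) (+-mono-≤ c c′)

bounded-norm : ∀ {B} p → Bounded B p → ‖ p ‖² ≤ 3 * (B * B)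
bounded-norm {B} (x , y , z) (a , b , c) = ≤-trans (+-mono-≤ (+-mono-≤ (*-mono-≤ a a) (*-mono-≤ b b)) (*-mono-≤ c c))
  (≤-reflexive (lemma B))
  where
  lemma : ∀ B → B * B + B * B + B * B ≡ 3 * (B * B)
  lemma = ℕ-ring

interval : ℕ → List ℤ
interval B = map (λ i → + i -ᶻ + B) (upTo (suc (B + B)))

interval-unique : ∀ B → Unique (interval B)
interval-unique B = Uniqueₚ.map⁺ (λ {x} {y} e → ℤₚ.+-injective (+ᶻ-cancelʳ (-ᶻ + B) (+ x) (+ y) e)) (Uniqueₚ.upTo⁺ (suc (B + B)))

∈-interval : ∀ {B} z → ∣ z ∣ ≤ B → z ∈ interval B
∈-interval {B} (+ n) h = subst (_∈ interval B) (trans (cong (_-ᶻ + B) (ℤₚ.pos-+ n B)) (lemma (+ n) (+ B)))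
  (∈-map⁺ (λ i → + i -ᶻ + B) (∈-upTo⁺ (s≤s (+-monoˡ-≤ B h))))
  where
  lemma : ∀ n b → (n +ᶻ b) -ᶻ b ≡ n
  lemma = ℤ-ring
∈-interval {B} -[1+ n ] h = subst (_∈ interval B) (begin
    + (B ∸ suc n) -ᶻ + B ≡⟨ cong (_-ᶻ + B) (trans (sym (ℤₚ.⊖-≥ h)) (sym (ℤₚ.m-n≡m⊖n B (suc n)))) ⟩
    (+ B -ᶻ + suc n) -ᶻ + B ≡⟨ lemma (+ B) (+ suc n) ⟩
    -ᶻ + suc n ∎)
  (∈-map⁺ (λ i → + i -ᶻ + B) (∈-upTo⁺ (s≤s (≤-trans (m∸n≤m B (suc n)) (m≤m+n B B)))))
  where
  open ≡-Reasoning
  lemma : ∀ b n → (b -ᶻ n) -ᶻ b ≡ -ᶻ n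
  lemma = ℤ-ring

interval-∈ : ∀ {B z} → z ∈ interval B → ∣ z ∣ ≤ B
interval-∈ {B} z∈ with ∈-map⁻ (λ i → + i -ᶻ + B) z∈
... | i , i∈ , refl = subst (_≤ B) (cong ∣_∣ (sym (ℤₚ.m-n≡m⊖n i B))) (bound (≤-pred (∈-upTo⁻ i∈)))
  where
  bound : i ≤ B + B → ∣ i ℤ.⊖ B ∣ ≤ B
  bound i≤ with ≤-total B i
  ... | inj₁ B≤i = subst (_≤ B) (cong ∣_∣ (sym (ℤₚ.⊖-≥ B≤i))) (≤-trans (∸-monoˡ-≤ B i≤) (≤-reflexive (m+n∸n≡m B B)))
  ... | inj₂ i≤B = subst (_≤ B) (trans (sym (ℤₚ.∣-i∣≡∣i∣ (+ (B ∸ i)))) (cong ∣_∣ (sym (ℤₚ.⊖-≤ i≤B)))) (m∸n≤m B i)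

opaque

  -- A finite stand-in for ℤ³, taken large enough to contain all tuple sums that occur.
  cube : ℕ → List Point
  cube B = cartesianProduct (interval B) (cartesianProduct (interval B) (interval B))

  cube-unique : ∀ B → Unique (cube B)
  cube-unique B = Uniqueₚ.cartesianProduct⁺ (interval-unique B) (Uniqueₚ.cartesianProduct⁺ (interval-unique B) (interval-unique B))

  ∈-cube : ∀ {B} p → Bounded B p → p ∈ cube B
  ∈-cube (x , y , z) (a , b , c) = ∈-cartesianProduct⁺ (∈-interval x a) (∈-cartesianProduct⁺ (∈-interval y b) (∈-interval z c))

  cube-∈ : ∀ {B} p → p ∈ cube B → Bounded B p
  cube-∈ {B} (x , y , z) p∈ =
    let (x∈ , yz∈) = ∈-cartesianProduct⁻ (interval B) (cartesianProduct (interval B) (interval B)) p∈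
        (y∈ , z∈) = ∈-cartesianProduct⁻ (interval B) (interval B) yz∈
    in interval-∈ x∈ , interval-∈ y∈ , interval-∈ z∈

  length-cube : ∀ B → length (cube B) ≡ suc (B + B) * (suc (B + B) * suc (B + B))
  length-cube B = trans (length-cartesianProduct (interval B) (cartesianProduct (interval B) (interval B))) (cong₂ _*_ len
    (trans (length-cartesianProduct (interval B) (interval B)) (cong₂ _*_ len len)))
    where
    len : length (interval B) ≡ suc (B + B)
    len = trans (length-map (λ i → + i -ᶻ + B) (upTo (suc (B + B)))) (length-upTo (suc (B + B)))

tupleSum : ℕ → List Point → (Point → ℕ) → ℕ
tupleSum t A φ = ∑ (tuples t A) (λ w → φ (sumP w))

tupleSum-suc : ∀ t A φ → tupleSum (suc t) A φ ≡ ∑ A (λ a → tupleSum t A (λ u → φ (a ⊕ u)))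
tupleSum-suc t A φ = trans (∑-concatMap (λ x → map (x ∷_) (tuples t A)) A _)
  (∑-cong A λ a → ∑-map (a ∷_) (tuples t A) _)

tupleSum-+ : ∀ s t A φ → tupleSum (s + t) A φ ≡ tupleSum s A (λ u → tupleSum t A (λ v → φ (u ⊕ v)))
tupleSum-+ zero    t A φ = trans (∑-cong (tuples t A) λ w → cong φ (sym (⊕-identityˡ (sumP w)))) (sym (+-identityʳ _))
tupleSum-+ (suc s) t A φ = trans (tupleSum-suc (s + t) A φ) (trans
  (∑-cong A λ a → trans (tupleSum-+ s t A (λ u → φ (a ⊕ u)))
    (∑-cong (tuples s A) λ w → ∑-cong (tuples t A) λ w′ → cong φ (sym (⊕-assoc a (sumP w) (sumP w′)))))
  (sym (tupleSum-suc s A (λ u → tupleSum t A (λ v → φ (u ⊕ v))))))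

reps : ℕ → List Point → Point → ℕ
reps t A n = tupleSum t A (λ u → ⟦ u ≟P n ⟧)

rep≡reps : ∀ t A n → rep t A n ≡ reps t A n
rep≡reps t A n = length-filter≡∑ (λ w → sumP w ≟P n) (tuples t A)

length-tuples : ∀ t A → length (tuples t A) ≡ length A ^ t
length-tuples t A = trans (length≡∑ (tuples t A)) (go t)
  where
  go : ∀ t → ∑ (tuples t A) (λ _ → 1) ≡ length A ^ t
  go zero    = refl
  go (suc t) = trans (tupleSum-suc t A (λ _ → 1)) (trans (∑-const A _) (cong (_*_ (length A)) (go t)))

reps-suc : ∀ t A n → reps (suc t) A n ≡ ∑ A (λ a → reps t A (n ⊖ a))
reps-suc t A n = trans (tupleSum-suc t A (λ u → ⟦ u ≟P n ⟧)) (∑-cong A λ a → ∑-cong (tuples t A) λ w →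
  ⟦⟧-cong ((a ⊕ sumP w) ≟P n) (sumP w ≟P (n ⊖ a)) (λ { refl → sym (⊕-⊖ a (sumP w)) }) (λ e → trans (cong (a ⊕_) e) (⊖-⊕ a n)))

-- Summing r_t over tuples weights each point u by r_t(u), so this is Σ r_t(u)² without reference to
-- a finite region.
energy : ℕ → List Point → ℕ
energy t A = tupleSum t A (reps t A)

on : ℕ → Point → Point → ℕ
on m n u = ⟦ normSq (n ⊖ u) ℤ.≟ + m ⟧

module OnSphere (m : ℕ) (A : List Point) (uA : Unique A) (onS : All (InS3 m) A) where

  #A k : ℕ
  #A = length A
  k = circleBound m

  adj : Point → Point → ℕ
  adj n u = ∑ A λ a → ⟦ (a ⊕ u) ≟P n ⟧

  adj≤1 : ∀ n u → adj n u ≤ 1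
  adj≤1 n u = ≤-trans (∑-mono A λ a → ≤-trans (⟦⟧-mono ((a ⊕ u) ≟P n) ((n ⊖ u) ≟P a) (λ { refl → back a u })) (≤-reflexive (sym (*-identityʳ _))))
    (∑-δ-≤ _≟P_ uA (λ _ → 1) (n ⊖ u))
    where
    back : ∀ a u → (a ⊕ u) ⊖ u ≡ a
    back a u = trans (cong (_⊖ u) (⊕-comm a u)) (⊕-⊖ u a)

  adj≤on : ∀ n u → adj n u ≤ on m n u
  adj≤on n u with normSq (n ⊖ u) ℤ.≟ + m
  ... | yes _   = adj≤1 n u
  ... | no ¬on = ≤-reflexive (∑-≡0 A λ a a∈ → ⟦⟧-no ((a ⊕ u) ≟P n)
          λ { refl → ¬on (trans (cong normSq (trans (cong (_⊖ u) (⊕-comm a u)) (⊕-⊖ u a))) (All.lookup onS a∈)) })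

  sums-bounded : ∀ t → All (λ w → Bounded (t * m) (sumP w)) (tuples t A)
  sums-bounded zero    = (z≤n , z≤n , z≤n) ∷ []
  sums-bounded (suc t) = Allₚ.concat⁺ (Allₚ.map⁺ (All.map (λ {a} a∈S →
    Allₚ.map⁺ (All.map (λ {w} → bounded-⊕ a (sumP w) (coordinate≤ {a} a∈S)) (sums-bounded t))) onS))

  -- Exchanges sums over points weighted by r_t for sums over tuples. The bound t m ≤ B ensures that
  -- no tuple sum falls outside the cube.
  cube-sum : ∀ t {B} → t * m ≤ B → (φ : Point → ℕ) → ∑ (cube B) (λ u → reps t A u * φ u) ≡ tupleSum t A φ
  cube-sum t {B} tm≤B φ = begin
    ∑ (cube B) (λ u → reps t A u * φ u) ≡⟨ ∑-cong (cube B) (λ u → sym (∑-*ʳ (tuples t A) (φ u) _)) ⟩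
    ∑ (cube B) (λ u → ∑ (tuples t A) (λ w → ⟦ sumP w ≟P u ⟧ * φ u)) ≡⟨ ∑-swap (cube B) (tuples t A) _ ⟩
    ∑ (tuples t A) (λ w → ∑ (cube B) (λ u → ⟦ sumP w ≟P u ⟧ * φ u)) ≡⟨ ∑-cong∈ (tuples t A) (λ w w∈ → ∑-δ _≟P_ (cube-unique B) φ
                                                                                    (∈-cube (sumP w) (bounded-≤ (sumP w) tm≤B (All.lookup (sums-bounded t) w∈)))) ⟩
    tupleSum t A φ ∎
    where open ≡-Reasoning

  cube-total : ∀ t {B} → t * m ≤ B → ∑ (cube B) (reps t A) ≡ #A ^ t
  cube-total t {B} h = trans (∑-cong (cube B) λ u → sym (*-identityʳ _)) (trans (cube-sum t h (λ _ → 1))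
    (trans (sym (length≡∑ (tuples t A))) (length-tuples t A)))

  -- These points lie on two spheres of equal radius, about the origin and about v.
  circle-points : ∀ v → v ≢ origin → ∑ A (on m v) ≤ k
  circle-points v v≢0 = subst (_≤ k) (length-filter≡∑ P? A) (circle-count m (λ e → v≢0 (sym e)) (filter P? A) (Uniqueₚ.filter⁺ P? uA)
    (All.tabulate λ {a} a∈ → let (a∈A , h) = ∈-filter⁻ P? {xs = A} a∈ in
      trans (cong normSq (⊖-origin a)) (All.lookup onS a∈A) , trans (normSq-flip a v) h))
    where
    P? : Decidable₁ (λ a → normSq (v ⊖ a) ≡ + m)
    P? a = normSq (v ⊖ a) ℤ.≟ + m

  sphereReps : ℕ → Point → ℕ
  sphereReps t n = tupleSum t A (on m n)

  sphereReps-suc : ∀ t n → sphereReps (suc t) n ≡ ∑ A (λ a → sphereReps t (n ⊖ a))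
  sphereReps-suc t n = trans (tupleSum-suc t A (on m n)) (∑-cong A λ a → ∑-cong (tuples t A) λ w →
    cong (λ p → ⟦ normSq p ℤ.≟ + m ⟧) (⊖-⊕-⊖ n a (sumP w)))

  sphereReps-one : ∀ n → sphereReps 1 n ≡ ∑ A (on m n)
  sphereReps-one n = trans (sphereReps-suc 0 n) (∑-cong A λ a → trans (+-identityʳ _)
    (cong (λ p → ⟦ normSq p ℤ.≟ + m ⟧) (⊖-origin (n ⊖ a))))

  sphereReps-one-≤ : ∀ n → n ≢ origin → sphereReps 1 n ≤ k
  sphereReps-one-≤ n n≢0 = ≤-trans (≤-reflexive (sphereReps-one n)) (circle-points n n≢0)

  -- With all but one summand fixed, the last one lies on a circle, unless the centre has been moved
  -- to the origin. For two summands this happens only for a = n, which costs |A| once; every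
  -- further summand costs a factor |A|.
  sphereReps-≤ : ∀ τ′ n → sphereReps (2 + τ′) n ≤ 2 * k * #A ^ suc τ′
  sphereReps-≤ zero n = begin
    sphereReps 2 n ≡⟨ sphereReps-suc 1 n ⟩
    ∑ A (λ a → sphereReps 1 (n ⊖ a)) ≤⟨ ∑-mono A (λ a → point a) ⟩
    ∑ A (λ a → k + ⟦ n ≟P a ⟧ * #A) ≡⟨ ∑-+ A _ _ ⟩
    ∑ A (λ _ → k) + ∑ A (λ a → ⟦ n ≟P a ⟧ * #A) ≤⟨ +-mono-≤ (≤-reflexive (∑-const A k)) (∑-δ-≤ _≟P_ uA (λ _ → #A) n) ⟩
    #A * k + #A ≤⟨ +-monoʳ-≤ (#A * k) (m≤m*n′ #A (1≤circleBound m)) ⟩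
    #A * k + #A * k ≡⟨ lemma #A k ⟩
    2 * k * (#A * 1) ∎
    where
    open ≤-Reasoning
    lemma : ∀ a k → a * k + a * k ≡ 2 * k * (a * 1)
    lemma = ℕ-ring
    point : ∀ a → sphereReps 1 (n ⊖ a) ≤ k + ⟦ n ≟P a ⟧ * #A
    point a with n ≟P a
    ... | no n≢a  = ≤-trans (sphereReps-one-≤ (n ⊖ a) (λ e → n≢a (p⊖q≡0 e))) (m≤m+n k 0)
    ... | yes _   = ≤-trans (≤-trans (≤-reflexive (sphereReps-one (n ⊖ a))) (≤-trans (∑-bound A (λ a′ _ → ⟦⟧≤1 (normSq (n ⊖ a ⊖ a′) ℤ.≟ + m)))
                      (≤-reflexive (trans (*-identityʳ #A) (sym (+-identityʳ #A)))))) (m≤n+m (#A + 0) k)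
  sphereReps-≤ (suc τ′) n = begin
    sphereReps (3 + τ′) n ≡⟨ sphereReps-suc (2 + τ′) n ⟩
    ∑ A (λ a → sphereReps (2 + τ′) (n ⊖ a)) ≤⟨ ∑-bound A (λ a _ → sphereReps-≤ τ′ (n ⊖ a)) ⟩
    #A * (2 * k * #A ^ suc τ′) ≡⟨ lemma #A k (#A ^ suc τ′) ⟩
    2 * k * (#A * #A ^ suc τ′) ∎
    where
    open ≤-Reasoning
    lemma : ∀ a k p → a * (2 * k * p) ≡ 2 * k * (a * p)
    lemma = ℕ-ring

  reps-adj : ∀ t n → reps (suc t) A n ≡ tupleSum t A (adj n)
  reps-adj t n = trans (tupleSum-suc t A (λ u → ⟦ u ≟P n ⟧)) (∑-swap A (tuples t A) (λ a w → ⟦ (a ⊕ sumP w) ≟P n ⟧))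

  reps≤sphereReps : ∀ t n → reps (suc t) A n ≤ sphereReps t n
  reps≤sphereReps t n = ≤-trans (≤-reflexive (reps-adj t n)) (∑-mono (tuples t A) λ w → adj≤on n (sumP w))

  reps-three-≤ : ∀ τ′ n → reps (3 + τ′) A n ≤ 2 * k * #A ^ suc τ′
  reps-three-≤ τ′ n = ≤-trans (reps≤sphereReps (2 + τ′) n) (sphereReps-≤ τ′ n)

  -- Only τ′ = 0 uses n ≠ 0: the two spheres carrying a summand of n coincide when n is the origin,
  -- and r_2(0) is |A| for symmetric A.
  reps-off-origin-≤ : ∀ τ′ n → n ≢ origin → reps (2 + τ′) A n ≤ 2 * k * #A ^ τ′
  reps-off-origin-≤ zero     n n≢0 = ≤-trans (reps≤sphereReps 1 n) (≤-trans (sphereReps-one-≤ n n≢0)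
    (≤-trans (m≤m+n k (k + 0)) (≤-reflexive (sym (*-identityʳ (2 * k))))))
  reps-off-origin-≤ (suc τ′) n _   = reps-three-≤ τ′ n

  reps-max : ∀ t n → reps (suc t) A n ≤ #A ^ t
  reps-max zero    n = ≤-trans (≤-reflexive (reps-adj 0 n)) (≤-trans (≤-reflexive (+-identityʳ _)) (adj≤1 n origin))
  reps-max (suc t) n = ≤-trans (≤-reflexive (reps-suc (suc t) A n)) (∑-bound A λ a _ → reps-max t (n ⊖ a))

  #A≤cube : #A ≤ suc (m + m) * (suc (m + m) * suc (m + m))
  #A≤cube = subst (#A ≤_) (length-cube m) (length≤-injective _≟P_ A (cube m) uA id
    (λ a a∈ → ∈-cube a (coordinate≤ {a} (All.lookup onS a∈))) (λ _ _ _ _ → id))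

-- Weighted incidences between sums and spheres

below-average : {X : Set} (xs : List X) → 1 ≤ length xs → (f : X → ℕ) → Σ X λ x → x ∈ xs × length xs * f x ≤ ∑ xs f
below-average (x ∷ []) _ f = x , here refl , ≤-refl
below-average (x ∷ xs@(_ ∷ _)) _ f with below-average xs (s≤s z≤n) f
... | y , y∈ , h with ≤-total (f x) (f y)
...   | inj₁ fx≤fy = x , here refl , +-monoʳ-≤ (f x) (≤-trans (*-monoʳ-≤ (length xs) fx≤fy) h)
...   | inj₂ fy≤fx = y , there y∈ , +-mono-≤ fy≤fx h

above-average : {X : Set} (xs : List X) → 1 ≤ length xs → (f : X → ℕ) → Σ X λ x → x ∈ xs × ∑ xs f ≤ length xs * f x
above-average (x ∷ []) _ f = x , here refl , ≤-refl
above-average (x ∷ xs@(_ ∷ _)) _ f with above-average xs (s≤s z≤n) f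
... | y , y∈ , h with ≤-total (f x) (f y)
...   | inj₁ fx≤fy = y , there y∈ , +-mono-≤ fx≤fy h
...   | inj₂ fy≤fx = x , here refl , +-monoʳ-≤ (f x) (≤-trans h (*-monoʳ-≤ (length xs) fy≤fx))

suc2m≤3m : ∀ {m} → 1 ≤ m → suc (m + m) ≤ 3 * m
suc2m≤3m {m} 1≤m = ≤-trans (+-monoˡ-≤ (m + m) 1≤m) (≤-reflexive (lemma m))
  where
  lemma : ∀ m → m + (m + m) ≡ 3 * m
  lemma = ℕ-ring

-- Polynomial size bounds and the constants built from them

opaque

  -- Bounds the offset of |n - u|² from m. The coordinates of n - u are at most 3 S m, being 2 S m
  -- for the centre and S m for u, so the square norm is at most 27 S² m², and m ≤ m².
  offsetBound : ℕ → ℕ → ℕ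
  offsetBound S m = (27 * S * S + 1) * m ^ 2

  subPoly-offsetBound : ∀ S {T} → SubPoly T → SubPoly (λ m → T (offsetBound S m))
  subPoly-offsetBound S t = subPoly-∘ t (27 * S * S + 1) 1 (m≤n+m 1 _)

  ≤offsetBound : ∀ S m → let b = S * m + S * m + S * m in 3 * (b * b) + m ≤ offsetBound S m
  ≤offsetBound S m = ≤-trans (+-monoʳ-≤ _ (m≤m*m m)) (≤-reflexive (lemma S m))
    where
    lemma : ∀ S m → let b = S * m + S * m + S * m in 3 * (b * b) + m * m ≡ (27 * S * S + 1) * (m * (m * 1))
    lemma = ℕ-ring

  -- Moduli are at most 2D ≤ 2|A| ≤ 2 (2m + 1)³ ≤ 2 (3m)³ = 54 m³.
  modulusBound : ℕ → ℕ
  modulusBound m = 54 * m ^ 3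

  subPoly-modulusBound : ∀ {T} → SubPoly T → SubPoly (λ m → T (modulusBound m))
  subPoly-modulusBound t = subPoly-∘ t 54 2 (s≤s z≤n)

  ≤modulusBound : ∀ {m} → 1 ≤ m → 2 * (suc (m + m) * (suc (m + m) * suc (m + m))) ≤ modulusBound m
  ≤modulusBound {m} 1≤m = ≤-trans (*-monoʳ-≤ 2 (*-mono-≤ h (*-mono-≤ h h))) (≤-reflexive (lemma m))
    where
    h : suc (m + m) ≤ 3 * m
    h = suc2m≤3m 1≤m
    lemma : ∀ m → 2 * (3 * m * (3 * m * (3 * m))) ≡ 54 * (m * (m * (m * 1)))
    lemma = ℕ-ring

  -- A bound for |A|^(t+1), from |A| ≤ 27 m³. It limits the values of r and hence the number of
  -- dyadic levels.
  levelBound : ℕ → ℕ → ℕ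
  levelBound t m = 27 ^ suc t * m ^ (3 * suc t)

  subPoly-levelBound : ∀ t {T} → SubPoly T → SubPoly (λ m → T (levelBound t m))
  subPoly-levelBound t s = subPoly-∘ s (27 ^ suc t) (t + 2 * suc t) (1≤^ (suc t) (s≤s z≤n))

  ≤levelBound : ∀ t {m} → 1 ≤ m → (suc (m + m) * (suc (m + m) * suc (m + m))) ^ suc t ≤ levelBound t m
  ≤levelBound t {m} 1≤m = ≤-trans (^-monoˡ-≤ (suc t) (≤-trans (*-mono-≤ h (*-mono-≤ h h)) (≤-reflexive (lemma m))))
    (≤-reflexive (trans (*-^ 27 (m ^ 3) (suc t)) (cong (_*_ (27 ^ suc t)) (^-*-assoc m 3 (suc t)))))
    where
    h : suc (m + m) ≤ 3 * m
    h = suc2m≤3m 1≤m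
    lemma : ∀ m → 3 * m * (3 * m * (3 * m)) ≡ 27 * (m * (m * (m * 1)))
    lemma = ℕ-ring

opaque

  -- 64 arises from doubling 2 H (2D) τ 4 (2D) when the small boxes dominate.
  T₁ : ℕ → ℕ
  T₁ m = 64 * τ (modulusBound m)

  -- 8k is 4 from (2Y)² times the 2k of `incidence-bound`; the bracket is the average over moduli of
  -- pairs off and on the sphere.
  T₂ : ℕ → ℕ → ℕ
  T₂ S m = 8 * circleBound m * (τ (offsetBound S m) + 2 * circleBound m)

  T₁-def : ∀ m → T₁ m ≡ 64 * τ (modulusBound m)
  T₁-def m = refl

  T₂-def : ∀ S m → T₂ S m ≡ 8 * circleBound m * (τ (offsetBound S m) + 2 * circleBound m)
  T₂-def S m = refl

  subPoly-T₁ : SubPoly T₁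
  subPoly-T₁ = subPoly-* (subPoly-const 64) (subPoly-modulusBound subPoly-τ)

  subPoly-T₂ : ∀ S → SubPoly (T₂ S)
  subPoly-T₂ S = subPoly-* (subPoly-* (subPoly-const 8) subPoly-circleBound)
    (subPoly-+ (subPoly-offsetBound S subPoly-τ) (subPoly-* (subPoly-const 2) subPoly-circleBound))

  1≤T₁ : ∀ m → 1 ≤ T₁ m
  1≤T₁ m = *-mono-≤ (s≤s (z≤n {63})) (1≤τ (modulusBound m))

  1≤T₂ : ∀ S m → 1 ≤ T₂ S m
  1≤T₂ S m = *-mono-≤ (*-mono-≤ (s≤s (z≤n {7})) (1≤circleBound m)) (≤-trans (1≤τ (offsetBound S m)) (m≤m+n _ _))

-- The three ways in which x ≤ c D² G and D x² ≤ P can cross for 1 ≤ D ≤ N: the former already holds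
-- at D = 1, the latter still holds at D = N, or the change occurs between some D and D + 1.
data Outcome (x c G P N : ℕ) : Set where
  linear : x ≤ c * G → Outcome x c G P N
  capped : N * (x * x) ≤ P → Outcome x c G P N
  fifth  : x * ((x * x) * (x * x)) ≤ 4 * c * G * (P * P) → Outcome x c G P N

-- Taking for D the largest value at which the first alternative fails replaces the optimisation over real D.
optimise : ∀ x c G P N → 1 ≤ N → (∀ D → 1 ≤ D → D ≤ N → x ≤ c * (D * D) * G ⊎ D * (x * x) ≤ P) → Outcome x c G P N
optimise x c G P N 1≤N alternative = go (trichotomy N 1≤N ≤-refl)
  where
  Trichotomy : ℕ → Set
  Trichotomy n = x ≤ c * G ⊎ n * (x * x) ≤ P ⊎ (Σ ℕ λ D → 1 ≤ D × D * (x * x) ≤ P × x ≤ c * (suc D * suc D) * G)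
  first : x ≤ c * (1 * 1) * G ⊎ 1 * (x * x) ≤ P → Trichotomy 1
  first (inj₁ h) = inj₁ (subst (λ z → x ≤ z * G) (*-identityʳ c) h)
  first (inj₂ h) = inj₂ (inj₁ h)
  next : ∀ n → 1 ≤ n → x ≤ c * (suc n * suc n) * G ⊎ suc n * (x * x) ≤ P → Trichotomy n → Trichotomy (suc n)
  next n 1≤n (inj₂ h) _               = inj₂ (inj₁ h)
  next n 1≤n (inj₁ h) (inj₁ a)        = inj₁ a
  next n 1≤n (inj₁ h) (inj₂ (inj₁ b)) = inj₂ (inj₂ (n , 1≤n , b , h))
  next n 1≤n (inj₁ h) (inj₂ (inj₂ d)) = inj₂ (inj₂ d)
  trichotomy : ∀ n → 1 ≤ n → n ≤ N → Trichotomy n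
  trichotomy (suc zero)    _ 1≤N = first (alternative 1 (s≤s z≤n) 1≤N)
  trichotomy (suc (suc n)) _ n<N = next (suc n) (s≤s z≤n) (alternative (2 + n) (s≤s z≤n) n<N) (trichotomy (suc n) (s≤s z≤n) (<⇒≤ n<N))
  -- D² x⁵ = x (D x²)², where x is bounded at D + 1 and D x² at D. Since D + 1 ≤ 2D, the factor D²
  -- cancels at the price of 4.
  fifth-power : ∀ D → 1 ≤ D → D * (x * x) ≤ P → x ≤ c * (suc D * suc D) * G → x * ((x * x) * (x * x)) ≤ 4 * c * G * (P * P)
  fifth-power D 1≤D b h = *-cancelˡ-≤ (D * D) {{m*n≢0 D D}} (begin
    D * D * (x * ((x * x) * (x * x))) ≡⟨ lemma D x ⟩
    x * (D * (x * x) * (D * (x * x))) ≤⟨ *-mono-≤ h (*-mono-≤ b b) ⟩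
    c * (suc D * suc D) * G * (P * P) ≤⟨ *-monoˡ-≤ (P * P) (*-monoˡ-≤ G (*-monoʳ-≤ c (*-mono-≤ sucD≤ sucD≤))) ⟩
    c * ((D + D) * (D + D)) * G * (P * P) ≡⟨ lemma′ c D G (P * P) ⟩
    D * D * (4 * c * G * (P * P)) ∎)
    where
    open ≤-Reasoning
    instance _ = >-nonZero 1≤D
    sucD≤ : suc D ≤ D + D
    sucD≤ = +-monoˡ-≤ D 1≤D
    lemma : ∀ D x → D * D * (x * ((x * x) * (x * x))) ≡ x * (D * (x * x) * (D * (x * x)))
    lemma = ℕ-ring
    lemma′ : ∀ c D G p → c * ((D + D) * (D + D)) * G * p ≡ D * D * (4 * c * G * p)
    lemma′ = ℕ-ring
  go : Trichotomy N → Outcome x c G P N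
  go (inj₁ h) = linear h
  go (inj₂ (inj₁ h)) = capped h
  go (inj₂ (inj₂ (D , 1≤D , b , h))) = fifth (fifth-power D 1≤D b h)

levelCount : ℕ → ℕ → ℕ
levelCount τ′ m = suc (lg (levelBound (suc τ′) m))

-- One constant for all cases of `combine-bound`. The factor c⁵ comes from the fifth power of x ≤ c
-- y, 8 a b² from `optimise` and the doubled energy, and k from h ≤ 2kp in the linear case.
combine : ℕ → ℕ → ℕ → ℕ → ℕ
combine c k a b = c * ((c * c) * (c * c)) * (8 * k * a * (b * b))

opaque

  T₃ : ℕ → ℕ → ℕ → ℕ
  T₃ S τ′ m = combine (2 * levelCount τ′ m) (circleBound m) (T₁ m) (T₂ S m)

  T₃-def : ∀ S τ′ m → T₃ S τ′ m ≡ combine (2 * levelCount τ′ m) (circleBound m) (T₁ m) (T₂ S m)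
  T₃-def S τ′ m = refl

  subPoly-T₃ : ∀ S τ′ → SubPoly (T₃ S τ′)
  subPoly-T₃ S τ′ = subPoly-* (subPoly-* c (subPoly-* (subPoly-* c c) (subPoly-* c c)))
    (subPoly-* (subPoly-* (subPoly-* (subPoly-const 8) subPoly-circleBound) subPoly-T₁) (subPoly-* (subPoly-T₂ S) (subPoly-T₂ S)))
    where
    c : SubPoly (λ m → 2 * levelCount τ′ m)
    c = subPoly-* (subPoly-const 2) (subPoly-levelBound (suc τ′) subPoly-lg)

-- x is the quantity to be bounded, a = |A|, p = a^τ′ and q = a^t; E is the energy, G and E₂ are the first two moments of g.
data Bound (T a p q E G E₂ W x : ℕ) : Set where
  atOrigin : x ≤ T * (a * p * W) → Bound T a p q E G E₂ W x
  linear   : x ≤ T * (p * G) → Bound T a p q E G E₂ W x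
  capped   : a * (x * x) ≤ T * (q * q * E₂) → Bound T a p q E G E₂ W x
  fifth    : x * ((x * x) * (x * x)) ≤ T * (E * (q * q * q) * G * (E₂ * E₂)) → Bound T a p q E G E₂ W x

module _ {c k a b : ℕ} (1≤c : 1 ≤ c) (1≤k : 1 ≤ k) (1≤a : 1 ≤ a) (1≤b : 1 ≤ b) where

  open ≤-Reasoning

  private
    1≤c⁴ : 1 ≤ (c * c) * (c * c)
    1≤c⁴ = *-mono-≤ (*-mono-≤ 1≤c 1≤c) (*-mono-≤ 1≤c 1≤c)

  c≤combine : c ≤ combine c k a b
  c≤combine = ≤-trans (m≤m*n′ c 1≤c⁴) (m≤m*n′ _ (*-mono-≤ (*-mono-≤ (*-mono-≤ (s≤s (z≤n {7})) 1≤k) 1≤a) (*-mono-≤ 1≤b 1≤b)))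

  linear-constant : c * (a * (4 * k)) ≤ combine c k a b
  linear-constant = begin
    c * (a * (4 * k)) ≤⟨ m≤m*n′ _ (*-mono-≤ 1≤c⁴ (*-mono-≤ (s≤s (z≤n {1})) (*-mono-≤ 1≤b 1≤b))) ⟩
    c * (a * (4 * k)) * ((c * c) * (c * c) * (2 * (b * b))) ≡⟨ lemma c a k b ⟩
    combine c k a b ∎
    where
    lemma : ∀ c a k b → c * (a * (4 * k)) * ((c * c) * (c * c) * (2 * (b * b))) ≡ c * ((c * c) * (c * c)) * (8 * k * a * (b * b))
    lemma = ℕ-ring

  capped-constant : c * c * b ≤ combine c k a b
  capped-constant = begin
    c * c * b ≤⟨ m≤m*n′ _ (*-mono-≤ (*-mono-≤ (*-mono-≤ 1≤c (*-mono-≤ 1≤c 1≤c)) 1≤b) (*-mono-≤ (*-mono-≤ (s≤s (z≤n {7})) 1≤k) 1≤a)) ⟩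
    c * c * b * (c * (c * c) * b * (8 * k * a)) ≡⟨ lemma c a k b ⟩
    combine c k a b ∎
    where
    lemma : ∀ c a k b → c * c * b * (c * (c * c) * b * (8 * k * a)) ≡ c * ((c * c) * (c * c)) * (8 * k * a * (b * b))
    lemma = ℕ-ring

  -- y is the contribution of the weights in [h , 2h), whose total is F.
  combine-bound : ∀ {h F P p q E G E₂ W N x y} → x ≤ c * y → F ≤ q → P ≡ b * F * (q * E₂) → 2 * h * F ≤ 2 * E → (2 * k * p < h → y ≡ 0) →
    Outcome y (a * (2 * h)) G P N → Bound (combine c k a b) N p q E G E₂ W x
  combine-bound {h} {F} {P} {p} {q} {E} {G} {E₂} {W} {N} {x} {y} x≤ F≤q P≡ hF≤E vanish o with 2 * k * p <? h
  -- Above 2kp the level is empty, as r_t is at most 2kp off the origin. In the other cases h ≤ 2kp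
  -- is available.
  ... | yes lt = linear (≤-trans x≤ (≤-trans (≤-reflexive (trans (cong (_*_ c) (vanish lt)) (*-zeroʳ c))) z≤n))
  ... | no ¬lt with o
  ...   | linear y≤ = linear (begin
    x ≤⟨ x≤ ⟩
    c * y ≤⟨ *-monoʳ-≤ c y≤ ⟩
    c * (a * (2 * h) * G) ≤⟨ *-monoʳ-≤ c (*-monoˡ-≤ G (*-monoʳ-≤ a (*-monoʳ-≤ 2 (≮⇒≥ ¬lt)))) ⟩
    c * (a * (2 * (2 * k * p)) * G) ≡⟨ lemma c a k p G ⟩
    c * (a * (4 * k)) * (p * G) ≤⟨ *-monoˡ-≤ (p * G) linear-constant ⟩
    combine c k a b * (p * G) ∎)
    where
    lemma : ∀ c a k p G → c * (a * (2 * (2 * k * p)) * G) ≡ c * (a * (4 * k)) * (p * G)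
    lemma = ℕ-ring
  ...   | capped y≤ = capped (begin
    N * (x * x) ≤⟨ *-monoʳ-≤ N (*-mono-≤ x≤ x≤) ⟩
    N * (c * y * (c * y)) ≡⟨ lemma N c y ⟩
    c * c * (N * (y * y)) ≤⟨ *-monoʳ-≤ (c * c) y≤ ⟩
    c * c * P ≡⟨ cong (_*_ (c * c)) P≡ ⟩
    c * c * (b * F * (q * E₂)) ≤⟨ *-monoʳ-≤ (c * c) (*-monoˡ-≤ (q * E₂) (*-monoʳ-≤ b F≤q)) ⟩
    c * c * (b * q * (q * E₂)) ≡⟨ lemma′ c b q E₂ ⟩
    c * c * b * (q * q * E₂) ≤⟨ *-monoˡ-≤ (q * q * E₂) capped-constant ⟩
    combine c k a b * (q * q * E₂) ∎)
    where
    lemma : ∀ N c y → N * (c * y * (c * y)) ≡ c * c * (N * (y * y))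
    lemma = ℕ-ring
    lemma′ : ∀ c b q e → c * c * (b * q * (q * e)) ≡ c * c * b * (q * q * e)
    lemma′ = ℕ-ring
  ...   | fifth y≤ = fifth (begin
    x * ((x * x) * (x * x)) ≤⟨ *-mono-≤ x≤ (*-mono-≤ (*-mono-≤ x≤ x≤) (*-mono-≤ x≤ x≤)) ⟩
    c * y * ((c * y * (c * y)) * (c * y * (c * y))) ≡⟨ lemma c y ⟩
    c * ((c * c) * (c * c)) * (y * ((y * y) * (y * y))) ≤⟨ *-monoʳ-≤ (c * ((c * c) * (c * c))) y≤ ⟩
    c * ((c * c) * (c * c)) * (4 * (a * (2 * h)) * G * (P * P)) ≡⟨ cong (λ z → c * ((c * c) * (c * c)) * (4 * (a * (2 * h)) * G * (z * z))) P≡ ⟩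
    c * ((c * c) * (c * c)) * (4 * (a * (2 * h)) * G * (b * F * (q * E₂) * (b * F * (q * E₂))))
      ≡⟨ lemma′ (c * ((c * c) * (c * c))) a h G b F q E₂ ⟩
    c * ((c * c) * (c * c)) * (4 * a * (b * b)) * (2 * h * F * F * (q * q) * G * (E₂ * E₂))
      -- The energy enters here: one factor F is joined with the height h and bounded by E, and only
      -- the other one is estimated trivially by q.
      ≤⟨ *-monoʳ-≤ (c * ((c * c) * (c * c)) * (4 * a * (b * b))) (*-monoˡ-≤ (E₂ * E₂) (*-monoˡ-≤ G (*-monoˡ-≤ (q * q) (*-mono-≤ hF≤E F≤q)))) ⟩
    c * ((c * c) * (c * c)) * (4 * a * (b * b)) * (2 * E * q * (q * q) * G * (E₂ * E₂))
      ≤⟨ m≤m*n′ _ 1≤k ⟩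
    c * ((c * c) * (c * c)) * (4 * a * (b * b)) * (2 * E * q * (q * q) * G * (E₂ * E₂)) * k
      ≡⟨ lemma″ (c * ((c * c) * (c * c))) a b E q G E₂ k ⟩
    combine c k a b * (E * (q * q * q) * G * (E₂ * E₂)) ∎)
    where
    lemma : ∀ c y → c * y * ((c * y * (c * y)) * (c * y * (c * y))) ≡ c * ((c * c) * (c * c)) * (y * ((y * y) * (y * y)))
    lemma = ℕ-ring
    lemma′ : ∀ d a h G b F q e → d * (4 * (a * (2 * h)) * G * (b * F * (q * e) * (b * F * (q * e)))) ≡
      d * (4 * a * (b * b)) * (2 * h * F * F * (q * q) * G * (e * e))
    lemma′ = ℕ-ring
    lemma″ : ∀ d a b E q G e k → d * (4 * a * (b * b)) * (2 * E * q * (q * q) * G * (e * e)) * k ≡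
      d * (8 * k * a * (b * b)) * (E * (q * q * q) * G * (e * e))
    lemma″ = ℕ-ring

-- f is a weight on the t-fold sums, t = 2 + τ′; g is a weight on centres pos v.
module WeightedIncidence (m : ℕ) (1≤m : 1 ≤ m) (A : List Point) (uA : Unique A) (onS : All (InS3 m) A) (τ′ S : ℕ) (t≤S : 2 + τ′ ≤ S)
  (pos : Point → Point) (pos-bounded : ∀ v → Bounded (S * m) v → Bounded (S * m + S * m) (pos v))
  (pos-circle : ∀ u u′ → u ≢ u′ → (L : List Point) → Unique L →
    All (λ v → normSq (pos v ⊖ u) ≡ + m × normSq (pos v ⊖ u′) ≡ + m) L → length L ≤ circleBound m)
  (g : Point → ℕ) where

  open OnSphere m A uA onS

  t : ℕ
  t = 2 + τ′

  Ω : List Point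
  Ω = cube (S * m)

  inc : Point → Point → ℕ
  inc v u = adj (pos v) u

  I : (Point → ℕ) → ℕ
  I f = ∑ Ω λ v → g v * ∑ Ω λ u → f u * inc v u

  G E₂ : ℕ
  G = ∑ Ω g
  E₂ = ∑ Ω λ v → g v * g v

  t*m≤S*m : t * m ≤ S * m
  t*m≤S*m = *-monoˡ-≤ m t≤S

  codegree : ∀ u u′ → u ≢ u′ → ∑ Ω (λ v → inc v u * inc v u′) ≤ k
  codegree u u′ u≢u′ = ≤-trans (∑-mono Ω pointwise)
    (subst (_≤ k) (length-filter≡∑ P? Ω) (pos-circle u u′ u≢u′ (filter P? Ω) (Uniqueₚ.filter⁺ P? (cube-unique (S * m)))
      (All.tabulate λ v∈ → proj₂ (∈-filter⁻ P? {xs = Ω} v∈))))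
    where
    P? : Decidable₁ (λ v → normSq (pos v ⊖ u) ≡ + m × normSq (pos v ⊖ u′) ≡ + m)
    P? v = (normSq (pos v ⊖ u) ℤ.≟ + m) ×-dec (normSq (pos v ⊖ u′) ℤ.≟ + m)
    both : {P Q : Set} (d : Dec P) (e : Dec Q) → ⟦ d ⟧ * ⟦ e ⟧ ≤ ⟦ d ×-dec e ⟧
    both (yes _) (yes _) = ≤-refl
    both (yes _) (no _)  = z≤n
    both (no _)  _       = z≤n
    pointwise : ∀ v → inc v u * inc v u′ ≤ ⟦ P? v ⟧
    pointwise v = ≤-trans (*-mono-≤ (adj≤on (pos v) u) (adj≤on (pos v) u′))
      (both (normSq (pos v ⊖ u) ℤ.≟ + m) (normSq (pos v ⊖ u′) ℤ.≟ + m))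

  -- The index i stands for the modulus i + 1, so D + i with i < D runs through the moduli in (D ,
  -- 2D].
  meets : ℕ → Point → Cell → ℕ
  meets i v κ = ⟦ touches? (suc i) m (pos v) κ ⟧

  inc≤meets : ∀ i v u → inc v u ≤ meets i v (cell (suc i) u)
  inc≤meets i v u = ≤-trans (adj≤on (pos v) u) (⟦⟧-mono (normSq (pos v ⊖ u) ℤ.≟ + m) (touches? (suc i) m (pos v) (cell (suc i) u))
    (on-sphere⇒touches (suc i) m (pos v) u))

  τX : ℕ
  τX = τ (offsetBound S m)

  -- Off the sphere the moduli counted divide the nonzero offset of |pos v - u|² from m. On the
  -- sphere all D moduli count, and this term is kept explicit for `average`.
  moduli-count : ∀ D v u → v ∈ Ω → u ∈ Ω →
    ∑ (upTo D) (λ i → meets (D + i) v (cell (suc (D + i)) u)) ≤ τX + D * on m (pos v) u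
  moduli-count D v u v∈ u∈ with normSq (pos v ⊖ u) ℤ.≟ + m
  ... | yes _ = ≤-trans (∑-bound (upTo D) (λ i _ → ⟦⟧≤1 (touches? (suc (D + i)) m (pos v) (cell (suc (D + i)) u))))
          (≤-trans (≤-reflexive (cong (_* 1) (length-upTo D))) (m≤n+m (D * 1) τX))
  ... | no off = ≤-trans (∑-mono (upTo D) λ i → ⟦⟧-mono (touches? (suc (D + i)) m (pos v) (cell (suc (D + i)) u)) (suc (D + i) ∣? offset)
            (λ d → ∣ᶻ⇒∣ (touches⇒∣ (suc (D + i)) m (pos v) u d)))
          (≤-trans (≤-reflexive (sym (length-filter≡∑ P? (upTo D))))
          (≤-trans (length≤-injective _≟_ (filter P? (upTo D)) (divisors offset) (Uniqueₚ.filter⁺ P? (Uniqueₚ.upTo⁺ D)) (λ i → suc (D + i))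
            (λ i i∈ → ∈-divisors⁺ 1≤offset (proj₂ (∈-filter⁻ P? {xs = upTo D} i∈)))
            (λ i j _ _ e → +-cancelˡ-≡ D i j (suc-injective e)))
          (≤-trans (#divisors≤τ offset≤) (m≤m+n τX _))))
    where
    offset : ℕ
    offset = ∣ normSq (pos v ⊖ u) -ᶻ + m ∣
    P? : Decidable₁ (λ i → suc (D + i) ∣ offset)
    P? i = suc (D + i) ∣? offset
    1≤offset : 1 ≤ offset
    1≤offset = n≢0⇒n>0 λ e → off (ℤₚ.i-j≡0⇒i≡j (normSq (pos v ⊖ u)) (+ m) (ℤₚ.∣i∣≡0⇒i≡0 e))
    offset≤ : offset ≤ offsetBound S m
    offset≤ = ≤-trans (ℤₚ.∣i-j∣≤∣i∣+∣j∣ (normSq (pos v ⊖ u)) (+ m)) (≤-trans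
      (+-monoˡ-≤ m (≤-trans (≤-reflexive (cong ∣_∣ (normSq≡‖‖² (pos v ⊖ u))))
        (bounded-norm (pos v ⊖ u) (bounded-⊖ (pos v) u (pos-bounded v (cube-∈ v v∈)) (cube-∈ u u∈))))) (≤offsetBound S m))

  module _ (f : Point → ℕ) (H : ℕ) (f≤H : ∀ u → f u ≤ H) (f≤reps : ∀ u → f u ≤ reps t A u) where

    F : ℕ
    F = ∑ Ω f

    F≤ : F ≤ #A ^ t
    F≤ = ≤-trans (∑-mono Ω f≤reps) (≤-reflexive (cube-total t t*m≤S*m))

    module Modulus (i : ℕ) = Incidence _≟P_ _≟ᶜ_ Ω (cube-unique (S * m)) Ω (cells (suc i)) (cells-unique (suc i))
      inc (λ v u → adj≤1 (pos v) u) (cell (suc i)) (cell∈ (suc i)) (meets i) (inc≤meets i)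
      (suc i * (#divisors (suc i) * (4 * suc i))) k (λ v → touched-cells (suc i) m (pos v)) codegree f H f≤H g

    -- Pairs off the sphere contribute τX times |A|^t E₂. Pairs on it contribute D each, but for
    -- each v they have total weight at most 2k |A|^(t-1); with D ≤ |A| this has the same order,
    -- which is why D is capped at |A|.
    average : ∀ D → D ≤ #A → ∑ (upTo D) (λ i → Modulus.total₂ (D + i)) ≤ (τX + 2 * k) * #A ^ t * E₂
    average D D≤#A = begin
      ∑ (upTo D) (λ i → ∑ Ω λ u → f u * ∑ Ω λ v → g v * g v * b i v u)
        ≡⟨ ∑-swap (upTo D) Ω _ ⟩
      ∑ Ω (λ u → ∑ (upTo D) λ i → f u * ∑ Ω λ v → g v * g v * b i v u)
        ≡⟨ ∑-cong Ω (λ u → trans (∑-*ˡ (upTo D) (f u) _) (cong (_*_ (f u)) (trans (∑-swap (upTo D) Ω _) (∑-cong Ω λ v → ∑-*ˡ (upTo D) (g v * g v) _)))) ⟩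
      ∑ Ω (λ u → f u * ∑ Ω λ v → g v * g v * ∑ (upTo D) λ i → b i v u)
        ≤⟨ ∑-mono∈ Ω (λ u u∈ → *-monoʳ-≤ (f u) (∑-mono∈ Ω λ v v∈ → *-monoʳ-≤ (g v * g v) (moduli-count D v u v∈ u∈))) ⟩
      ∑ Ω (λ u → f u * ∑ Ω λ v → g v * g v * (τX + D * on m (pos v) u))
        ≡⟨ ∑-cong Ω (λ u → trans (cong (_*_ (f u)) (trans (∑-cong Ω λ v → *-distribˡ-+ (g v * g v) τX _) (trans (∑-+ Ω _ _) (cong (_+ Q u) (∑-*ʳ Ω τX _)))))
             (*-distribˡ-+ (f u) (E₂ * τX) (Q u))) ⟩
      ∑ Ω (λ u → f u * (E₂ * τX) + f u * Q u)
        ≡⟨ trans (∑-+ Ω _ _) (cong (_+ ∑ Ω (λ u → f u * Q u)) (∑-*ʳ Ω (E₂ * τX) f)) ⟩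
      F * (E₂ * τX) + ∑ Ω (λ u → f u * Q u)
        ≡⟨ cong (_+_ (F * (E₂ * τX))) (trans (∑-cong Ω λ u → trans (sym (∑-*ˡ Ω (f u) _)) (∑-cong Ω λ v → regroup (f u) (g v) D (on m (pos v) u)))
             (trans (∑-swap Ω Ω _) (∑-cong Ω λ v → ∑-*ˡ Ω (g v * g v * D) _))) ⟩
      F * (E₂ * τX) + ∑ Ω (λ v → g v * g v * D * ∑ Ω λ u → f u * on m (pos v) u)
        ≤⟨ +-mono-≤ (*-monoˡ-≤ (E₂ * τX) F≤) (∑-mono Ω λ v → *-mono-≤ (*-monoʳ-≤ (g v * g v) D≤#A) (sphere v)) ⟩
      #A ^ t * (E₂ * τX) + ∑ Ω (λ v → g v * g v * #A * (2 * k * #A ^ suc τ′))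
        ≡⟨ cong (_+_ (#A ^ t * (E₂ * τX))) (trans (∑-*ʳ Ω (2 * k * #A ^ suc τ′) _) (cong (_* (2 * k * #A ^ suc τ′)) (∑-*ʳ Ω #A _))) ⟩
      #A ^ t * (E₂ * τX) + E₂ * #A * (2 * k * #A ^ suc τ′)
        ≡⟨ collect #A (#A ^ suc τ′) E₂ τX k ⟩
      (τX + 2 * k) * #A ^ t * E₂ ∎
      where
      open ≤-Reasoning
      b : ℕ → Point → Point → ℕ
      b i v u = meets (D + i) v (cell (suc (D + i)) u)
      Q : Point → ℕ
      Q u = ∑ Ω λ v → g v * g v * (D * on m (pos v) u)
      regroup : ∀ f g D o → f * (g * g * (D * o)) ≡ g * g * D * (f * o)
      regroup = ℕ-ring
      collect : ∀ a p e x k → a * p * (e * x) + e * a * (2 * k * p) ≡ (x + 2 * k) * (a * p) * e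
      collect = ℕ-ring
      sphere : ∀ v → ∑ Ω (λ u → f u * on m (pos v) u) ≤ 2 * k * #A ^ suc τ′
      sphere v = ≤-trans (∑-mono Ω λ u → *-monoˡ-≤ (on m (pos v) u) (f≤reps u))
        (≤-trans (≤-reflexive (cube-sum t t*m≤S*m (on m (pos v)))) (sphereReps-≤ τ′ (pos v)))

    P : ℕ
    P = T₂ S m * F * (#A ^ t * E₂)

    module Choice (D : ℕ) (1≤D : 1 ≤ D) (D≤#A : D ≤ #A) (i : ℕ) (i<D : i < D)
      (V : ℕ) (below : D * V ≤ (τX + 2 * k) * #A ^ t * E₂) (Y : ℕ)
      (I≤ : I f ≤ 2 * H * (suc (D + i) * (#divisors (suc (D + i)) * (4 * suc (D + i)))) * G + Y)
      (Y²≤ : Y * Y ≤ V * (2 * k * F)) where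

      open ≤-Reasoning

      R R′ : ℕ
      R = suc (D + i) * (#divisors (suc (D + i)) * (4 * suc (D + i)))
      R′ = (2 * D) * (τ (modulusBound m) * (4 * (2 * D)))

      q≤2D : suc (D + i) ≤ 2 * D
      q≤2D = ≤-trans (+-monoʳ-< D i<D) (≤-reflexive (cong (_+_ D) (sym (+-identityʳ D))))

      R-bound : 2 * H * R * G ≤ 2 * H * R′ * G
      R-bound = *-monoˡ-≤ G (*-monoʳ-≤ (2 * H) (*-mono-≤ q≤2D (*-mono-≤
        (#divisors≤τ (≤-trans q≤2D (≤-trans (*-monoʳ-≤ 2 (≤-trans D≤#A #A≤cube)) (≤modulusBound 1≤m)))) (*-monoʳ-≤ 4 q≤2D))))

      few-boxes : Y ≤ 2 * H * R * G → I f ≤ T₁ m * H * (D * D) * G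
      few-boxes Y≤ = begin
        I f ≤⟨ I≤ ⟩
        2 * H * R * G + Y ≤⟨ +-monoʳ-≤ (2 * H * R * G) Y≤ ⟩
        2 * H * R * G + 2 * H * R * G ≤⟨ +-mono-≤ R-bound R-bound ⟩
        2 * H * R′ * G + 2 * H * R′ * G ≡⟨ lemma H D (τ (modulusBound m)) G ⟩
        64 * τ (modulusBound m) * H * (D * D) * G ≡⟨ cong (λ z → z * H * (D * D) * G) (T₁-def m) ⟨
        T₁ m * H * (D * D) * G ∎
        where
        lemma : ∀ H D x G → 2 * H * ((2 * D) * (x * (4 * (2 * D)))) * G + 2 * H * ((2 * D) * (x * (4 * (2 * D)))) * G ≡ 64 * x * H * (D * D) * G
        lemma = ℕ-ring

      few-pairs : 2 * H * R * G ≤ Y → D * (I f * I f) ≤ P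
      few-pairs ≤Y = begin
        D * (I f * I f) ≤⟨ *-monoʳ-≤ D (*-mono-≤ I≤2Y I≤2Y) ⟩
        D * ((Y + Y) * (Y + Y)) ≡⟨ lemma D Y ⟩
        4 * (D * (Y * Y)) ≤⟨ *-monoʳ-≤ 4 (*-monoʳ-≤ D Y²≤) ⟩
        4 * (D * (V * (2 * k * F))) ≡⟨ lemma′ D V k F ⟩
        D * V * (8 * k * F) ≤⟨ *-monoˡ-≤ (8 * k * F) below ⟩
        (τX + 2 * k) * #A ^ t * E₂ * (8 * k * F) ≡⟨ lemma″ (τX + 2 * k) (#A ^ t) E₂ k F ⟩
        8 * k * (τX + 2 * k) * F * (#A ^ t * E₂) ≡⟨ cong (λ z → z * F * (#A ^ t * E₂)) (T₂-def S m) ⟨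
        P ∎
        where
        I≤2Y : I f ≤ Y + Y
        I≤2Y = ≤-trans I≤ (+-monoˡ-≤ Y ≤Y)
        lemma : ∀ D Y → D * ((Y + Y) * (Y + Y)) ≡ 4 * (D * (Y * Y))
        lemma = ℕ-ring
        lemma′ : ∀ D z k F → 4 * (D * (z * (2 * k * F))) ≡ D * z * (8 * k * F)
        lemma′ = ℕ-ring
        lemma″ : ∀ x a e k F → x * a * e * (8 * k * F) ≡ 8 * k * x * F * (a * e)
        lemma″ = ℕ-ring

      conclude : I f ≤ T₁ m * H * (D * D) * G ⊎ D * (I f * I f) ≤ P
      conclude with ≤-total Y (2 * H * R * G)
      ... | inj₁ h = inj₁ (few-boxes h)
      ... | inj₂ h = inj₂ (few-pairs h)

    -- Some modulus in (D , 2D] has `total₂` at most 1/D of the sum bounded in `average`. The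
    -- alternatives record whether the light boxes or the heavy part Y dominate.
    alternative : ∀ D → 1 ≤ D → D ≤ #A → I f ≤ T₁ m * H * (D * D) * G ⊎ D * (I f * I f) ≤ P
    alternative D 1≤D D≤#A = pick (below-average (upTo D) (subst (1 ≤_) (sym (length-upTo D)) 1≤D) V)
      where
      V : ℕ → ℕ
      V i = Modulus.total₂ (D + i)
      pick : Σ ℕ (λ i → i ∈ upTo D × length (upTo D) * V i ≤ ∑ (upTo D) V) → I f ≤ T₁ m * H * (D * D) * G ⊎ D * (I f * I f) ≤ P
      pick (i , i∈ , below) = let (Y , I≤ , Y²≤) = Modulus.incidence-bound (D + i) in
        Choice.conclude D 1≤D D≤#A i (∈-upTo⁻ i∈) (V i)
          (≤-trans (subst (λ n → n * V i ≤ ∑ (upTo D) V) (length-upTo D) below) (average D D≤#A)) Y I≤ Y²≤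

    outcome : 1 ≤ #A → Outcome (I f) (T₁ m * H) G P #A
    outcome 1≤#A = optimise (I f) (T₁ m * H) G P #A 1≤#A alternative

  W : ℕ
  W = ∑ Ω λ v → g v * inc v origin

  r : Point → ℕ
  r = reps t A

  -- r off the origin, restricted to values in [2^j , 2^(j+1)): on such a piece the maximum H is
  -- comparable to every nonzero value.
  level : ℕ → Point → ℕ
  level j u = ⟦ ¬? (origin ≟P u) ⟧ * (⟦ lg (r u) ≟ j ⟧ * r u)

  level≤r : ∀ j u → level j u ≤ r u
  level≤r j u = ≤-trans (⟦⟧*-≤ (¬? (origin ≟P u)) _) (⟦⟧*-≤ (lg (r u) ≟ j) (r u))

  level≤ : ∀ j u → level j u ≤ 2 * 2 ^ j
  level≤ j u = ≤-trans (⟦⟧*-≤ (¬? (origin ≟P u)) _) bound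
    where
    bound : ⟦ lg (r u) ≟ j ⟧ * r u ≤ 2 * 2 ^ j
    bound with lg (r u) ≟ j
    ... | yes e = ≤-trans (≤-reflexive (*-identityˡ (r u))) (≤-trans (<⇒≤ (<2^suc-lg (r u))) (≤-reflexive (cong (λ l → 2 ^ suc l) e)))
    ... | no _  = z≤n

  level-support : ∀ j u → 1 ≤ level j u → u ≢ origin × 2 ^ j ≤ r u
  level-support j u h with origin ≟P u | lg (r u) ≟ j
  ... | no ≢u | yes refl = (λ e → ≢u (sym e)) , 2^lg≤ (subst (1 ≤_) (trans (+-identityʳ (r u + 0)) (+-identityʳ (r u))) h)

  2^level*level≤ : ∀ j u → 2 ^ j * level j u ≤ r u * r u
  2^level*level≤ j u with level j u in eq
  ... | zero  = ≤-trans (≤-reflexive (*-zeroʳ (2 ^ j))) z≤n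
  ... | suc l = *-mono-≤ (proj₂ (level-support j u (subst (1 ≤_) (sym eq) (s≤s z≤n)))) (subst (_≤ r u) eq (level≤r j u))

  -- On the support of the level 2^j ≤ r, so 2^j times the level is at most r². This is the gain
  -- from cutting into levels.
  2^level*F≤energy : ∀ j → 2 ^ j * ∑ Ω (level j) ≤ energy t A
  2^level*F≤energy j = ≤-trans (≤-reflexive (sym (∑-*ˡ Ω (2 ^ j) (level j)))) (≤-trans (∑-mono Ω (2^level*level≤ j))
    (≤-reflexive (cube-sum t t*m≤S*m r)))

  level-vanishes : ∀ j → 2 * k * #A ^ τ′ < 2 ^ j → ∀ u → level j u ≡ 0
  level-vanishes j lt u = n≤0⇒n≡0 (≮⇒≥ λ 1≤l → let (u≢0 , 2^j≤r) = level-support j u 1≤l in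
    <⇒≱ lt (≤-trans 2^j≤r (reps-off-origin-≤ τ′ u u≢0)))

  #levels : ℕ
  #levels = levelCount τ′ m

  lg<#levels : ∀ u → lg (r u) < #levels
  lg<#levels u with r u in eq
  ... | zero  = s≤s z≤n
  ... | suc x = s≤s (lg-mono {suc x} (s≤s z≤n) (subst (_≤ levelBound (suc τ′) m) eq
    (≤-trans r≤ (≤-trans (^-monoˡ-≤ t #A≤cube) (≤levelBound (suc τ′) 1≤m)))))
    where
    r≤ : r u ≤ #A ^ t
    r≤ = ≤-trans (∑-bound (tuples t A) (λ w _ → ⟦⟧≤1 (sumP w ≟P u))) (≤-reflexive (trans (*-identityʳ _) (length-tuples t A)))

  central : Point → ℕ
  central u = ⟦ origin ≟P u ⟧ * r u

  decompose : ∀ u → r u ≡ central u + ∑ (upTo #levels) (λ j → level j u)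
  decompose u = trans (split (origin ≟P u)) (cong (_+_ (central u)) (sym levels))
    where
    split : ∀ d → r u ≡ ⟦ d ⟧ * r u + ⟦ ¬? d ⟧ * r u
    split (yes _) = sym (trans (+-identityʳ (1 * r u)) (*-identityˡ (r u)))
    split (no _)  = sym (*-identityˡ (r u))
    levels : ∑ (upTo #levels) (λ j → level j u) ≡ ⟦ ¬? (origin ≟P u) ⟧ * r u
    levels = trans (∑-*ˡ (upTo #levels) ⟦ ¬? (origin ≟P u) ⟧ (λ j → ⟦ lg (r u) ≟ j ⟧ * r u))
      (cong (_*_ ⟦ ¬? (origin ≟P u) ⟧) (∑-δ _≟_ (Uniqueₚ.upTo⁺ #levels) (λ _ → r u) (∈-upTo⁺ (lg<#levels u))))

  I-split : I r ≡ I central + ∑ (upTo #levels) (λ j → I (level j))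
  I-split = begin
    ∑ Ω (λ v → g v * ∑ Ω λ u → r u * inc v u)
      ≡⟨ ∑-cong Ω (λ v → cong (_*_ (g v)) (trans (∑-cong Ω λ u → expand v u) (trans (∑-+ Ω _ _) (cong (_+_ (∑ Ω λ u → central u * inc v u)) (∑-swap Ω (upTo #levels) _))))) ⟩
    ∑ Ω (λ v → g v * (∑ Ω (λ u → central u * inc v u) + ∑ (upTo #levels) λ j → ∑ Ω λ u → level j u * inc v u))
      ≡⟨ ∑-cong Ω (λ v → trans (*-distribˡ-+ (g v) _ _) (cong (_+_ (g v * ∑ Ω λ u → central u * inc v u)) (sym (∑-*ˡ (upTo #levels) (g v) _)))) ⟩
    ∑ Ω (λ v → g v * ∑ Ω (λ u → central u * inc v u) + ∑ (upTo #levels) λ j → g v * ∑ Ω λ u → level j u * inc v u)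
      ≡⟨ trans (∑-+ Ω _ _) (cong (_+_ (I central)) (∑-swap Ω (upTo #levels) _)) ⟩
    I central + ∑ (upTo #levels) (λ j → I (level j)) ∎
    where
    open ≡-Reasoning
    expand : ∀ v u → r u * inc v u ≡ central u * inc v u + ∑ (upTo #levels) (λ j → level j u * inc v u)
    expand v u = trans (cong (_* inc v u) (decompose u)) (trans (*-distribʳ-+ (inc v u) (central u) _)
      (cong (_+_ (central u * inc v u)) (sym (∑-*ʳ (upTo #levels) (inc v u) (λ j → level j u)))))

  -- The origin enters with its trivial weight |A|^(t-1); the saving must come from `W`, which sees
  -- only incidences with the origin.
  I-central≤ : I central ≤ #A * #A ^ τ′ * W
  I-central≤ = ≤-trans (∑-mono Ω λ v → *-monoʳ-≤ (g v) (at v)) (≤-reflexive (trans (∑-cong Ω λ v → swap (g v) (#A * #A ^ τ′) (inc v origin))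
    (∑-*ˡ Ω (#A * #A ^ τ′) (λ v → g v * inc v origin))))
    where
    swap : ∀ x y z → x * (y * z) ≡ y * (x * z)
    swap = ℕ-ring
    at : ∀ v → ∑ Ω (λ u → central u * inc v u) ≤ #A * #A ^ τ′ * inc v origin
    at v = ≤-trans (≤-reflexive (∑-cong Ω λ u → *-assoc ⟦ origin ≟P u ⟧ (r u) (inc v u)))
      (≤-trans (∑-δ-≤ _≟P_ (cube-unique (S * m)) (λ u → r u * inc v u) origin) (*-monoˡ-≤ (inc v origin) (reps-max (suc τ′) origin)))

  I-zero : ∀ f → (∀ u → f u ≡ 0) → I f ≡ 0
  I-zero f f≡0 = ∑-≡0 Ω λ v _ → trans (cong (_*_ (g v)) (∑-≡0 Ω λ u _ → cong (_* inc v u) (f≡0 u))) (*-zeroʳ (g v))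

  -- Either the origin carries at least half of I r, or the levels do, and then one of them has at
  -- least the average. The loss is 2 `#levels`, which is logarithmic in m.
  bound : 1 ≤ #A → Bound (T₃ S τ′ m) #A (#A ^ τ′) (#A ^ t) (energy t A) G E₂ W (I r)
  bound 1≤#A = subst (λ T → Bound T #A (#A ^ τ′) (#A ^ t) (energy t A) G E₂ W (I r)) (sym (T₃-def S τ′ m)) (cases (≤-total Σ₁ (I central)))
    where
    c Σ₁ : ℕ
    c = 2 * #levels
    Σ₁ = ∑ (upTo #levels) (λ j → I (level j))
    1≤c : 1 ≤ c
    1≤c = s≤s z≤n
    cases : Σ₁ ≤ I central ⊎ I central ≤ Σ₁ → Bound (combine c k (T₁ m) (T₂ S m)) #A (#A ^ τ′) (#A ^ t) (energy t A) G E₂ W (I r)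
    cases (inj₁ h) = atOrigin (≤-trans (≤-reflexive I-split) (≤-trans (+-monoʳ-≤ (I central) h)
      (≤-trans (≤-reflexive (double (I central))) (*-mono-≤ (≤-trans (*-monoʳ-≤ 2 (s≤s (z≤n {lg (levelBound (suc τ′) m)})))
        (c≤combine 1≤c (1≤circleBound m) (1≤T₁ m) (1≤T₂ S m))) I-central≤))))
      where
      double : ∀ x → x + x ≡ 2 * 1 * x
      double = ℕ-ring
    cases (inj₂ h) = at (above-average (upTo #levels) (subst (1 ≤_) (sym (length-upTo #levels)) (s≤s z≤n)) (λ j → I (level j)))
      where
      at : Σ ℕ (λ j → j ∈ upTo #levels × Σ₁ ≤ length (upTo #levels) * I (level j)) →
        Bound (combine c k (T₁ m) (T₂ S m)) #A (#A ^ τ′) (#A ^ t) (energy t A) G E₂ W (I r)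
      at (j , _ , Σ₁≤) = combine-bound 1≤c (1≤circleBound m) (1≤T₁ m) (1≤T₂ S m)
        {h = 2 ^ j} {F = ∑ Ω (level j)} {P = T₂ S m * ∑ Ω (level j) * (#A ^ t * E₂)}
        (≤-trans (≤-reflexive I-split) (≤-trans (+-mono-≤ h ≤-refl) (≤-trans (+-mono-≤ Σ₁≤#levels Σ₁≤#levels) (≤-reflexive (double #levels (I (level j)))))))
        (F≤ (level j) (2 * 2 ^ j) (level≤ j) (level≤r j)) refl
        (≤-trans (≤-reflexive (*-assoc 2 (2 ^ j) _)) (*-monoʳ-≤ 2 (2^level*F≤energy j)))
        (λ lt → I-zero (level j) (level-vanishes j lt))
        (outcome (level j) (2 * 2 ^ j) (level≤ j) (level≤r j) 1≤#A)
        where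
        Σ₁≤#levels : Σ₁ ≤ #levels * I (level j)
        Σ₁≤#levels = subst (λ n → Σ₁ ≤ n * I (level j)) (length-upTo #levels) Σ₁≤
        double : ∀ n x → n * x + n * x ≡ 2 * n * x
        double = ℕ-ring

-- The energy recursion

∑-positive : {X : Set} (xs : List X) (f : X → ℕ) → 1 ≤ ∑ xs f → Σ X λ x → x ∈ xs × 1 ≤ f x
∑-positive (x ∷ xs) f h with f x in eq
... | suc _ = x , here refl , subst (1 ≤_) (sym eq) (s≤s z≤n)
... | zero  = let (y , y∈ , p) = ∑-positive xs f h in y , there y∈ , p

-- With t = 2 + τ′ the energy satisfies E_t ≪ m^ε a^(ea τ′ / eb τ′), that is, a^(2t − 5/2 + 1 / (2·3^τ′)).
eb ea : ℕ → ℕ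
eb τ′ = 2 * 3 ^ τ′
ea τ′ = (3 + 4 * τ′) * 3 ^ τ′ + 1

1≤eb : ∀ τ′ → 1 ≤ eb τ′
1≤eb τ′ = *-mono-≤ (s≤s (z≤n {1})) (1≤^ τ′ (s≤s z≤n))

ea-suc : ∀ τ′ → ea (suc τ′) ≡ (9 + 4 * τ′) * eb τ′ + ea τ′
ea-suc τ′ = lemma τ′ (3 ^ τ′)
  where
  lemma : ∀ t X → (3 + 4 * (1 + t)) * (3 * X) + 1 ≡ (9 + 4 * t) * (2 * X) + ((3 + 4 * t) * X + 1)
  lemma = ℕ-ring

2τ*eb≤ea : ∀ τ′ → 2 * τ′ * eb τ′ ≤ ea τ′
2τ*eb≤ea τ′ = ≤-trans (m≤m+n _ (3 * 3 ^ τ′ + 1)) (≤-reflexive (lemma τ′ (3 ^ τ′)))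
  where
  lemma : ∀ t X → 2 * t * (2 * X) + (3 * X + 1) ≡ (3 + 4 * t) * X + 1
  lemma = ℕ-ring

-- A bound x ≤ T a^(α/β).
PowBound : ℕ → ℕ → ℕ → ℕ → ℕ → Set
PowBound x β T a α = x ^ β ≤ T * a ^ α

-- Off the origin r_2 ≤ 2k, summed over |A|² pairs; the origin adds r_2(0)² ≤ |A|².
energy-base : ∀ m A → Unique A → All (InS3 m) A → energy 2 A ≤ 3 * circleBound m * (length A * length A)
energy-base m A uA onS = begin
  ∑ (tuples 2 A) (λ w → reps 2 A (sumP w))
    ≤⟨ ∑-mono (tuples 2 A) (λ w → point (sumP w)) ⟩
  ∑ (tuples 2 A) (λ w → 2 * k + ⟦ sumP w ≟P origin ⟧ * #A)
    ≡⟨ trans (∑-+ (tuples 2 A) _ _) (cong₂ _+_ (∑-const (tuples 2 A) (2 * k)) (∑-*ʳ (tuples 2 A) #A _)) ⟩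
  length (tuples 2 A) * (2 * k) + reps 2 A origin * #A
    ≤⟨ +-mono-≤ (*-monoˡ-≤ (2 * k) (≤-reflexive (trans (length-tuples 2 A) (cong (_*_ #A) (*-identityʳ #A))))) (*-monoˡ-≤ #A at-origin) ⟩
  #A * #A * (2 * k) + #A * #A
    ≤⟨ +-monoʳ-≤ (#A * #A * (2 * k)) (m≤m*n′ (#A * #A) (1≤circleBound m)) ⟩
  #A * #A * (2 * k) + #A * #A * k
    ≡⟨ lemma (#A * #A) k ⟩
  3 * k * (#A * #A) ∎
  where
  open ≤-Reasoning
  open OnSphere m A uA onS
  lemma : ∀ a k → a * (2 * k) + a * k ≡ 3 * k * a
  lemma = ℕ-ring
  at-origin : reps 2 A origin ≤ #A
  at-origin = ≤-trans (reps-max 1 origin) (≤-reflexive (*-identityʳ #A))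
  point : ∀ u → reps 2 A u ≤ 2 * k + ⟦ u ≟P origin ⟧ * #A
  point u with u ≟P origin
  ... | yes refl = ≤-trans at-origin (≤-trans (≤-reflexive (sym (+-identityʳ #A))) (m≤n+m (#A + 0) (2 * k)))
  ... | no u≢0   = ≤-trans (reps-off-origin-≤ 0 u u≢0) (≤-trans (≤-reflexive (*-identityʳ (2 * k))) (m≤m+n (2 * k) 0))

-- The centres are the points v themselves, with weight g = r_{t+1}. Then both the incidence sum and
-- E₂ equal E_{t+1}, and two of the five factors in the fifth-power bound cancel to leave a cube.
module EnergyStep (m : ℕ) (1≤m : 1 ≤ m) (A : List Point) (uA : Unique A) (onS : All (InS3 m) A) (τ′ : ℕ) where

  open OnSphere m A uA onS

  S : ℕ
  S = 3 + τ′

  doubled-bounded : ∀ v → Bounded (S * m) v → Bounded (S * m + S * m) v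
  doubled-bounded v = bounded-≤ v (m≤m+n (S * m) (S * m))

  circles : ∀ u u′ → u ≢ u′ → (L : List Point) → Unique L →
    All (λ v → normSq (v ⊖ u) ≡ + m × normSq (v ⊖ u′) ≡ + m) L → length L ≤ circleBound m
  circles u u′ = circle-count m

  module WI = WeightedIncidence m 1≤m A uA onS τ′ S (n≤1+n (2 + τ′)) id doubled-bounded circles (reps S A)

  I≡ : WI.I WI.r ≡ energy S A
  I≡ = trans (∑-cong WI.Ω λ v → cong (_*_ (reps S A v)) (trans (cube-sum (2 + τ′) WI.t*m≤S*m (adj v)) (sym (reps-adj (2 + τ′) v))))
    (cube-sum S ≤-refl (reps S A))

  E₂≡ : WI.E₂ ≡ energy S A
  E₂≡ = cube-sum S ≤-refl (reps S A)

  G≡ : WI.G ≡ #A * (#A * (#A * #A ^ τ′))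
  G≡ = cube-total S ≤-refl

  W≤ : WI.W ≤ 2 * k * (#A * #A ^ τ′) * #A
  W≤ = begin
    ∑ WI.Ω (λ v → reps S A v * adj v origin) ≤⟨ ∑-mono WI.Ω (λ v → *-monoˡ-≤ (adj v origin) (reps-three-≤ τ′ v)) ⟩
    ∑ WI.Ω (λ v → 2 * k * (#A * #A ^ τ′) * adj v origin) ≡⟨ ∑-*ˡ WI.Ω (2 * k * (#A * #A ^ τ′)) _ ⟩
    2 * k * (#A * #A ^ τ′) * ∑ WI.Ω (λ v → adj v origin) ≤⟨ *-monoʳ-≤ (2 * k * (#A * #A ^ τ′)) column ⟩
    2 * k * (#A * #A ^ τ′) * #A ∎
    where
    open ≤-Reasoning
    column : ∑ WI.Ω (λ v → adj v origin) ≤ #A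
    column = ≤-trans (≤-reflexive (∑-swap WI.Ω A _)) (≤-trans (∑-bound A λ a _ →
      ≤-trans (≤-reflexive (∑-cong WI.Ω λ v → sym (*-identityʳ _))) (∑-δ-≤ _≟P_ (cube-unique (S * m)) (λ _ → 1) (a ⊕ origin)))
      (≤-reflexive (*-identityʳ #A)))

  outcome : 1 ≤ #A → Bound (T₃ S τ′ m) #A (#A ^ τ′) (#A * (#A * #A ^ τ′)) (energy (2 + τ′) A)
    (#A * (#A * (#A * #A ^ τ′))) (energy S A) WI.W (energy S A)
  outcome 1≤#A = subst₂ (λ G E → Bound (T₃ S τ′ m) #A (#A ^ τ′) (#A * (#A * #A ^ τ′)) (energy (2 + τ′) A) G E WI.W (energy S A)) G≡ E₂≡
    (subst (Bound (T₃ S τ′ m) #A (#A ^ τ′) (#A * (#A * #A ^ τ′)) (energy (2 + τ′) A) WI.G WI.E₂ WI.W) I≡ (WI.bound 1≤#A))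

cancel-fifth : ∀ x R → x * ((x * x) * (x * x)) ≤ R * (x * x) → x * (x * x) ≤ R
cancel-fifth zero      R h = z≤n
cancel-fifth x@(suc _) R h = *-cancelʳ-≤ (x * (x * x)) R (x * x) {{m*n≢0 x x}} (≤-trans (≤-reflexive (lemma x)) h)
  where
  lemma : ∀ x → x * (x * x) * (x * x) ≡ x * ((x * x) * (x * x))
  lemma = ℕ-ring

-- The recursion E_{t+1} ≪ max ( a^(2t−1) , (a E_t a^(4t))^(1/3) ).
energy-dichotomy : ∀ {T k a p E W x} → 1 ≤ k → 1 ≤ a → W ≤ 2 * k * (a * p) * a →
  Bound T a p (a * (a * p)) E (a * (a * (a * p))) x W x →
  x ≤ 2 * k * T * (a * (a * a) * (p * p)) ⊎ x * (x * x) ≤ T * (E * (a * ((a * (a * p)) * (a * (a * p)) * ((a * (a * p)) * (a * (a * p))))))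
energy-dichotomy {T} {k} {a} {p} {E} {W} {x} 1≤k 1≤a W≤ (atOrigin h) = inj₁ (≤-trans h (≤-trans (*-monoʳ-≤ T (*-monoʳ-≤ (a * p) W≤))
  (≤-reflexive (lemma T a p k))))
  where
  lemma : ∀ T a p k → T * (a * p * (2 * k * (a * p) * a)) ≡ 2 * k * T * (a * (a * a) * (p * p))
  lemma = ℕ-ring
energy-dichotomy {T} {k} {a} {p} {E} {W} {x} 1≤k 1≤a W≤ (linear h) = inj₁ (≤-trans h (≤-trans (m≤m*n′ _ (*-mono-≤ (s≤s (z≤n {1})) 1≤k))
  (≤-reflexive (lemma T a p k))))
  where
  lemma : ∀ T a p k → T * (p * (a * (a * (a * p)))) * (2 * k) ≡ 2 * k * T * (a * (a * a) * (p * p))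
  lemma = ℕ-ring
energy-dichotomy {T} {k} {a} {p} {E} {W} {zero} 1≤k 1≤a W≤ (capped h) = inj₁ z≤n
energy-dichotomy {T} {k} {a} {p} {E} {W} {x@(suc _)} 1≤k 1≤a W≤ (capped h) = inj₁ (≤-trans (*-cancelˡ-≤ a {{>-nonZero 1≤a}}
    (*-cancelʳ-≤ (a * x) (a * (T * (a * (a * a) * (p * p)))) x (≤-trans (≤-reflexive (*-assoc a x x)) (≤-trans h (≤-reflexive (lemma T a p x))))))
  (≤-trans (m≤m*n′ _ (*-mono-≤ (s≤s (z≤n {1})) 1≤k)) (≤-reflexive (lemma′ T k (a * (a * a) * (p * p))))))
  where
  lemma : ∀ T a p x → T * (a * (a * p) * (a * (a * p)) * x) ≡ a * (T * (a * (a * a) * (p * p))) * x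
  lemma = ℕ-ring
  lemma′ : ∀ T k z → T * z * (2 * k) ≡ 2 * k * T * z
  lemma′ = ℕ-ring
energy-dichotomy {T} {k} {a} {p} {E} {W} {x} 1≤k 1≤a W≤ (fifth h) = inj₂ (cancel-fifth x _ (≤-trans h (≤-reflexive (lemma T E a (a * (a * p)) x))))
  where
  lemma : ∀ T E a q x → T * (E * (q * q * q) * (a * q) * (x * x)) ≡ T * (E * (a * (q * q * (q * q)))) * (x * x)
  lemma = ℕ-ring

cube^ : ∀ x n → (x * (x * x)) ^ n ≡ x ^ (3 * n)
cube^ x n = trans (cong (λ z → (x * (x * z)) ^ n) (sym (*-identityʳ x))) (^-*-assoc x 3 n)

1≤→^≤ : ∀ {a m n} → 1 ≤ a → m ≤ n → a ^ m ≤ a ^ n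
1≤→^≤ {suc a} _ h = ^-monoʳ-≤ (suc a) h

-- The first branch has exponent 2t - 1 = 3 + 2τ′, strictly below the target. The second reproduces
-- it exactly: 4t + 1 = 9 + 4τ′, and `ea-suc` is the recursion for the numerators.
energy-exponents : ∀ {T k a E T′ x} τ′ → 1 ≤ T → 1 ≤ k → 1 ≤ T′ → 1 ≤ a → PowBound E (eb τ′) T′ a (ea τ′) →
  let p = a ^ τ′; q = a * (a * p) in
  x ≤ 2 * k * T * (a * (a * a) * (p * p)) ⊎ x * (x * x) ≤ T * (E * (a * ((q * q) * (q * q)))) →
  PowBound x (eb (suc τ′)) ((2 * k * T) ^ (3 * eb τ′) * T′) a (ea (suc τ′))
energy-exponents {T} {k} {a} {E} {T′} {x} τ′ 1≤T 1≤k 1≤T′ 1≤a hE (inj₁ h) = begin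
  x ^ eb (suc τ′) ≡⟨ cong (x ^_) (triple (3 ^ τ′)) ⟩
  x ^ (3 * b) ≤⟨ ^-monoˡ-≤ (3 * b) (≤-trans h (≤-reflexive (cong (_*_ (2 * k * T)) power))) ⟩
  (2 * k * T * a ^ (3 + (τ′ + τ′))) ^ (3 * b) ≡⟨ trans (*-^ (2 * k * T) _ (3 * b)) (cong (_*_ ((2 * k * T) ^ (3 * b))) (^-*-assoc a (3 + (τ′ + τ′)) (3 * b))) ⟩
  (2 * k * T) ^ (3 * b) * a ^ ((3 + (τ′ + τ′)) * (3 * b))  ≤⟨ *-mono-≤ (m≤m*n′ ((2 * k * T) ^ (3 * b)) 1≤T′) (1≤→^≤ 1≤a exponent) ⟩
  (2 * k * T) ^ (3 * b) * T′ * a ^ ea (suc τ′) ∎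
  where
  open ≤-Reasoning
  b : ℕ
  b = eb τ′
  triple : ∀ X → 2 * (3 * X) ≡ 3 * (2 * X)
  triple = ℕ-ring
  power : a * (a * a) * (a ^ τ′ * a ^ τ′) ≡ a ^ (3 + (τ′ + τ′))
  power = trans (cong (_*_ (a * (a * a))) (sym (^-distribˡ-+-* a τ′ τ′))) (lemma a (a ^ (τ′ + τ′)))
    where
    lemma : ∀ a z → a * (a * a) * z ≡ a * (a * (a * z))
    lemma = ℕ-ring
  exponent : (3 + (τ′ + τ′)) * (3 * b) ≤ ea (suc τ′)
  exponent = ≤-trans (≤-reflexive (lemma τ′ b)) (≤-trans (+-monoʳ-≤ ((9 + 4 * τ′) * b) (2τ*eb≤ea τ′)) (≤-reflexive (sym (ea-suc τ′))))
    where
    lemma : ∀ t b → (3 + (t + t)) * (3 * b) ≡ (9 + 4 * t) * b + 2 * t * b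
    lemma = ℕ-ring
energy-exponents {T} {k} {a} {E} {T′} {x} τ′ 1≤T 1≤k 1≤T′ 1≤a hE (inj₂ h) = begin
  x ^ eb (suc τ′) ≡⟨ trans (cong (x ^_) (triple (3 ^ τ′))) (sym (cube^ x b)) ⟩
  (x * (x * x)) ^ b ≤⟨ ^-monoˡ-≤ b h ⟩
  (T * (E * (a * ((q * q) * (q * q))))) ^ b ≡⟨ trans (*-^ T _ b) (cong (_*_ (T ^ b)) (*-^ E _ b)) ⟩
  T ^ b * (E ^ b * (a * ((q * q) * (q * q))) ^ b) ≤⟨ *-mono-≤ constant (*-mono-≤ hE (≤-reflexive (trans (cong (_^ b) power) (^-*-assoc a (9 + 4 * τ′) b)))) ⟩
  (2 * k * T) ^ (3 * b) * (T′ * a ^ ea τ′ * a ^ ((9 + 4 * τ′) * b))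
      ≡⟨ trans (cong (_*_ ((2 * k * T) ^ (3 * b))) (*-assoc T′ _ _)) (sym (*-assoc ((2 * k * T) ^ (3 * b)) T′ _)) ⟩
  (2 * k * T) ^ (3 * b) * T′ * (a ^ ea τ′ * a ^ ((9 + 4 * τ′) * b))
      ≡⟨ cong (_*_ ((2 * k * T) ^ (3 * b) * T′)) (trans (sym (^-distribˡ-+-* a (ea τ′) ((9 + 4 * τ′) * b)))
                                                                (cong (a ^_) (trans (+-comm (ea τ′) ((9 + 4 * τ′) * b)) (sym (ea-suc τ′))))) ⟩
  (2 * k * T) ^ (3 * b) * T′ * a ^ ea (suc τ′) ∎
  where
  open ≤-Reasoning
  b q : ℕ
  b = eb τ′
  q = a * (a * a ^ τ′)
  triple : ∀ X → 2 * (3 * X) ≡ 3 * (2 * X)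
  triple = ℕ-ring
  constant : T ^ b ≤ (2 * k * T) ^ (3 * b)
  constant = ≤-trans (^-monoˡ-≤ b (≤-trans (m≤m*n′ T (*-mono-≤ (s≤s (z≤n {1})) 1≤k)) (≤-reflexive (*-comm T (2 * k)))))
    (1≤→^≤ (*-mono-≤ (*-mono-≤ (s≤s (z≤n {1})) 1≤k) 1≤T) (m≤m+n b _))
  power : a * ((q * q) * (q * q)) ≡ a ^ (9 + 4 * τ′)
  power = trans (lemma a (a ^ τ′)) (trans (cong (_*_ (a ^ 9)) (trans (sym (fourth (a ^ τ′)))
      (trans (^-*-assoc a τ′ 4) (cong (a ^_) (*-comm τ′ 4))))) (sym (^-distribˡ-+-* a 9 (4 * τ′))))
    where
    fourth : ∀ p → p * (p * (p * (p * 1))) ≡ p * p * (p * p)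
    fourth = ℕ-ring
    lemma : ∀ a p → a * ((a * (a * p) * (a * (a * p))) * (a * (a * p) * (a * (a * p)))) ≡
      a * (a * (a * (a * (a * (a * (a * (a * (a * 1)))))))) * (p * p * (p * p))
    lemma = ℕ-ring

energyConstant : ℕ → ℕ → ℕ
energyConstant zero     m = (3 * circleBound m) ^ 2
energyConstant (suc τ′) m = (2 * circleBound m * T₃ (3 + τ′) τ′ m) ^ (3 * eb τ′) * energyConstant τ′ m

subPoly-energyConstant : ∀ τ′ → SubPoly (energyConstant τ′)
subPoly-energyConstant zero     = subPoly-^ (subPoly-* (subPoly-const 3) subPoly-circleBound) 2
subPoly-energyConstant (suc τ′) = subPoly-* (subPoly-^ (subPoly-* (subPoly-* (subPoly-const 2) subPoly-circleBound) (subPoly-T₃ (3 + τ′) τ′)) (3 * eb τ′))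
  (subPoly-energyConstant τ′)

1≤T₃ : ∀ S τ′ m → 1 ≤ T₃ S τ′ m
1≤T₃ S τ′ m = subst (1 ≤_) (sym (T₃-def S τ′ m)) (≤-trans (s≤s z≤n) (c≤combine {2 * levelCount τ′ m} (s≤s z≤n) (1≤circleBound m) (1≤T₁ m) (1≤T₂ S m)))

1≤energyConstant : ∀ τ′ m → 1 ≤ energyConstant τ′ m
1≤energyConstant zero     m = 1≤^ 2 (*-mono-≤ (s≤s (z≤n {2})) (1≤circleBound m))
1≤energyConstant (suc τ′) m = *-mono-≤ (1≤^ (3 * eb τ′) (*-mono-≤ (*-mono-≤ (s≤s (z≤n {1})) (1≤circleBound m)) (1≤T₃ (3 + τ′) τ′ m))) (1≤energyConstant τ′ m)

energy-bound : ∀ τ′ m → 1 ≤ m → (A : List Point) → Unique A → All (InS3 m) A →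
  PowBound (energy (2 + τ′) A) (eb τ′) (energyConstant τ′ m) (length A) (ea τ′)
energy-bound zero m 1≤m A uA onS = ≤-trans (^-monoˡ-≤ 2 (energy-base m A uA onS)) (≤-reflexive (lemma (3 * circleBound m) (length A)))
  where
  lemma : ∀ c a → c * (a * a) * (c * (a * a) * 1) ≡ c * (c * 1) * (a * (a * (a * (a * 1))))
  lemma = ℕ-ring
energy-bound (suc τ′) m 1≤m [] _ _ = ≤-trans (≤-reflexive (0^ (eb (suc τ′)) (1≤eb (suc τ′)))) z≤n
  where
  0^ : ∀ n → 1 ≤ n → 0 ^ n ≡ 0
  0^ (suc n) _ = refl
energy-bound (suc τ′) m 1≤m A@(_ ∷ _) uA onS = energy-exponents τ′ (1≤T₃ (3 + τ′) τ′ m) (1≤circleBound m) (1≤energyConstant τ′ m) (s≤s z≤n)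
  (energy-bound τ′ m 1≤m A uA onS)
  (energy-dichotomy (1≤circleBound m) (s≤s z≤n) (EnergyStep.W≤ m 1≤m A uA onS τ′) (EnergyStep.outcome m 1≤m A uA onS τ′ (s≤s z≤n)))

-- Rational exponents

toℚᵘ-/ : ∀ n d .{{_ : NonZero d}} → ℚ.toℚᵘ (n ℚ./ d) ℚᵘ.≃ (n ℚᵘ./ d)
toℚᵘ-/ n (suc d) = ℚₚ.toℚᵘ-fromℚᵘ (mkℚᵘ n d)

cross-multiply : ∀ p d p′ d′ .{{_ : NonZero d}} .{{_ : NonZero d′}} → (+ p) ℚ./ d ≡ (+ p′) ℚ./ d′ → p * d′ ≡ p′ * d
cross-multiply p d@(suc _) p′ d′@(suc _) eq with ℚᵘₚ.≃-trans (ℚᵘₚ.≃-sym (toℚᵘ-/ (+ p) d)) (ℚᵘₚ.≃-trans (ℚₚ.toℚᵘ-cong eq) (toℚᵘ-/ (+ p′) d′))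
... | *≡* e = ℤₚ.+-injective (trans (ℤₚ.pos-* p d′) (trans e (sym (ℤₚ.pos-* p′ d))))

-- The hypothesis is s - 5/2 + L/M = α/β multiplied by 2 M β, with the negative term moved across so
-- that it can be checked in ℕ.
expo-cross : ∀ s L M α β .{{_ : NonZero M}} .{{_ : NonZero β}} → lam s ≡ (+ L) ℚ./ M →
  2 * s * M * β + 2 * L * β ≡ 2 * M * α + 5 * M * β → expo s ≡ (+ α) ℚ./ β
expo-cross s L M@(suc M₁) α β@(suc β₁) lam≡ eq = ℚₚ.toℚᵘ-injective (ℚᵘₚ.≃-trans unfold (ℚᵘₚ.≃-trans (*≡* cross) (ℚᵘₚ.≃-sym (toℚᵘ-/ (+ α) β))))
  where
  first second : ℚ
  first = ((+ s) ℚ./ 1) ℚ.- ((+ 3) ℚ./ 1)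
  second = first ℚ.+ ((+ 1) ℚ./ 2)
  sum₁ sum₂ sum : ℚᵘ
  sum₁ = mkℚᵘ (+ s) 0 ℚᵘ.+ mkℚᵘ (-ᶻ + 3) 0
  sum₂ = sum₁ ℚᵘ.+ mkℚᵘ (+ 1) 1
  sum = sum₂ ℚᵘ.+ mkℚᵘ (+ L) M₁
  first≃ : ℚ.toℚᵘ first ℚᵘ.≃ sum₁
  first≃ = ℚᵘₚ.≃-trans (ℚₚ.toℚᵘ-homo-+ ((+ s) ℚ./ 1) (ℚ.- ((+ 3) ℚ./ 1))) (ℚᵘₚ.+-congˡ (mkℚᵘ (-ᶻ + 3) 0) (toℚᵘ-/ (+ s) 1))
  second≃ : ℚ.toℚᵘ second ℚᵘ.≃ sum₂
  second≃ = ℚᵘₚ.≃-trans (ℚₚ.toℚᵘ-homo-+ first ((+ 1) ℚ./ 2)) (ℚᵘₚ.+-congˡ (mkℚᵘ (+ 1) 1) first≃)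
  unfold : ℚ.toℚᵘ (expo s) ℚᵘ.≃ sum
  unfold = ℚᵘₚ.≃-trans (ℚₚ.toℚᵘ-homo-+ second (lam s))
    (ℚᵘₚ.+-cong {ℚ.toℚᵘ second} {sum₂} {ℚ.toℚᵘ (lam s)} {mkℚᵘ (+ L) M₁} second≃ (ℚᵘₚ.≃-trans (ℚₚ.toℚᵘ-cong lam≡) (toℚᵘ-/ (+ L) M)))
  eqᶻ : + 2 *ᶻ + s *ᶻ + M *ᶻ + β +ᶻ + 2 *ᶻ + L *ᶻ + β ≡ + 2 *ᶻ + M *ᶻ + α +ᶻ + 5 *ᶻ + M *ᶻ + β
  eqᶻ = trans (sym (trans (ℤₚ.pos-+ (2 * s * M * β) _) (cong₂ _+ᶻ_ (four 2 s M β) (three* 2 L β))))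
    (trans (cong +_ eq) (trans (ℤₚ.pos-+ (2 * M * α) _) (cong₂ _+ᶻ_ (three* 2 M α) (three* 5 M β))))
    where
    three* : ∀ a b c → + (a * b * c) ≡ + a *ᶻ + b *ᶻ + c
    three* a b c = trans (ℤₚ.pos-* (a * b) c) (cong (_*ᶻ + c) (ℤₚ.pos-* a b))
    four : ∀ a b c d → + (a * b * c * d) ≡ + a *ᶻ + b *ᶻ + c *ᶻ + d
    four a b c d = trans (ℤₚ.pos-* (a * b * c) d) (cong (_*ᶻ + d) (three* a b c))
  cross : ℚᵘ.↥ sum *ᶻ + β ≡ + α *ᶻ ℚᵘ.↧ sum
  cross = trans (lemma (+ s) (+ L) (+ M) (+ β)) (trans (cong (_-ᶻ + 5 *ᶻ + M *ᶻ + β) eqᶻ) (trans (lemma′ (+ M) (+ α) (+ β)) (cong (_*ᶻ_ (+ α)) (sym (ℤₚ.pos-* 2 M)))))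
    where
    lemma : ∀ s L M b → (((s *ᶻ + 1 +ᶻ -ᶻ + 3 *ᶻ + 1) *ᶻ + 2 +ᶻ + 1 *ᶻ + 1) *ᶻ M +ᶻ L *ᶻ + 2) *ᶻ b ≡
      (+ 2 *ᶻ s *ᶻ M *ᶻ b +ᶻ + 2 *ᶻ L *ᶻ b) -ᶻ + 5 *ᶻ M *ᶻ b
    lemma = ℤ-ring
    lemma′ : ∀ M a b → (+ 2 *ᶻ M *ᶻ a +ᶻ + 5 *ᶻ M *ᶻ b) -ᶻ + 5 *ᶻ M *ᶻ b ≡ a *ᶻ (+ 2 *ᶻ M)
    lemma′ = ℤ-ring

lam-even : ∀ s M .{{_ : NonZero M}} → s % 2 ≡ 0 → 2 * 3 ^ (s / 2) ≡ M → lam s ≡ (+ 9) ℚ./ M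
lam-even s M e refl with s % 2 | e
... | zero | refl = refl

lam-odd : ∀ s M .{{_ : NonZero M}} → s % 2 ≡ 1 → 10 * 3 ^ (s / 2) ≡ M → lam s ≡ (+ 27) ℚ./ M
lam-odd s M e refl with s % 2 | e
... | suc zero | refl = refl

double%2 : ∀ t → (t + t) % 2 ≡ 0
double%2 t = trans (cong (_% 2) (lemma t)) ([m+kn]%n≡m%n 0 t 2)
  where
  lemma : ∀ t → t + t ≡ 0 + t * 2
  lemma = ℕ-ring

suc-double%2 : ∀ t → (t + suc t) % 2 ≡ 1
suc-double%2 t = trans (cong (_% 2) (lemma t)) ([m+kn]%n≡m%n 1 t 2)
  where
  lemma : ∀ t → t + suc t ≡ 1 + t * 2
  lemma = ℕ-ring

half-unique : ∀ s r t → s % 2 ≡ r → s ≡ r + t * 2 → s / 2 ≡ t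
half-unique s r t s%2≡r s≡ = *-cancelʳ-≡ (s / 2) t 2 (+-cancelˡ-≡ r (s / 2 * 2) (t * 2)
  (trans (cong (_+ s / 2 * 2) (sym s%2≡r)) (trans (sym (m≡m%n+[m/n]*n s 2)) s≡)))

-- 9/(2·3^t) = 1/(2·3^τ′), so 2t - 5/2 + λ has the denominator `eb τ′`.
expo-even : ∀ τ′ .{{_ : NonZero (eb τ′)}} → let t = 2 + τ′ in expo (t + t) ≡ (+ ea τ′) ℚ./ eb τ′
expo-even τ′ = expo-cross (t + t) 9 (2 * 3 ^ t) (ea τ′) (eb τ′) (lam-even (t + t) (2 * 3 ^ t) (double%2 t)
    (cong (λ h → 2 * 3 ^ h) (half-unique (t + t) 0 t (double%2 t) (double t)))) (lemma τ′ (3 ^ τ′))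
  where
  t : ℕ
  t = 2 + τ′
  instance _ = >-nonZero (*-mono-≤ (s≤s (z≤n {1})) (1≤^ t (s≤s (z≤n {2}))))
  double : ∀ t → t + t ≡ 0 + t * 2
  double = ℕ-ring
  lemma : ∀ t X → 2 * ((2 + t) + (2 + t)) * (2 * (3 * (3 * X))) * (2 * X) + 2 * 9 * (2 * X) ≡
    2 * (2 * (3 * (3 * X))) * ((3 + 4 * t) * X + 1) + 5 * (2 * (3 * (3 * X))) * (2 * X)
  lemma = ℕ-ring

-- The right side is (4t + 3e)/5 with e = `ea τ′` / `eb τ′`; the defect 1/(2·3^τ′) of e becomes
-- 3/(10·3^τ′) = 27/(10·3^t).
expo-odd : ∀ τ′ .{{_ : NonZero (5 * eb τ′)}} → let t = 2 + τ′ in expo (t + suc t) ≡ (+ (4 * t * eb τ′ + 3 * ea τ′)) ℚ./ (5 * eb τ′)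
expo-odd τ′ = expo-cross (t + suc t) 27 (10 * 3 ^ t) (4 * t * eb τ′ + 3 * ea τ′) (5 * eb τ′) (lam-odd (t + suc t) (10 * 3 ^ t) (suc-double%2 t)
    (cong (λ h → 10 * 3 ^ h) (half-unique (t + suc t) 1 t (suc-double%2 t) (double t)))) (lemma τ′ (3 ^ τ′))
  where
  t : ℕ
  t = 2 + τ′
  instance _ = >-nonZero (*-mono-≤ (s≤s (z≤n {9})) (1≤^ t (s≤s (z≤n {2}))))
  double : ∀ t → t + suc t ≡ 1 + t * 2
  double = ℕ-ring
  lemma : ∀ t X → 2 * ((2 + t) + (3 + t)) * (10 * (3 * (3 * X))) * (5 * (2 * X)) + 2 * 27 * (5 * (2 * X)) ≡
    2 * (10 * (3 * (3 * X))) * (4 * (2 + t) * (2 * X) + 3 * ((3 + 4 * t) * X + 1)) + 5 * (10 * (3 * (3 * X))) * (5 * (2 * X))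
  lemma = ℕ-ring

-- Even and odd s

-- r_{2t}(n) counts coincidences of the sum w with n - w′ over pairs of t-tuples. The
-- self-coincidences of either side number E_t.
reps-even≤energy : ∀ m t A n → Unique A → All (InS3 m) A → reps (t + t) A n ≤ energy t A
reps-even≤energy m t A n@(n₁ , n₂ , n₃) uA onS = square-cancel-≤ (begin
  reps (t + t) A n * reps (t + t) A n ≡⟨ cong₂ _*_ rep≡ rep≡ ⟩
  C * C ≤⟨ coincidences _≟P_ (cube-unique B) ws ws sumP β
                                             (λ w w∈ → ∈-cube (sumP w) (bounded-≤ (sumP w) (m≤n+m (t * m) N) (All.lookup (sums-bounded t) w∈)))
                                             (λ w w∈ → ∈-cube (β w) (bounded-⊖ n (sumP w) n-bounded (All.lookup (sums-bounded t) w∈))) ⟩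
  ∑ ws (λ w → ∑ ws λ w′ → ⟦ sumP w ≟P sumP w′ ⟧) * ∑ ws (λ w → ∑ ws λ w′ → ⟦ β w ≟P β w′ ⟧)
      ≡⟨ cong₂ _*_ (∑-cong ws λ w → ∑-cong ws λ w′ → ⟦⟧-cong (sumP w ≟P sumP w′) (sumP w′ ≟P sumP w) sym sym)
                                             (∑-cong ws λ w → ∑-cong ws λ w′ → ⟦⟧-cong (β w ≟P β w′) (sumP w′ ≟P sumP w) (β-injective w w′) (λ e → cong (n ⊖_) (sym e))) ⟩
  energy t A * energy t A ∎)
  where
  open ≤-Reasoning
  open OnSphere m A uA onS using (sums-bounded)
  ws : List (List Point)
  ws = tuples t A
  N B C : ℕ
  -- n is arbitrary here, so the cube of labels is enlarged to contain every n - w′; its size does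
  -- not enter the bound.
  N = ∣ n₁ ∣ + ∣ n₂ ∣ + ∣ n₃ ∣
  B = N + t * m
  n-bounded : Bounded N n
  n-bounded = ≤-trans (m≤m+n ∣ n₁ ∣ ∣ n₂ ∣) (m≤m+n _ ∣ n₃ ∣) , ≤-trans (m≤n+m ∣ n₂ ∣ ∣ n₁ ∣) (m≤m+n _ ∣ n₃ ∣) , m≤n+m ∣ n₃ ∣ _
  β : List Point → Point
  β w = n ⊖ sumP w
  β-injective : ∀ w w′ → β w ≡ β w′ → sumP w′ ≡ sumP w
  β-injective w w′ e = trans (sym (cancel (sumP w′))) (trans (cong (n ⊖_) (sym e)) (cancel (sumP w)))
    where
    cancel : ∀ p → n ⊖ (n ⊖ p) ≡ p
    cancel (x , y , z) = cong₂ _,_ (l n₁ x) (cong₂ _,_ (l n₂ y) (l n₃ z))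
      where
      l : ∀ a x → a -ᶻ (a -ᶻ x) ≡ x
      l = ℤ-ring
  C = ∑ ws (λ w → ∑ ws λ w′ → ⟦ sumP w ≟P β w′ ⟧)
  rep≡ : reps (t + t) A n ≡ C
  rep≡ = trans (tupleSum-+ t t A (λ u → ⟦ u ≟P n ⟧)) (∑-cong ws λ w → ∑-cong ws λ w′ →
    ⟦⟧-cong ((sumP w ⊕ sumP w′) ≟P n) (sumP w ≟P β w′)
      (λ { refl → sym (trans (cong (_⊖ sumP w′) (⊕-comm (sumP w) (sumP w′))) (⊕-⊖ (sumP w′) (sumP w))) })
      (λ e → trans (⊕-comm (sumP w) (sumP w′)) (trans (cong (sumP w′ ⊕_) e) (⊖-⊕ (sumP w′) n))))

-- r_{2t+1}(n₀) = Σ r_t(v) r_{t+1}(n₀ - v): the centres are n₀ - v with weight g = r_t, so that G =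
-- |A|^t and E₂ = E_t, while W becomes r_{t+1}(n₀).
module OddSum (m : ℕ) (1≤m : 1 ≤ m) (A : List Point) (uA : Unique A) (onS : All (InS3 m) A) (τ′ : ℕ)
  (n₀ : Point) (n₀-bounded : Bounded ((3 + τ′ + (2 + τ′)) * m) n₀) where

  open OnSphere m A uA onS

  t S : ℕ
  t = 2 + τ′
  S = 3 + τ′ + t

  reflect-injective : ∀ u u′ → n₀ ⊖ u ≡ n₀ ⊖ u′ → u ≡ u′
  reflect-injective u u′ e = trans (sym (⊖-⊖ u)) (trans (cong (n₀ ⊖_) e) (⊖-⊖ u′))
    where
    ⊖-⊖ : ∀ p → n₀ ⊖ (n₀ ⊖ p) ≡ p
    ⊖-⊖ p = trans (cong (_⊖ (n₀ ⊖ p)) (trans (sym (⊖-⊕ p n₀)) (⊕-comm p (n₀ ⊖ p)))) (⊕-⊖ (n₀ ⊖ p) p)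

  reflected-circle : ∀ u u′ → u ≢ u′ → (L : List Point) → Unique L →
    All (λ v → normSq (n₀ ⊖ v ⊖ u) ≡ + m × normSq (n₀ ⊖ v ⊖ u′) ≡ + m) L → length L ≤ circleBound m
  reflected-circle u u′ u≢u′ L uL props = circle-count m {n₀ ⊖ u} {n₀ ⊖ u′} (λ e → u≢u′ (reflect-injective u u′ e)) L uL
    (All.tabulate λ {v} v∈ → reflect v u (proj₁ (All.lookup props v∈)) , reflect v u′ (proj₂ (All.lookup props v∈)))
    where
    reflect : ∀ v w → normSq (n₀ ⊖ v ⊖ w) ≡ + m → normSq (v ⊖ (n₀ ⊖ w)) ≡ + m
    reflect v w h = trans (sym (normSq-reflect n₀ v w)) h

  reflected-bounded : ∀ v → Bounded (S * m) v → Bounded (S * m + S * m) (n₀ ⊖ v)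
  reflected-bounded v = bounded-⊖ n₀ v n₀-bounded

  module WI = WeightedIncidence m 1≤m A uA onS τ′ S (m≤n+m t (3 + τ′)) (n₀ ⊖_) reflected-bounded reflected-circle (reps t A)

  shift : ∀ s → tupleSum t A (λ v → reps s A (n₀ ⊖ v)) ≡ reps (t + s) A n₀
  shift s = sym (trans (tupleSum-+ t s A (λ u → ⟦ u ≟P n₀ ⟧)) (∑-cong (tuples t A) λ w → ∑-cong (tuples s A) λ w′ →
    ⟦⟧-cong ((sumP w ⊕ sumP w′) ≟P n₀) (sumP w′ ≟P (n₀ ⊖ sumP w)) (λ { refl → sym (⊕-⊖ (sumP w) (sumP w′)) })
      (λ e → trans (cong (sumP w ⊕_) e) (⊖-⊕ (sumP w) n₀))))

  I≡ : WI.I WI.r ≡ reps (t + suc t) A n₀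
  I≡ = trans (∑-cong WI.Ω λ v → cong (_*_ (reps t A v)) (trans (cube-sum t WI.t*m≤S*m (adj (n₀ ⊖ v))) (sym (reps-adj t (n₀ ⊖ v)))))
    (trans (cube-sum t WI.t*m≤S*m (λ v → reps (suc t) A (n₀ ⊖ v))) (shift (suc t)))

  E₂≡ : WI.E₂ ≡ energy t A
  E₂≡ = cube-sum t WI.t*m≤S*m (reps t A)

  G≡ : WI.G ≡ #A ^ t
  G≡ = cube-total t WI.t*m≤S*m

  W≤ : WI.W ≤ 2 * k * (#A * #A ^ τ′)
  W≤ = ≤-trans (≤-reflexive (trans (cube-sum t WI.t*m≤S*m (λ v → adj (n₀ ⊖ v) origin)) (trans
      (∑-cong (tuples t A) λ w → sym (trans (reps-adj 0 (n₀ ⊖ sumP w)) (+-identityʳ _)))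
      (trans (shift 1) (cong (λ s → reps s A n₀) (+-comm t 1))))))
    (reps-three-≤ τ′ n₀)

  outcome : 1 ≤ #A → Bound (T₃ S τ′ m) #A (#A ^ τ′) (#A ^ t) (energy t A) (#A ^ t) (energy t A) WI.W (reps (t + suc t) A n₀)
  outcome 1≤#A = subst₂ (λ G E → Bound (T₃ S τ′ m) #A (#A ^ τ′) (#A ^ t) (energy t A) G E WI.W (reps (t + suc t) A n₀)) G≡ E₂≡
    (subst (Bound (T₃ S τ′ m) #A (#A ^ τ′) (#A ^ t) (energy t A) WI.G WI.E₂ WI.W) I≡ (WI.bound 1≤#A))

data OddBound (C T a p q E x : ℕ) : Set where
  small  : x ≤ C * (a * a * (p * p)) → OddBound C T a p q E x
  capped : a * (x * x) ≤ T * (q * q * E) → OddBound C T a p q E x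
  fifth  : x * ((x * x) * (x * x)) ≤ T * (E * (E * E) * ((q * q) * (q * q))) → OddBound C T a p q E x

odd-trichotomy : ∀ {T k a p E W x} → 1 ≤ k → W ≤ 2 * k * (a * p) → Bound T a p (a * (a * p)) E (a * (a * p)) E W x →
  OddBound (2 * k * T) T a p (a * (a * p)) E x
odd-trichotomy {T} {k} {a} {p} 1≤k W≤ (atOrigin h) = small (≤-trans h (≤-trans (*-monoʳ-≤ T (*-monoʳ-≤ (a * p) W≤)) (≤-reflexive (lemma T a p k))))
  where
  lemma : ∀ T a p k → T * (a * p * (2 * k * (a * p))) ≡ 2 * k * T * (a * a * (p * p))
  lemma = ℕ-ring
odd-trichotomy {T} {k} {a} {p} 1≤k W≤ (linear h) = small (≤-trans h (≤-trans (m≤m*n′ _ (*-mono-≤ (s≤s (z≤n {1})) 1≤k)) (≤-reflexive (lemma T a p k))))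
  where
  lemma : ∀ T a p k → T * (p * (a * (a * p))) * (2 * k) ≡ 2 * k * T * (a * a * (p * p))
  lemma = ℕ-ring
odd-trichotomy 1≤k W≤ (capped h) = capped h
odd-trichotomy {T} {k} {a} {p} {E} 1≤k W≤ (fifth h) = fifth (≤-trans h (≤-reflexive (lemma T E (a * (a * p)))))
  where
  lemma : ∀ T E q → T * (E * (q * q * q) * q * (E * E)) ≡ T * (E * (E * E) * ((q * q) * (q * q)))
  lemma = ℕ-ring

fifth^ : ∀ x n → (x * ((x * x) * (x * x))) ^ n ≡ x ^ (5 * n)
fifth^ x n = trans (cong (_^ n) (lemma x)) (^-*-assoc x 5 n)
  where
  lemma : ∀ x → x * ((x * x) * (x * x)) ≡ x * (x * (x * (x * (x * 1))))
  lemma = ℕ-ring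

oddExponent : ℕ → ℕ
oddExponent τ′ = 4 * (2 + τ′) * eb τ′ + 3 * ea τ′

-- Only `fifth` is sharp, with exponent (4t + 3e)/5. The exponents 2t - 2 of `small` and (2t - 1 +
-- e)/2 of `capped` are strictly smaller.
odd-exponents : ∀ {C T a E T′ x} τ′ → 1 ≤ T → T ≤ C → 1 ≤ T′ → 1 ≤ a → PowBound E (eb τ′) T′ a (ea τ′) →
  OddBound C T a (a ^ τ′) (a ^ (2 + τ′)) E x → PowBound x (5 * eb τ′) (C ^ (5 * eb τ′) * T′ ^ 5) a (oddExponent τ′)
odd-exponents {C} {T} {a} {E} {T′} {x} τ′ 1≤T T≤C 1≤T′ 1≤a hE (small h) = begin
  x ^ (5 * b) ≤⟨ ^-monoˡ-≤ (5 * b) (≤-trans h (≤-reflexive (cong (_*_ C) power))) ⟩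
  (C * a ^ (2 + (τ′ + τ′))) ^ (5 * b) ≡⟨ trans (*-^ C _ (5 * b)) (cong (_*_ (C ^ (5 * b))) (^-*-assoc a (2 + (τ′ + τ′)) (5 * b))) ⟩
  C ^ (5 * b) * a ^ ((2 + (τ′ + τ′)) * (5 * b)) ≤⟨ *-mono-≤ (m≤m*n′ (C ^ (5 * b)) (1≤^ 5 1≤T′)) (1≤→^≤ 1≤a exponent) ⟩
  C ^ (5 * b) * T′ ^ 5 * a ^ oddExponent τ′ ∎
  where
  open ≤-Reasoning
  b : ℕ
  b = eb τ′
  power : a * a * (a ^ τ′ * a ^ τ′) ≡ a ^ (2 + (τ′ + τ′))
  power = trans (*-assoc a a _) (cong (λ z → a * (a * z)) (sym (^-distribˡ-+-* a τ′ τ′)))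
  exponent : (2 + (τ′ + τ′)) * (5 * b) ≤ oddExponent τ′
  exponent = ≤-trans (m≤m+n _ (5 * 3 ^ τ′ + 3)) (≤-reflexive (lemma τ′ (3 ^ τ′)))
    where
    lemma : ∀ t X → (2 + (t + t)) * (5 * (2 * X)) + (5 * X + 3) ≡ 4 * (2 + t) * (2 * X) + 3 * ((3 + 4 * t) * X + 1)
    lemma = ℕ-ring
-- The hypothesis controls a x², so the claim is proved in squared form after multiplication by
-- a^(5b).
odd-exponents {C} {T} {a} {E} {T′} {x} τ′ 1≤T T≤C 1≤T′ 1≤a hE (capped h) = square-cancel-≤ (*-cancelʳ-≤ _ _ (a ^ (5 * b)) {{>-nonZero (1≤^ (5 * b) 1≤a)}} (begin
  x ^ (5 * b) * x ^ (5 * b) * a ^ (5 * b) ≡⟨ lhs ⟩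
  (a * (x * x)) ^ (5 * b) ≤⟨ ^-monoˡ-≤ (5 * b) h ⟩
  (T * (q * q * E)) ^ (5 * b) ≡⟨ trans (*-^ T (q * q * E) (5 * b)) (cong (_*_ (T ^ (5 * b))) (trans (*-^ (q * q) E (5 * b)) (cong₂ _*_ qpow Epow))) ⟩
  T ^ (5 * b) * (a ^ ((2 + τ′) * (10 * b)) * (E ^ b) ^ 5)  ≤⟨ *-mono-≤ (^-monoˡ-≤ (5 * b) T≤C) (*-monoʳ-≤ (a ^ ((2 + τ′) * (10 * b))) (≤-trans (^-monoˡ-≤ 5 hE) (≤-reflexive (trans (*-^ T′ _ 5) (cong (_*_ (T′ ^ 5)) (^-*-assoc a (ea τ′) 5)))))) ⟩
  C ^ (5 * b) * (a ^ ((2 + τ′) * (10 * b)) * (T′ ^ 5 * a ^ (ea τ′ * 5)))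
      ≡⟨ gather (C ^ (5 * b)) (a ^ ((2 + τ′) * (10 * b))) (T′ ^ 5) (a ^ (ea τ′ * 5)) ⟩
  K * (a ^ ((2 + τ′) * (10 * b)) * a ^ (ea τ′ * 5)) ≡⟨ cong (_*_ K) (^-distribˡ-+-* a ((2 + τ′) * (10 * b)) (ea τ′ * 5)) ⟨
  K * a ^ ((2 + τ′) * (10 * b) + ea τ′ * 5) ≤⟨ *-mono-≤ (m≤m*m K) (1≤→^≤ 1≤a exponent) ⟩
  K * K * a ^ (oddExponent τ′ + oddExponent τ′ + 5 * b) ≡⟨ cong (_*_ (K * K)) (trans (^-distribˡ-+-* a (oddExponent τ′ + oddExponent τ′) (5 * b)) (cong (_* a ^ (5 * b)) (^-distribˡ-+-* a (oddExponent τ′) (oddExponent τ′)))) ⟩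
  K * K * (a ^ oddExponent τ′ * a ^ oddExponent τ′ * a ^ (5 * b))
      ≡⟨ gather′ K (a ^ oddExponent τ′) (a ^ (5 * b)) ⟩
  K * a ^ oddExponent τ′ * (K * a ^ oddExponent τ′) * a ^ (5 * b) ∎))
  where
  open ≤-Reasoning
  b q K : ℕ
  b = eb τ′
  q = a ^ (2 + τ′)
  K = C ^ (5 * b) * T′ ^ 5
  lhs : x ^ (5 * b) * x ^ (5 * b) * a ^ (5 * b) ≡ (a * (x * x)) ^ (5 * b)
  lhs = trans (*-comm _ (a ^ (5 * b))) (sym (trans (*-^ a (x * x) (5 * b)) (cong (_*_ (a ^ (5 * b))) (*-^ x x (5 * b)))))
  qpow : (q * q) ^ (5 * b) ≡ a ^ ((2 + τ′) * (10 * b))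
  qpow = trans (*-^ q q (5 * b)) (trans (sym (^-distribˡ-+-* q (5 * b) (5 * b))) (trans (^-*-assoc a (2 + τ′) (5 * b + 5 * b)) (cong (λ e → a ^ ((2 + τ′) * e)) (lemma b))))
    where
    lemma : ∀ b → 5 * b + 5 * b ≡ 10 * b
    lemma = ℕ-ring
  Epow : E ^ (5 * b) ≡ (E ^ b) ^ 5
  Epow = trans (cong (E ^_) (*-comm 5 b)) (sym (^-*-assoc E b 5))
  gather : ∀ c y t z → c * (y * (t * z)) ≡ c * t * (y * z)
  gather = ℕ-ring
  gather′ : ∀ k y z → k * k * (y * y * z) ≡ k * y * (k * y) * z
  gather′ = ℕ-ring
  exponent : (2 + τ′) * (10 * b) + ea τ′ * 5 ≤ oddExponent τ′ + oddExponent τ′ + 5 * b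
  exponent = ≤-trans (m≤m+n _ (5 * 3 ^ τ′ + 1)) (≤-reflexive (lemma τ′ (3 ^ τ′)))
    where
    lemma : ∀ t X → (2 + t) * (10 * (2 * X)) + ((3 + 4 * t) * X + 1) * 5 + (5 * X + 1) ≡
      4 * (2 + t) * (2 * X) + 3 * ((3 + 4 * t) * X + 1) + (4 * (2 + t) * (2 * X) + 3 * ((3 + 4 * t) * X + 1)) + 5 * (2 * X)
    lemma = ℕ-ring
odd-exponents {C} {T} {a} {E} {T′} {x} τ′ 1≤T T≤C 1≤T′ 1≤a hE (fifth h) = begin
  x ^ (5 * b) ≡⟨ fifth^ x b ⟨
  (x * ((x * x) * (x * x))) ^ b ≤⟨ ^-monoˡ-≤ b h ⟩
  (T * (E * (E * E) * ((q * q) * (q * q)))) ^ b ≡⟨ trans (*-^ T _ b) (cong (_*_ (T ^ b)) (trans (*-^ (E * (E * E)) _ b) (cong₂ _*_ Epow qpow))) ⟩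
  T ^ b * ((E ^ b) ^ 3 * a ^ (4 * (2 + τ′) * b)) ≤⟨ *-mono-≤ constant (*-monoˡ-≤ _ (≤-trans (^-monoˡ-≤ 3 hE) (≤-reflexive (trans (*-^ T′ _ 3) (cong (_*_ (T′ ^ 3)) (^-*-assoc a (ea τ′) 3)))))) ⟩
  C ^ (5 * b) * (T′ ^ 3 * a ^ (ea τ′ * 3) * a ^ (4 * (2 + τ′) * b))
      ≤⟨ *-monoʳ-≤ (C ^ (5 * b)) (*-monoˡ-≤ _ (*-monoˡ-≤ _ (1≤→^≤ {T′} {3} {5} 1≤T′ (s≤s (s≤s (s≤s z≤n)))))) ⟩
  C ^ (5 * b) * (T′ ^ 5 * a ^ (ea τ′ * 3) * a ^ (4 * (2 + τ′) * b))
      ≡⟨ gather (C ^ (5 * b)) (T′ ^ 5) (a ^ (ea τ′ * 3)) (a ^ (4 * (2 + τ′) * b)) ⟩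
  C ^ (5 * b) * T′ ^ 5 * (a ^ (4 * (2 + τ′) * b) * a ^ (ea τ′ * 3))
      ≡⟨ cong (_*_ (C ^ (5 * b) * T′ ^ 5)) (trans (sym (^-distribˡ-+-* a (4 * (2 + τ′) * b) (ea τ′ * 3))) (cong (λ e → a ^ (4 * (2 + τ′) * b + e)) (*-comm (ea τ′) 3))) ⟩
  C ^ (5 * b) * T′ ^ 5 * a ^ oddExponent τ′ ∎
  where
  open ≤-Reasoning
  b q : ℕ
  b = eb τ′
  q = a ^ (2 + τ′)
  constant : T ^ b ≤ C ^ (5 * b)
  constant = ≤-trans (^-monoˡ-≤ b T≤C) (1≤→^≤ (≤-trans 1≤T T≤C) (m≤m+n b _))
  Epow : (E * (E * E)) ^ b ≡ (E ^ b) ^ 3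
  Epow = trans (cube^ E b) (trans (cong (E ^_) (*-comm 3 b)) (sym (^-*-assoc E b 3)))
  qpow : ((q * q) * (q * q)) ^ b ≡ a ^ (4 * (2 + τ′) * b)
  qpow = trans (cong (_^ b) (trans (fourth q) (trans (^-*-assoc a (2 + τ′) 4) (cong (a ^_) (*-comm (2 + τ′) 4))))) (^-*-assoc a (4 * (2 + τ′)) b)
    where
    fourth : ∀ q → (q * q) * (q * q) ≡ q * (q * (q * (q * 1)))
    fourth = ℕ-ring
  gather : ∀ c t y z → c * (t * y * z) ≡ c * t * (z * y)
  gather = ℕ-ring

oddConstant : ℕ → ℕ → ℕ
oddConstant τ′ m = (2 * circleBound m * T₃ (3 + τ′ + (2 + τ′)) τ′ m) ^ (5 * eb τ′) * energyConstant τ′ m ^ 5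

subPoly-oddConstant : ∀ τ′ → SubPoly (oddConstant τ′)
subPoly-oddConstant τ′ = subPoly-* (subPoly-^ (subPoly-* (subPoly-* (subPoly-const 2) subPoly-circleBound) (subPoly-T₃ (3 + τ′ + (2 + τ′)) τ′)) (5 * eb τ′))
  (subPoly-^ (subPoly-energyConstant τ′) 5)

0^ : ∀ n → 1 ≤ n → 0 ^ n ≡ 0
0^ (suc n) _ = refl

-- The offsets must be polynomial in m, which requires a bounded n. If n has no representation the
-- claim is trivial; otherwise n is a sum of 2t + 1 points of A and inherits their bound.
odd-bound : ∀ τ′ m → 1 ≤ m → (A : List Point) → Unique A → All (InS3 m) A → ∀ n →
  PowBound (reps ((2 + τ′) + (3 + τ′)) A n) (5 * eb τ′) (oddConstant τ′ m) (length A) (oddExponent τ′)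
odd-bound τ′ m 1≤m A uA onS n with reps ((2 + τ′) + (3 + τ′)) A n in eq
... | zero  = ≤-trans (≤-reflexive (0^ (5 * eb τ′) (*-mono-≤ (s≤s (z≤n {4})) (1≤eb τ′)))) z≤n
... | suc x = nonempty A uA onS eq
  where
  nonempty : ∀ A → Unique A → All (InS3 m) A → reps ((2 + τ′) + (3 + τ′)) A n ≡ suc x → PowBound (suc x) (5 * eb τ′) (oddConstant τ′ m) (length A) (oddExponent τ′)
  nonempty [] _ _ ()
  nonempty A@(_ ∷ _) uA onS eq = odd-exponents τ′ (1≤T₃ S τ′ m) T≤ (1≤energyConstant τ′ m) (s≤s z≤n) (energy-bound τ′ m 1≤m A uA onS)
    (subst (OddBound (2 * circleBound m * T₃ S τ′ m) (T₃ S τ′ m) (length A) (length A ^ τ′) (length A ^ (2 + τ′)) (energy (2 + τ′) A)) eq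
      (odd-trichotomy (1≤circleBound m) (OddSum.W≤ m 1≤m A uA onS τ′ n n-bounded) (OddSum.outcome m 1≤m A uA onS τ′ n n-bounded (s≤s z≤n))))
    where
    S : ℕ
    S = 3 + τ′ + (2 + τ′)
    T≤ : T₃ S τ′ m ≤ 2 * circleBound m * T₃ S τ′ m
    T≤ = ≤-trans (m≤m*n′ _ (*-mono-≤ (s≤s (z≤n {1})) (1≤circleBound m))) (≤-reflexive (*-comm (T₃ S τ′ m) (2 * circleBound m)))
    n-bounded : Bounded (S * m) n
    n-bounded with ∑-positive (tuples ((2 + τ′) + (3 + τ′)) A) (λ w → ⟦ sumP w ≟P n ⟧) (subst (1 ≤_) (sym eq) (s≤s z≤n))
    ... | w , w∈ , h = subst (Bounded (S * m)) (⟦⟧-pos (sumP w ≟P n) h)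
      (bounded-≤ (sumP w) (*-monoˡ-≤ m (≤-reflexive (+-comm (2 + τ′) (3 + τ′)))) (All.lookup (OnSphere.sums-bounded m A uA onS ((2 + τ′) + (3 + τ′))) w∈))

even-bound : ∀ τ′ m → 1 ≤ m → (A : List Point) → Unique A → All (InS3 m) A → ∀ n →
  PowBound (reps ((2 + τ′) + (2 + τ′)) A n) (eb τ′) (energyConstant τ′ m) (length A) (ea τ′)
even-bound τ′ m 1≤m A uA onS n = ≤-trans (^-monoˡ-≤ (eb τ′) (reps-even≤energy m (2 + τ′) A n uA onS)) (energy-bound τ′ m 1≤m A uA onS)

-- From subpolynomial factors to rational exponents

-- With x ≤ T a^(α/β), T^K ≤ C m and 1/K ≤ p/d, taking (β K)-th powers gives x^d ≤ C^d m^p a^q for q/d = α/β.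
PowBound⇒power : ∀ x T a m C K α β d p q → 1 ≤ m → 1 ≤ K → 1 ≤ β → PowBound x β T a α → T ^ K ≤ C * m →
  d ≤ p * K → q * β ≡ α * d → x ^ d ≤ suc C ^ d * m ^ p * a ^ q
PowBound⇒power x T a m C K α β d p q 1≤m 1≤K 1≤β hx hT d≤pK qβ≡αd = ^-cancelˡ-≤ (β * K) {{>-nonZero 1≤βK}} (begin
  (x ^ d) ^ (β * K) ≡⟨ trans (^-*-assoc x d (β * K)) (trans (cong (x ^_) (l₁ d β K)) (sym (^-*-assoc x β (K * d)))) ⟩
  (x ^ β) ^ (K * d) ≤⟨ ^-monoˡ-≤ (K * d) hx ⟩
  (T * a ^ α) ^ (K * d) ≡⟨ trans (*-^ T (a ^ α) (K * d)) (cong₂ _*_ (sym (^-*-assoc T K d)) apow) ⟩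
  (T ^ K) ^ d * (a ^ q) ^ (β * K) ≤⟨ *-monoˡ-≤ _ (≤-trans (^-monoˡ-≤ d (≤-trans hT (*-monoˡ-≤ m (n≤1+n C)))) (≤-trans (≤-reflexive (*-^ (suc C) m d)) (*-mono-≤ Cpow mpow))) ⟩
  (suc C ^ d) ^ (β * K) * (m ^ p) ^ (β * K) * (a ^ q) ^ (β * K)
      ≡⟨ trans (*-^ (suc C ^ d * m ^ p) (a ^ q) (β * K)) (cong (_* (a ^ q) ^ (β * K)) (*-^ (suc C ^ d) (m ^ p) (β * K))) ⟨
  (suc C ^ d * m ^ p * a ^ q) ^ (β * K) ∎)
  where
  open ≤-Reasoning
  1≤βK : 1 ≤ β * K
  1≤βK = *-mono-≤ 1≤β 1≤K
  l₁ : ∀ d b k → d * (b * k) ≡ b * (k * d)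
  l₁ = ℕ-ring
  l₂ : ∀ a k d → a * (k * d) ≡ a * d * k
  l₂ = ℕ-ring
  apow : (a ^ α) ^ (K * d) ≡ (a ^ q) ^ (β * K)
  apow = trans (^-*-assoc a α (K * d)) (trans (cong (a ^_) (trans (l₂ α K d) (trans (cong (_* K) (sym qβ≡αd)) (*-assoc q β K)))) (sym (^-*-assoc a q (β * K))))
  -- The successor makes the base at least 1, so that raising the exponent cannot decrease the
  -- power.
  Cpow : suc C ^ d ≤ (suc C ^ d) ^ (β * K)
  Cpow = ≤-trans (1≤→^≤ (s≤s z≤n) (m≤m*n′ d 1≤βK)) (≤-reflexive (sym (^-*-assoc (suc C) d (β * K))))
  mpow : m ^ d ≤ (m ^ p) ^ (β * K)
  mpow = ≤-trans (1≤→^≤ 1≤m (≤-trans d≤pK (*-monoʳ-≤ p (≤-trans (m≤m*n′ K 1≤β) (≤-reflexive (*-comm K β)))))) (≤-reflexive (sym (^-*-assoc m p (β * K))))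

-- A positive ε with reduced denominator K is at least 1/K. This holds for every way p/d of writing
-- ε, so K can be chosen before p and d.
positive-denominator : (ε : ℚ) → 0ℚ ℚ.< ε → (d p : ℕ) .{{_ : NonZero d}} → ε ≡ (+ p) ℚ./ d → d ≤ p * ℚ.↧ₙ ε
positive-denominator ε@(ℚ.mkℚ (+ suc N) D _) _ d p ε≡ = ≤-trans (m≤m+n d (N * d))
  (≤-reflexive (cross-multiply (suc N) (suc D) p d (trans (ℚₚ.↥p/↧p≡p ε) ε≡)))
positive-denominator (ℚ.mkℚ (+ zero) _ _)  0<ε _ _ _ = contradiction (ℚ.positive 0<ε) λ ()
positive-denominator (ℚ.mkℚ -[1+ _ ] _ _) 0<ε _ _ _ = contradiction (ℚ.positive 0<ε) λ ()

finish : ∀ s α β .{{_ : NonZero β}} → expo s ≡ (+ α) ℚ./ β → (T : ℕ → ℕ) → SubPoly T →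
  (∀ m → 1 ≤ m → (A : List Point) → Unique A → All (InS3 m) A → ∀ n → PowBound (reps s A n) β (T m) (length A) α) →
  (ε : ℚ) → 0ℚ ℚ.< ε → Σ ℕ λ C → ∀ m → 1 ≤ m → (A : List Point) → Unique A → All (InS3 m) A → ∀ n →
    BoundPow (rep s A n) C m (length A) ε (expo s)
finish s α β expo≡ T subPoly bound ε 0<ε = suc C , λ m 1≤m A uA onS n d p q ε≡ q/d≡ →
  subst (λ x → x ^ d ≤ suc C ^ d * m ^ p * length A ^ q) (sym (rep≡reps s A n))
    (PowBound⇒power (reps s A n) (T m) (length A) m C K α β d p q 1≤m (s≤s z≤n) (>-nonZero⁻¹ β) (bound m 1≤m A uA onS n) (T^K≤ m 1≤m)
      (positive-denominator ε 0<ε d p ε≡) (cross-multiply q d α β (trans (sym q/d≡) expo≡)))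
  where
  K C : ℕ
  -- T^K ≤ C m with 1/K ≤ ε gives T ≪ m^ε, and this K and C depend on ε but not on the
  -- representations p/d and q/d.
  K = ℚ.↧ₙ ε
  C = proj₁ (subPoly K)
  T^K≤ : ∀ m → 1 ≤ m → T m ^ K ≤ C * m
  T^K≤ = proj₂ (subPoly K)

split-parity : ∀ s → 4 ≤ s → Σ ℕ λ τ′ → s ≡ (2 + τ′) + (2 + τ′) ⊎ s ≡ (2 + τ′) + (3 + τ′)
split-parity s 4≤s with s ∸ 4 | m+[n∸m]≡n 4≤s
... | n | refl = shifted (halves n)
  where
  halves : ∀ n → Σ ℕ λ τ′ → n ≡ τ′ + τ′ ⊎ n ≡ suc (τ′ + τ′)
  halves zero = 0 , inj₁ refl
  halves (suc n) with halves n
  ... | h , inj₁ e = h , inj₂ (cong suc e)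
  ... | h , inj₂ e = suc h , inj₁ (cong suc (trans e (sym (+-suc h h))))
  even : ∀ h → 4 + (h + h) ≡ (2 + h) + (2 + h)
  even = ℕ-ring
  odd : ∀ h → 4 + (1 + (h + h)) ≡ (2 + h) + (3 + h)
  odd = ℕ-ring
  shifted : (Σ ℕ λ τ′ → n ≡ τ′ + τ′ ⊎ n ≡ suc (τ′ + τ′)) → Σ ℕ λ τ′ → 4 + n ≡ (2 + τ′) + (2 + τ′) ⊎ 4 + n ≡ (2 + τ′) + (3 + τ′)
  shifted (h , inj₁ e) = h , inj₁ (trans (cong (_+_ 4) e) (even h))
  shifted (h , inj₂ e) = h , inj₂ (trans (cong (_+_ 4) e) (odd h))

theorem1p4 : (s : ℕ) → 4 ≤ s → (ε : ℚ) → 0ℚ ℚ.< ε →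
    Σ ℕ (λ C → (m : ℕ) → 1 ≤ m → (A : List Point) → Unique A → All (InS3 m) A →
    (n : Point) → BoundPow (rep s A n) C m (length A) ε (expo s))
theorem1p4 s 4≤s ε 0<ε with split-parity s 4≤s
... | τ′ , inj₁ refl = finish ((2 + τ′) + (2 + τ′)) (ea τ′) (eb τ′) (expo-even τ′) (energyConstant τ′) (subPoly-energyConstant τ′) (even-bound τ′) ε 0<ε
  where instance _ = >-nonZero (1≤eb τ′)
... | τ′ , inj₂ refl = finish ((2 + τ′) + (3 + τ′)) (oddExponent τ′) (5 * eb τ′) (expo-odd τ′) (oddConstant τ′) (subPoly-oddConstant τ′) (odd-bound τ′) ε 0<ε
  where instance _ = >-nonZero (*-mono-≤ (s≤s (z≤n {4})) (1≤eb τ′))
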